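{- There is an algorithm that, given an $L$-shaped supergrid graph $L(m,n;k,l)$ and two distinct vertices $s$ and $t$ of it, computes a longest $(s,t)$-path of $L(m,n;k,l)$ in $O(mn)$ time.
   Context: The infinite supergrid graph has as vertices all points $(x,y)\in\mathbb{Z}^2$, two distinct vertices $u,v$ being adjacent iff $|u_x-v_x|\le 1$ and $|u_y-v_y|\le 1$. For integers $m,n>1$ and $k,l\ge 1$ with $m-k\ge 1$, $n-l\ge 1$, $L(m,n;k,l)$ is the subgraph of this infinite graph induced by $\{(x,y):1\le x\le m,\ 1\le y\le n\}\setminus\{(x,y): m-k+1\le x\le m,\ 1\le y\le l\}$. A longest $(s,t)$-path is a simple path from $s$ to $t$ having the maximum number of vertices among all simple paths from $s$ to $t$. -}

module Defs where

open import Data.Bool using (Bool; true; false; not; _∧_; if_then_else_)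
open import Data.Integer using (ℤ; +_; 1ℤ; ∣_∣) renaming (_+_ to _+ℤ_; _-_ to _-ℤ_; _≤_ to _≤ℤ_)
open import Data.List using (List; length; head; last; applyUpTo)
open import Data.List.Relation.Unary.All using (All)
open import Data.List.Relation.Unary.Linked using (Linked)
open import Data.List.Relation.Unary.Unique.Propositional using (Unique)
open import Data.Maybe using (just)
open import Data.Nat using (ℕ; _+_; _*_; _∸_; _≤_; _≤ᵇ_; _≡ᵇ_)
open import Data.Product using (_×_; _,_; proj₁; proj₂)
open import Data.Unit using (⊤)
open import Level using (0ℓ)
open import Relation.Binary.Core using (Rel)
open import Relation.Binary.PropositionalEquality using (_≡_; _≢_)
open import Relation.Nullary using (¬_)
open import Relation.Unary using (Pred)

Point : Set
Point = ℤ × ℤ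

record Graph : Set₁ where
  field
    Vertex : Pred Point 0ℓ
    Adj    : Rel Point 0ℓ

open Graph public

supergrid : Graph
supergrid .Vertex _ = ⊤
supergrid .Adj u v =
  u ≢ v ×
  ∣ proj₁ u -ℤ proj₁ v ∣ ≤ 1 ×
  ∣ proj₂ u -ℤ proj₂ v ∣ ≤ 1

induced : Graph → Pred Point 0ℓ → Graph
induced G P .Vertex v = Vertex G v × P v
induced G P .Adj u v  = Adj G u v × P u × P v

InBox : (a b c d : ℤ) → Pred Point 0ℓ
InBox a b c d (x , y) = (a ≤ℤ x × x ≤ℤ b) × (c ≤ℤ y × y ≤ℤ d)

L : (m n k l : ℕ) → Graph
L m n k l = induced supergrid λ v →
  InBox 1ℤ (+ m) 1ℤ (+ n) v ×
  ¬ InBox ((+ m -ℤ + k) +ℤ 1ℤ) (+ m) 1ℤ (+ l) v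

record IsPath (G : Graph) (s t : Point) (p : List Point) : Set where
  field
    vertices : All (Vertex G) p
    linked   : Linked (Adj G) p
    simple   : Unique p
    starts   : head p ≡ just s
    ends     : last p ≡ just t

record IsLongestPath (G : Graph) (s t : Point) (p : List Point) : Set where
  field
    isPath  : IsPath G s t p
    longest : ∀ q → IsPath G s t q → length q ≤ length p

-- The model of computation is structured programs for a random access
-- machine under the uniform cost criterion.  A program mentions finitely
-- many registers; the memory is addressed by computed values.  As the
-- only arithmetic is addition and truncated subtraction, there is no
-- unit-cost multiplication, division or bit manipulation.

record State : Set where
  constructor ⟪_,_⟫
  field
    reg : ℕ → ℕ
    mem : ℕ → ℕ

open State public

_[_↦_] : (ℕ → ℕ) → ℕ → ℕ → (ℕ → ℕ)
(f [ i ↦ a ]) j = if j ≡ᵇ i then a else f j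

infixl 6 _⊕_ _⊖_
infix  5 _≤ᵉ_ _≡ᵉ_
infixr 4 _andᵇ_

data Expr : Set where
  lit     : ℕ → Expr
  var     : ℕ → Expr
  load    : Expr → Expr
  _⊕_ _⊖_ : Expr → Expr → Expr

data Cond : Set where
  _≤ᵉ_ _≡ᵉ_ : Expr → Expr → Cond
  notᵇ      : Cond → Cond
  _andᵇ_    : Cond → Cond → Cond

infix  3 _≔_ mem[_]≔_
infixr 2 _⨾_

data Program : Set where
  skip          : Program
  _≔_           : ℕ → Expr → Program
  mem[_]≔_      : Expr → Expr → Program
  _⨾_           : Program → Program → Program
  ifᵖ_then_else_ : Cond → Program → Program → Program
  while_loop_   : Cond → Program → Program

⟦_⟧ : Expr → State → ℕ
⟦ lit a ⟧   σ = a
⟦ var x ⟧   σ = reg σ x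
⟦ load e ⟧  σ = mem σ (⟦ e ⟧ σ)
⟦ e ⊕ e′ ⟧  σ = ⟦ e ⟧ σ + ⟦ e′ ⟧ σ
⟦ e ⊖ e′ ⟧  σ = ⟦ e ⟧ σ ∸ ⟦ e′ ⟧ σ

⟦_⟧ᵇ : Cond → State → Bool
⟦ e ≤ᵉ e′ ⟧ᵇ   σ = ⟦ e ⟧ σ ≤ᵇ ⟦ e′ ⟧ σ
⟦ e ≡ᵉ e′ ⟧ᵇ   σ = ⟦ e ⟧ σ ≡ᵇ ⟦ e′ ⟧ σ
⟦ notᵇ b ⟧ᵇ    σ = not (⟦ b ⟧ᵇ σ)
⟦ b andᵇ b′ ⟧ᵇ σ = ⟦ b ⟧ᵇ σ ∧ ⟦ b′ ⟧ᵇ σ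

-- Evaluation is charged one unit per node of the syntax tree.
cost : Expr → ℕ
cost (lit _)  = 1
cost (var _)  = 1
cost (load e) = 1 + cost e
cost (e ⊕ e′) = 1 + cost e + cost e′
cost (e ⊖ e′) = 1 + cost e + cost e′

costᵇ : Cond → ℕ
costᵇ (e ≤ᵉ e′)   = 1 + cost e + cost e′
costᵇ (e ≡ᵉ e′)   = 1 + cost e + cost e′
costᵇ (notᵇ b)    = 1 + costᵇ b
costᵇ (b andᵇ b′) = 1 + costᵇ b + costᵇ b′

infix 1 ⟨_,_⟩⇓[_]_

data ⟨_,_⟩⇓[_]_ : Program → State → ℕ → State → Set where

  ⇓skip : ∀ {σ} →
    ⟨ skip , σ ⟩⇓[ 1 ] σ

  ⇓assign : ∀ {x e σ} →
    ⟨ x ≔ e , σ ⟩⇓[ 1 + cost e ] ⟪ reg σ [ x ↦ ⟦ e ⟧ σ ] , mem σ ⟫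

  ⇓store : ∀ {a e σ} →
    ⟨ mem[ a ]≔ e , σ ⟩⇓[ 1 + cost a + cost e ] ⟪ reg σ , mem σ [ ⟦ a ⟧ σ ↦ ⟦ e ⟧ σ ] ⟫

  ⇓seq : ∀ {P Q σ σ′ σ″ c d} →
    ⟨ P , σ ⟩⇓[ c ] σ′ →
    ⟨ Q , σ′ ⟩⇓[ d ] σ″ →
    ⟨ P ⨾ Q , σ ⟩⇓[ c + d ] σ″

  ⇓if-true : ∀ {b P Q σ σ′ c} →
    ⟦ b ⟧ᵇ σ ≡ true →
    ⟨ P , σ ⟩⇓[ c ] σ′ →
    ⟨ ifᵖ b then P else Q , σ ⟩⇓[ 1 + costᵇ b + c ] σ′

  ⇓if-false : ∀ {b P Q σ σ′ c} →
    ⟦ b ⟧ᵇ σ ≡ false →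
    ⟨ Q , σ ⟩⇓[ c ] σ′ →
    ⟨ ifᵖ b then P else Q , σ ⟩⇓[ 1 + costᵇ b + c ] σ′

  ⇓while-true : ∀ {b P σ σ′ σ″ c d} →
    ⟦ b ⟧ᵇ σ ≡ true →
    ⟨ P , σ ⟩⇓[ c ] σ′ →
    ⟨ while b loop P , σ′ ⟩⇓[ d ] σ″ →
    ⟨ while b loop P , σ ⟩⇓[ 1 + costᵇ b + c + d ] σ″

  ⇓while-false : ∀ {b P σ} →
    ⟦ b ⟧ᵇ σ ≡ false →
    ⟨ while b loop P , σ ⟩⇓[ 1 + costᵇ b ] σ

-- Vertices of L m n k l have positive coordinates, so ∣_∣ loses nothing.
inputRegs : (m n k l : ℕ) (s t : Point) → ℕ → ℕ
inputRegs m n k l (sx , sy) (tx , ty) = λ where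
  0 → m
  1 → n
  2 → k
  3 → l
  4 → ∣ sx ∣
  5 → ∣ sy ∣
  6 → ∣ tx ∣
  7 → ∣ ty ∣
  _ → 0

input : (m n k l : ℕ) (s t : Point) → State
input m n k l s t = ⟪ inputRegs m n k l s t , (λ _ → 0) ⟫

-- Register 0 holds the number of vertices; the i-th vertex (from 0) is
-- stored in memory cells 2i and 2i + 1.
output : State → List Point
output σ = applyUpTo (λ i → + mem σ (2 * i) , + mem σ (2 * i + 1)) (reg σ 0)

{-# OPTIONS --safe #-}
module Submission where

-- The region is cut into few rectangles that a path visits one after the
-- other.  A rectangle of the king's graph can be swept from a corner to any
-- other corner column by column, the last two columns being swept in zigzag if
-- the parity is wrong, and from a point to a corner by a few such sweeps.  The
-- cuts run along the sides of the region and through or next to s and t, so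
-- that the validity of a decomposition is a condition on differences of
-- coordinates, which the program tests; that some listed decomposition applies
-- to each input, and that it covers what it has to, is decided by computation
-- with difference bound matrices.  Optimality is clear if everything is
-- covered.  Otherwise few cells s, t, … separate the region into parts; a
-- simple path visits each of these cells once, so it misses a part from one of
-- few lists, and the longest of the sweeps of what remains is taken.

open import Data.Bool using (Bool; true; false; not; if_then_else_; T; _∧_)
open import Data.Bool.ListAction using (all; any)
open import Data.Bool.Properties using (T-≡; ∧-conicalˡ; ∧-conicalʳ)
open import Data.Empty using (⊥; ⊥-elim)
open import Data.Fin using (Fin; zero; suc; toℕ) renaming (_≟_ to _≟ᶠ_)
open import Data.Integer using (ℤ; -[1+_]; 1ℤ; 0ℤ; -1ℤ; ∣_∣; +≤+; -≤+; -<+) renaming (+_ to pos; _+_ to _+ℤ_; _-_ to _-ℤ_; -_ to -ℤ_; _≤_ to _≤ℤ_; _<_ to _<ℤ_; _≤ᵇ_ to _≤ᵇℤ_; suc to sucℤ)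
import Data.Integer.Properties as ℤₚ
open import Data.List using (List; []; _∷_; [_]; _++_; _∷ʳ_; map; foldr; zip; upTo; applyUpTo; cartesianProduct; length; reverse; concat; head; last; lookup)
open import Data.List.Membership.Propositional using (_∈_)
open import Data.List.Membership.Propositional.Properties using (∈-++⁺ˡ; ∈-++⁺ʳ; ∈-++⁻; ∈-map⁺; ∈-map⁻; ∈-∃++; ∈-cartesianProduct⁺; ∈-upTo⁺)
open import Data.List.Properties using (last-map; length-++; length-map; length-upTo; length-applyUpTo; applyUpTo-∷ʳ; ++-assoc; ++-identityʳ; map-++; map-∘)
open import Data.List.Relation.Unary.All using (All; []; _∷_)
import Data.List.Relation.Unary.All as All
import Data.List.Relation.Unary.All.Properties as Allₚ
open import Data.List.Relation.Unary.AllPairs using ([]; _∷_)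
open import Data.List.Relation.Unary.Any using (Any; here; there)
import Data.List.Relation.Unary.Any as Any
import Data.List.Relation.Unary.Any.Properties as Anyₚ
open import Data.List.Relation.Unary.Linked using (Linked; []; [-]; _∷_)
import Data.List.Relation.Unary.Linked as Linked
import Data.List.Relation.Unary.Linked.Properties as Linkedₚ
open import Data.List.Relation.Unary.Unique.Propositional using (Unique)
import Data.List.Relation.Unary.Unique.Propositional.Properties as Uniqueₚ
open import Data.Maybe using (Maybe; just; nothing; is-just; _<∣>_) renaming (map to mapᴹ; zipWith to zipWithᴹ)
open import Data.Maybe.Relation.Binary.Connected using (Connected; just)
open import Data.Nat using (ℕ; zero; suc; pred; _+_; _*_; _∸_; _≤_; _<_; _≤ᵇ_; _≡ᵇ_; z≤n; s≤s; z<s; s<s; s≤s⁻¹)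
open import Data.Nat.Properties
open import Data.Nat.Solver using (module +-*-Solver)
open import Data.Product using (Σ-syntax; _×_; _,_; proj₁; proj₂; swap; map₂)
open import Data.Sum using (_⊎_; inj₁; inj₂; [_,_]′)
import Data.Sum as Sum
open import Data.Unit using (⊤; tt)
open import Data.Vec using (Vec; []; _∷_; zipWith; replicate) renaming (lookup to lookupⱽ; map to mapⱽ)
open import Data.Vec.Properties using (lookup-map; lookup-zipWith; lookup-replicate)
open import Function using (_∘_; id; case_of_)
open import Function.Bundles using (Equivalence)
open import Level using (0ℓ)
open import Relation.Binary.Core using (Rel)
open import Relation.Binary.PropositionalEquality using (_≡_; _≢_; refl; sym; trans; cong; cong₂; subst; subst₂; module ≡-Reasoning)
open import Relation.Nullary using (¬_; Dec; yes; no; contradiction)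
open import Relation.Nullary.Reflects using (Reflects; ofʸ; ofⁿ; _×-reflects_; invert)
open import Relation.Unary using (Pred)
open import Defs

-- Diagonal moves make parity harmless: two columns can be swept in zigzag, so whether a sweep
-- exists depends on comparisons of coordinates up to small constants, never on a remainder. Every
-- condition is therefore a difference constraint within one axis, a class closed under negation
-- over the integers, and one finite table of plans can serve regions of all sizes. The obstacle is
-- the number of cases, given by the relative position of s, t and the reentrant corner in both
-- axes. So the table is data that is read twice: `compile` turns it into the program, and `solves?`
-- searches for a proof that it is exhaustive and optimal. The search is sound by its type and may
-- fail; that it succeeds for `solution` is one evaluation. The same pattern, on a smaller scale,
-- yields the sweeps from a point to a corner. The time bound comes without a recurrence: the
-- program has fixed size, each piece emits a nonempty path at a bounded price per vertex, and no
-- path has more than m * n vertices.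

private variable
  A B : Set

-- Sweeps

-- A Hamiltonian path of `R` from `p` to `q`. With `R` as an index, regions add up under
-- concatenation; `complete` is what later bounds the length of competing paths.
record Sweep {A : Set} (_~_ : Rel A 0ℓ) (R : Pred A 0ℓ) (p q : A) (xs : List A) : Set where
  field
    starts   : head xs ≡ just p
    ends     : last xs ≡ just q
    linked   : Linked _~_ xs
    simple   : Unique xs
    sound    : ∀ {z} → z ∈ xs → R z
    complete : ∀ {z} → R z → z ∈ xs

open Sweep public

head-++ : ∀ {p : A} xs {ys} → head xs ≡ just p → head (xs ++ ys) ≡ just p
head-++ (x ∷ xs) eq = eq

last-++ : ∀ {q : A} xs {ys} → last ys ≡ just q → last (xs ++ ys) ≡ just q
last-++ []            eq = eq
last-++ (x ∷ [])      {y ∷ ys} eq = eq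
last-++ (x ∷ x′ ∷ xs) eq = last-++ (x′ ∷ xs) eq

module _ {_~_ : Rel A 0ℓ} where

  sweep-cell : ∀ p → Sweep _~_ (_≡ p) p p (p ∷ [])
  sweep-cell p .starts = refl
  sweep-cell p .ends = refl
  sweep-cell p .linked = [-]
  sweep-cell p .simple = [] ∷ []
  sweep-cell p .sound (here eq) = eq
  sweep-cell p .complete eq = here eq

  sweep-++ : ∀ {R R′ p q p′ q′ xs ys} →
    Sweep _~_ R p q xs → q ~ p′ → Sweep _~_ R′ p′ q′ ys →
    (∀ {z} → R z → R′ z → ⊥) →
    Sweep _~_ (λ z → R z ⊎ R′ z) p q′ (xs ++ ys)
  sweep-++ {q = q} {p′} {xs = xs} {ys} s q~p t disjoint = record
    { starts   = head-++ xs (s .starts)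
    ; ends     = last-++ xs (t .ends)
    ; linked   = Linkedₚ.++⁺ (s .linked) (joint (s .ends) (t .starts)) (t .linked)
    ; simple   = Uniqueₚ.++⁺ (s .simple) (t .simple) (λ (i , j) → disjoint (s .sound i) (t .sound j))
    ; sound    = λ i → [ inj₁ ∘ s .sound , inj₂ ∘ t .sound ]′ (∈-++⁻ xs i)
    ; complete = [ ∈-++⁺ˡ ∘ s .complete , ∈-++⁺ʳ xs ∘ t .complete ]′
    }
    where
    joint : ∀ {u v} → u ≡ just q → v ≡ just p′ → Connected _~_ u v
    joint refl refl = just q~p

  sweep-start : ∀ {R p p′ q xs} → p ≡ p′ → Sweep _~_ R p q xs → Sweep _~_ R p′ q xs
  sweep-start refl s = s

  sweep-end : ∀ {R p q q′ xs} → q ≡ q′ → Sweep _~_ R p q xs → Sweep _~_ R p q′ xs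
  sweep-end refl s = s

  sweep-cong : ∀ {R R′ p q xs} → (∀ {z} → R z → R′ z) → (∀ {z} → R′ z → R z) →
    Sweep _~_ R p q xs → Sweep _~_ R′ p q xs
  sweep-cong f g s = record { Sweep s ; sound = f ∘ s .sound ; complete = s .complete ∘ g }

-- Injectivity is asked for on `R` only, because coordinates counted downwards use truncated
-- subtraction and are injective only inside the rectangle.
sweep-map : ∀ {_~_ : Rel A 0ℓ} {_≈_ : Rel B 0ℓ} {R R′ p q xs} (f : A → B) →
  (∀ {u v} → R u → R v → f u ≡ f v → u ≡ v) →
  (∀ {u v} → R u → R v → u ~ v → f u ≈ f v) →
  (∀ {u} → R u → R′ (f u)) →
  (∀ {z} → R′ z → Σ[ u ∈ A ] R u × z ≡ f u) →
  Sweep _~_ R p q xs → Sweep _≈_ R′ (f p) (f q) (map f xs)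
sweep-map {_~_ = _~_} {_≈_} {R} {R′} {xs = xs} f inj hom into onto s = record
  { starts   = head-map xs (s .starts)
  ; ends     = trans (last-map f xs) (cong (mapᴹ f) (s .ends))
  ; linked   = linked′ xs (s .sound) (s .linked)
  ; simple   = simple′ xs (s .sound) (s .simple)
  ; sound    = λ i → let (u , u∈ , eq) = ∈-map⁻ f i in subst R′ (sym eq) (into (s .sound u∈))
  ; complete = λ r → let (u , ru , eq) = onto r in subst (_∈ _) (sym eq) (∈-map⁺ f (s .complete ru))
  }
  where
  head-map : ∀ xs {p} → head xs ≡ just p → head (map f xs) ≡ just (f p)
  head-map (x ∷ xs) refl = refl
  linked′ : ∀ xs → (∀ {z} → z ∈ xs → R z) → Linked _~_ xs → Linked _≈_ (map f xs)
  linked′ [] r [] = []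
  linked′ (x ∷ []) r [-] = [-]
  linked′ (x ∷ y ∷ xs) r (x~y ∷ l) = hom (r (here refl)) (r (there (here refl))) x~y ∷ linked′ (y ∷ xs) (r ∘ there) l
  apart : ∀ {x} xs → R x → (∀ {z} → z ∈ xs → R z) → All (x ≢_) xs → All (f x ≢_) (map f xs)
  apart [] rx r [] = []
  apart (y ∷ xs) rx r (x≢y ∷ a) = (x≢y ∘ inj rx (r (here refl))) ∷ apart xs rx (r ∘ there) a
  simple′ : ∀ xs → (∀ {z} → z ∈ xs → R z) → Unique xs → Unique (map f xs)
  simple′ [] r [] = []
  simple′ (x ∷ xs) r (a ∷ u) = apart xs (r (here refl)) (r ∘ there) a ∷ simple′ xs (r ∘ there) u

unique-⊆⇒length≤ : ∀ {xs ys : List A} → Unique xs → (∀ {z} → z ∈ xs → z ∈ ys) → length xs ≤ length ys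
unique-⊆⇒length≤ {xs = []} _ _ = z≤n
unique-⊆⇒length≤ {xs = x ∷ xs} (x∉ ∷ u) xs⊆ with ∈-∃++ (xs⊆ (here refl))
... | as , bs , refl = subst (suc (length xs) ≤_) eq (s≤s (unique-⊆⇒length≤ u without))
  where
  eq : suc (length (as ++ bs)) ≡ length (as ++ x ∷ bs)
  eq rewrite length-++ as {bs} | length-++ as {x ∷ bs} = sym (+-suc (length as) (length bs))
  without : ∀ {z} → z ∈ xs → z ∈ as ++ bs
  without z∈ with ∈-++⁻ as (xs⊆ (there z∈))
  ... | inj₁ i = ∈-++⁺ˡ i
  ... | inj₂ (here refl) = ⊥-elim (All.lookup x∉ z∈ refl)
  ... | inj₂ (there i) = ∈-++⁺ʳ as i

-- Rectangles

Cell : Set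
Cell = ℕ × ℕ

_≈₁_ : Rel ℕ 0ℓ
i ≈₁ j = i ≤ suc j × j ≤ suc i

-- Equal cells are allowed; that consecutive cells of a path differ comes from `Unique`. The
-- relation `_~_` on points follows the same convention.
_~ᶜ_ : Rel Cell 0ℓ
(i , j) ~ᶜ (i′ , j′) = i ≈₁ i′ × j ≈₁ j′

≈₁-refl : ∀ {i} → i ≈₁ i
≈₁-refl = n≤1+n _ , n≤1+n _

≈₁-suc : ∀ {i} → i ≈₁ suc i
≈₁-suc = m≤n⇒m≤1+n (n≤1+n _) , ≤-refl

≈₁-sym : ∀ {i j} → i ≈₁ j → j ≈₁ i
≈₁-sym (p , q) = q , p

module Boustrophedon (g : ℕ) where

  h : ℕ
  h = suc g

  row : Bool → ℕ → ℕ
  row true  j = j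
  row false j = g ∸ j

  cells : Bool → ℕ → ℕ → List Cell
  cells false i r = (i , r) ∷ []
  cells true  i r = (i , r) ∷ (suc i , r) ∷ []

  strip : (zig down : Bool) (i j k : ℕ) → List Cell
  strip zig down i j zero    = []
  strip zig down i j (suc k) = cells zig i (row down j) ++ strip zig down i (suc j) k

  zigzags : (opp : Bool) → ℕ → Bool
  zigzags true 2 = true
  zigzags _    _ = false

  -- `opp` tells whether the sweep has to end on the row opposite to the one it starts on. Each
  -- column turns `opp` and `down` around together. If two columns are left and `opp` is set,
  -- straight columns would end on the wrong side, and both are taken as one zigzag strip.
  columns : (fuel : ℕ) (opp down : Bool) (i w : ℕ) → List Cell
  columns zero    opp down i w = []
  columns (suc n) opp down i zero = []
  columns (suc n) opp down i w@(suc _) with zigzags opp w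
  ... | true  = strip true down i 0 h
  ... | false = strip false down i 0 h ++ columns n (not opp) (not down) (suc i) (pred w)

  wide : Bool → ℕ
  wide false = 0
  wide true  = 1

  sweep-cells : ∀ zig i r → Sweep _~ᶜ_ (λ z → (i ≤ proj₁ z × proj₁ z ≤ wide zig + i) × proj₂ z ≡ r) (i , r) (wide zig + i , r) (cells zig i r)
  sweep-cells false i r = sweep-cong (λ { refl → (≤-refl , ≤-refl) , refl })
    (λ { ((p , q) , refl) → cong (_, r) (≤-antisym q p) }) (sweep-cell (i , r))
  sweep-cells true i r = sweep-cong
    [ (λ { refl → (≤-refl , n≤1+n i) , refl }) , (λ { refl → (n≤1+n i , ≤-refl) , refl }) ]′ from
    (sweep-++ (sweep-cell (i , r)) (≈₁-suc , ≈₁-refl) (sweep-cell (suc i , r)) λ { refl () })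
    where
    from : ∀ {z} → (i ≤ proj₁ z × proj₁ z ≤ suc i) × proj₂ z ≡ r → z ≡ (i , r) ⊎ z ≡ (suc i , r)
    from {x , y} ((p , q) , refl) with m≤n⇒m<n∨m≡n q
    ... | inj₁ (s≤s q′) = inj₁ (cong (_, y) (≤-antisym q′ p))
    ... | inj₂ refl = inj₂ refl

  InStrip : (zig : Bool) (i : ℕ) (down : Bool) (j k : ℕ) → Pred Cell 0ℓ
  InStrip zig i down j k (x , y) = (i ≤ x × x ≤ wide zig + i) × Σ[ d ∈ ℕ ] (j ≤ d × d < j + k) × y ≡ row down d

  row-injective : ∀ down {j j′} → j < h → j′ < h → row down j ≡ row down j′ → j ≡ j′
  row-injective true  _ _ eq = eq
  row-injective false p q eq = ∸-cancelˡ-≡ (s≤s⁻¹ p) (s≤s⁻¹ q) eq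

  row-step : ∀ down j → suc j < h → row down j ≈₁ row down (suc j)
  row-step true  j _ = ≈₁-suc
  row-step false j p = subst (_≈₁ row false (suc j)) (sym (+-∸-assoc 1 (s≤s⁻¹ p))) (≈₁-sym ≈₁-suc)

  sweep-strip : ∀ zig down i j k → j + suc k ≤ h →
    Sweep _~ᶜ_ (InStrip zig i down j (suc k)) (i , row down j) (wide zig + i , row down (j + k)) (strip zig down i j (suc k))
  sweep-strip zig down i j zero j<h rewrite +-identityʳ j = sweep-cong to from
    (subst (Sweep _ _ _ _) (sym (++-identityʳ _)) (sweep-cells zig i (row down j)))
    where
    to : ∀ {z} → (i ≤ proj₁ z × proj₁ z ≤ wide zig + i) × proj₂ z ≡ row down j → InStrip zig i down j 1 z
    to (p , eq) = p , j , (≤-refl , ≤-reflexive (+-comm 1 j)) , eq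
    from : ∀ {z} → InStrip zig i down j 1 z → (i ≤ proj₁ z × proj₁ z ≤ wide zig + i) × proj₂ z ≡ row down j
    from (p , d , (l , u) , eq) = p , trans eq (cong (row down) (≤-antisym (s≤s⁻¹ (subst (suc d ≤_) (+-comm j 1) u)) l))
  sweep-strip zig down i j (suc k) j<h = sweep-end (cong (λ e → wide zig + i , row down e) (sym (+-suc j k)))
    (sweep-cong to from
      (sweep-++ (sweep-cells zig i (row down j)) (turn zig , row-step down j 1+j<h)
        (sweep-strip zig down i (suc j) k j′) disjoint))
    where
    j′ : suc j + suc k ≤ h
    j′ = subst (_≤ h) (+-suc j (suc k)) j<h
    1+j<h : suc j < h
    1+j<h = ≤-trans (s≤s (s≤s (m≤m+n j k))) (subst (λ e → suc e ≤ h) (+-suc j k) j′)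
    turn : ∀ zig → (wide zig + i) ≈₁ i
    turn false = ≈₁-refl
    turn true  = ≈₁-sym ≈₁-suc
    bound : ∀ {d} → d < suc j + suc k → d < h
    bound u = ≤-trans u j′
    disjoint : ∀ {z} → (i ≤ proj₁ z × proj₁ z ≤ wide zig + i) × proj₂ z ≡ row down j → InStrip zig i down (suc j) (suc k) z → ⊥
    disjoint (_ , refl) (_ , d , (l , u) , eq) = <⇒≢ l (row-injective down (≤-trans (n≤1+n _) 1+j<h) (bound u) eq)
    to : ∀ {z} → ((i ≤ proj₁ z × proj₁ z ≤ wide zig + i) × proj₂ z ≡ row down j) ⊎ InStrip zig i down (suc j) (suc k) z → InStrip zig i down j (suc (suc k)) z
    to (inj₁ (p , eq)) = p , j , (≤-refl , m<m+n j z<s) , eq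
    to (inj₂ (p , d , (l , u) , eq)) = p , d , (≤-trans (n≤1+n j) l , subst (suc d ≤_) (sym (+-suc j (suc k))) u) , eq
    from : ∀ {z} → InStrip zig i down j (suc (suc k)) z → ((i ≤ proj₁ z × proj₁ z ≤ wide zig + i) × proj₂ z ≡ row down j) ⊎ InStrip zig i down (suc j) (suc k) z
    from (p , d , (l , u) , eq) with m≤n⇒m<n∨m≡n l
    ... | inj₁ j<d = inj₂ (p , d , (j<d , subst (suc d ≤_) (+-suc j (suc k)) u) , eq)
    ... | inj₂ refl = inj₁ (p , eq)

  InColumns : (i w : ℕ) → Pred Cell 0ℓ
  InColumns i w (x , y) = (i ≤ x × x < i + w) × y < h

  row<h : ∀ down {j} → j < h → row down j < h
  row<h true  p = p
  row<h false {j} _ = s≤s (m∸n≤m g j)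

  unrow : ∀ down {y} → y < h → Σ[ j ∈ ℕ ] j < h × y ≡ row down j
  unrow true  {y} p = y , p , refl
  unrow false {y} p = g ∸ y , s≤s (m∸n≤m g y) , sym (m∸[m∸n]≡n (s≤s⁻¹ p))

  whole-strip : ∀ zig down i →
    Sweep _~ᶜ_ (InColumns i (suc (wide zig))) (i , row down 0) (wide zig + i , row down g) (strip zig down i 0 h)
  whole-strip zig down i = sweep-cong
    (λ { ((p , q) , d , (_ , u) , refl) → (p , ≤-trans (s≤s q) (≤-reflexive (+-comm (suc (wide zig)) i))) , row<h down u })
    (λ { ((p , q) , v) → (p , s≤s⁻¹ (≤-trans q (≤-reflexive (+-comm i (suc (wide zig)))))) , let (j , u , eq) = unrow down v in j , (z≤n , u) , eq })
    (sweep-strip zig down i 0 g ≤-refl)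

  row-turn : ∀ down → row (not down) 0 ≡ row down g
  row-turn true  = refl
  row-turn false = sym (n∸n≡0 g)

  finish : (opp down : Bool) → ℕ
  finish true  down = row down g
  finish false down = row down 0

  -- The goal is a fixed row of the rectangle: turning the direction and the relative position of
  -- the goal around together does not move it. This carries the goal through the induction over
  -- columns.
  finish-turn : ∀ opp down → finish (not opp) (not down) ≡ finish opp down
  finish-turn true  down  = row-turn down
  finish-turn false true  = n∸n≡0 g
  finish-turn false false = refl

  -- A single column of several rows cannot be swept so as to end on its starting row; this is the
  -- only obstruction.
  Feasible : Bool → ℕ → Set
  Feasible true  w = 1 ≤ w
  Feasible false w = 2 ≤ w ⊎ (w ≡ 1 × g ≡ 0)

  columns-zero : ∀ n opp down i → columns n opp down i 0 ≡ []
  columns-zero zero    _ _ _ = refl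
  columns-zero (suc n) _ _ _ = refl

  more : ∀ n opp down i w →
    Sweep _~ᶜ_ (InColumns (suc i) (suc w)) (suc i , row (not down) 0) (suc i + w , finish (not opp) (not down)) (columns n (not opp) (not down) (suc i) (suc w)) →
    Sweep _~ᶜ_ (InColumns i (suc (suc w))) (i , row down 0) (i + suc w , finish opp down)
      (strip false down i 0 h ++ columns n (not opp) (not down) (suc i) (suc w))
  more n opp down i w s = sweep-cong to from
    (sweep-end (cong₂ _,_ (sym (+-suc i w)) (finish-turn opp down))
      (sweep-++ (whole-strip false down i) (≈₁-suc , subst (row down g ≈₁_) (sym (row-turn down)) ≈₁-refl) s
        λ { ((_ , u) , _) ((l , _) , _) → <-irrefl refl (≤-trans (≤-trans u (≤-reflexive (+-comm i 1))) l) }))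
    where
    to : ∀ {z} → InColumns i 1 z ⊎ InColumns (suc i) (suc w) z → InColumns i (suc (suc w)) z
    to (inj₁ ((l , u) , v)) = (l , ≤-trans u (+-monoʳ-≤ i (s≤s z≤n))) , v
    to (inj₂ ((l , u) , v)) = (≤-trans (n≤1+n i) l , ≤-trans u (≤-reflexive (sym (+-suc i (suc w))))) , v
    from : ∀ {z} → InColumns i (suc (suc w)) z → InColumns i 1 z ⊎ InColumns (suc i) (suc w) z
    from ((l , u) , v) with m≤n⇒m<n∨m≡n l
    ... | inj₁ i<x = inj₂ ((i<x , ≤-trans u (≤-reflexive (+-suc i (suc w)))) , v)
    ... | inj₂ refl = inj₁ ((≤-refl , m<m+n i z<s) , v)

  sweep-columns : ∀ n opp down i w → suc w ≤ n → Feasible opp (suc w) →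
    Sweep _~ᶜ_ (InColumns i (suc w)) (i , row down 0) (i + w , finish opp down) (columns n opp down i (suc w))
  sweep-columns (suc n) true down i zero _ _ rewrite columns-zero n false (not down) (suc i) | ++-identityʳ (strip false down i 0 h) | +-identityʳ i = whole-strip false down i
  sweep-columns (suc n) false down i zero _ (inj₁ (s≤s ()))
  sweep-columns (suc n) false down i zero _ (inj₂ (_ , g≡0)) rewrite columns-zero n true (not down) (suc i) | ++-identityʳ (strip false down i 0 h) | +-identityʳ i
    = sweep-end (cong (λ e → i , row down e) g≡0) (whole-strip false down i)
  sweep-columns (suc n) true down i (suc zero) _ _ = sweep-end (cong (_, row down g) (+-comm 1 i)) (whole-strip true down i)
  sweep-columns (suc n) true down i (suc (suc w)) (s≤s w<n) _ = more n true down i (suc w) (sweep-columns n false (not down) (suc i) (suc w) w<n (inj₁ (s≤s (s≤s z≤n))))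
  sweep-columns (suc n) false down i (suc w) (s≤s w<n) _ = more n false down i w (sweep-columns n true (not down) (suc i) w w<n (s≤s z≤n))

-- Running programs

-- A Hoare triple for total correctness with a time budget. The budget is only an upper bound, so
-- that triples compose without exact costs.
record Runs (P : Program) (σ : State) (c : ℕ) (Q : State → Set) : Set where
  constructor runs
  field
    {final} : State
    {time}  : ℕ
    exec    : ⟨ P , σ ⟩⇓[ time ] final
    bounded : time ≤ c
    post    : Q final

infixr 2 _⟫=_

_⟫=_ : ∀ {P P′ σ c d Q Q′} → Runs P σ c Q → (∀ {σ′} → Q σ′ → Runs P′ σ′ d Q′) → Runs (P ⨾ P′) σ (c + d) Q′
runs e b q ⟫= k with k q
... | runs e′ b′ q′ = runs (⇓seq e e′) (+-mono-≤ b b′) q′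

runs-weaken : ∀ {P σ c d Q Q′} → c ≤ d → (∀ {σ′} → Q σ′ → Q′ σ′) → Runs P σ c Q → Runs P σ d Q′
runs-weaken c≤d f (runs e b q) = runs e (≤-trans b c≤d) (f q)

runs-skip : ∀ {σ} → Runs skip σ 1 (_≡ σ)
runs-skip = runs ⇓skip ≤-refl refl

runs-assign : ∀ {x e σ} → Runs (x ≔ e) σ (1 + cost e) (_≡ ⟪ reg σ [ x ↦ ⟦ e ⟧ σ ] , mem σ ⟫)
runs-assign = runs ⇓assign ≤-refl refl

runs-if : ∀ {b P P′ σ c Q} → (⟦ b ⟧ᵇ σ ≡ true → Runs P σ c Q) → (⟦ b ⟧ᵇ σ ≡ false → Runs P′ σ c Q) →
  Runs (ifᵖ b then P else P′) σ (1 + costᵇ b + c) Q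
runs-if {b} {σ = σ} t f with ⟦ b ⟧ᵇ σ in eq
... | true  with runs e ≤c q ← t refl = runs (⇓if-true eq e) (+-monoʳ-≤ _ ≤c) q
... | false with runs e ≤c q ← f refl = runs (⇓if-false eq e) (+-monoʳ-≤ _ ≤c) q

runs-while-true : ∀ {b P σ c d Q Q′} → ⟦ b ⟧ᵇ σ ≡ true → Runs P σ c Q →
  (∀ {σ′} → Q σ′ → Runs (while b loop P) σ′ d Q′) → Runs (while b loop P) σ (1 + costᵇ b + c + d) Q′
runs-while-true t (runs e ≤c q) k with k q
... | runs e′ ≤d q′ = runs (⇓while-true t e e′) (+-mono-≤ (+-monoʳ-≤ _ ≤c) ≤d) q′

runs-while-false : ∀ {b P σ} → ⟦ b ⟧ᵇ σ ≡ false → Runs (while b loop P) σ (1 + costᵇ b) (_≡ σ)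
runs-while-false f = runs (⇓while-false f) ≤-refl refl

≤ᵇ-true : ∀ {m n} → m ≤ n → (m ≤ᵇ n) ≡ true
≤ᵇ-true m≤n = Equivalence.to T-≡ (≤⇒≤ᵇ m≤n)

≤ᵇ-false : ∀ {m n} → ¬ (m ≤ n) → (m ≤ᵇ n) ≡ false
≤ᵇ-false {m} {n} m≰n with m ≤ᵇ n in eq
... | false = refl
... | true  = contradiction (≤ᵇ⇒≤ m n (Equivalence.from T-≡ eq)) m≰n

update-≢ : ∀ (f : ℕ → ℕ) x {a y} → y ≢ x → (f [ x ↦ a ]) y ≡ f y
update-≢ f x {y = y} y≢x with y ≡ᵇ x in eq
... | false = refl
... | true  = contradiction (≡ᵇ⇒≡ y x (Equivalence.from T-≡ eq)) y≢x

update-≡ : ∀ (f : ℕ → ℕ) x {a y} → y ≡ x → (f [ x ↦ a ]) y ≡ a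
update-≡ f x {y = y} y≡x with y ≡ᵇ x in eq
... | true  = refl
... | false = contradiction (trans (sym eq) (Equivalence.to T-≡ (≡⇒≡ᵇ y x y≡x))) λ ()

-- Emitting vertices

-- Registers 0–11 belong to the main program, 12–17 to the point-to-corner
-- routine and 20–30 to the corner-to-corner routine; register 31 counts the
-- vertices written so far.
cnt : ℕ
cnt = 31

Keeps : ℕ → State → State → Set
Keeps k σ σ′ = ∀ r → r < k → reg σ′ r ≡ reg σ r

Counts : State → State → Set
Counts σ σ′ = ∀ r → r ≢ cnt → reg σ′ r ≡ reg σ r

-- The format of `output`, but counted by register `cnt`, since register 0 holds m until the program
-- ends.
out : State → List Point
out σ = applyUpTo (λ i → pos (mem σ (2 * i)) , pos (mem σ (2 * i + 1))) (reg σ cnt)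

put : Expr → Expr → Program
put x y = mem[ var cnt ⊕ var cnt ]≔ x ⨾ mem[ var cnt ⊕ var cnt ⊕ lit 1 ]≔ y ⨾ cnt ≔ var cnt ⊕ lit 1

applyUpTo-cong : ∀ {A : Set} {f g : ℕ → A} n → (∀ i → i < n → f i ≡ g i) → applyUpTo f n ≡ applyUpTo g n
applyUpTo-cong zero    eq = refl
applyUpTo-cong (suc n) eq = cong₂ _∷_ (eq 0 z<s) (applyUpTo-cong n λ i i<n → eq (suc i) (s<s i<n))

-- `ey` is evaluated after the first store, hence its value is required in every memory. Earlier
-- vertices survive because the two written cells differ from theirs by size or by parity.
runs-put : ∀ {σ ex ey x y} → ⟦ ex ⟧ σ ≡ x → (∀ {μ} → ⟦ ey ⟧ ⟪ reg σ , μ ⟫ ≡ y) →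
  Runs (put ex ey) σ (14 + cost ex + cost ey) (λ σ′ → out σ′ ≡ out σ ++ [ pos x , pos y ] × Counts σ σ′)
runs-put {σ} {ex} {ey} refl eqy = runs (⇓seq ⇓store (⇓seq ⇓store ⇓assign)) bound (trans step (cong (out σ ++_) (cong [_] new)) , λ r r≢ → update-≢ (reg σ) cnt r≢)
  where
  n = reg σ cnt
  μ₁ = mem σ [ n + n ↦ ⟦ ex ⟧ σ ]
  μ₂ = μ₁ [ n + n + 1 ↦ ⟦ ey ⟧ ⟪ reg σ , μ₁ ⟫ ]
  double : ∀ i → 2 * i ≡ i + i
  double i = cong (i +_) (+-identityʳ i)
  bound : 1 + 3 + cost ex + ((1 + 5 + cost ey) + (1 + 3)) ≤ 14 + cost ex + cost ey
  bound = ≤-reflexive (eq (cost ex) (cost ey))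
    where
    open +-*-Solver
    eq : ∀ a b → 1 + 3 + a + ((1 + 5 + b) + (1 + 3)) ≡ 14 + a + b
    eq = solve 2 (λ a b → con 4 :+ a :+ ((con 6 :+ b) :+ con 4) := con 14 :+ a :+ b) refl
  at : ℕ → Point
  at i = pos (μ₂ (2 * i)) , pos (μ₂ (2 * i + 1))
  doubles : ∀ i j → i + i ≢ j + j + 1
  doubles i j eq = even≢odd i j (trans (double i) (trans eq (trans (+-comm (j + j) 1) (cong suc (sym (double j))))))
  old : ∀ i → i < n → at i ≡ (pos (mem σ (2 * i)) , pos (mem σ (2 * i + 1)))
  old i i<n rewrite double i = cong₂ _,_
    (cong pos (trans (update-≢ μ₁ (n + n + 1) (doubles i n)) (update-≢ (mem σ) (n + n) (<⇒≢ (+-mono-< i<n i<n)))))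
    (cong pos (trans (update-≢ μ₁ (n + n + 1) (λ eq → <⇒≢ (+-mono-< i<n i<n) (+-cancelʳ-≡ 1 _ _ eq)))
      (update-≢ (mem σ) (n + n) (λ eq → doubles n i (sym eq)))))
  new : at n ≡ (pos (⟦ ex ⟧ σ) , pos _)
  new rewrite double n = cong₂ _,_
    (cong pos (trans (update-≢ μ₁ (n + n + 1) (doubles n n)) (update-≡ (mem σ) (n + n) refl)))
    (cong pos (trans (update-≡ μ₁ (n + n + 1) refl) eqy))
  step : applyUpTo at (n + 1) ≡ out σ ++ [ at n ]
  step = begin
    applyUpTo at (n + 1)     ≡⟨ cong (applyUpTo at) (+-comm n 1) ⟩
    applyUpTo at (suc n)     ≡⟨ applyUpTo-∷ʳ at n ⟨
    applyUpTo at n ∷ʳ at n   ≡⟨ cong (_∷ʳ at n) (applyUpTo-cong n old) ⟩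
    out σ ++ [ at n ]        ∎
    where open ≡-Reasoning

bit : Bool → ℕ
bit true  = 1
bit false = 0

coord : (hi : Bool) (lo up : ℕ) → ℕ → ℕ
coord false lo up i = lo + i
coord true  lo up i = up ∸ i

coordᵉ : (hi : Bool) (lo up : ℕ) → Expr → Expr
coordᵉ false lo up e = var lo ⊕ e
coordᵉ true  lo up e = var up ⊖ e

⟦coordᵉ⟧ : ∀ hi lo up e {σ} → ⟦ coordᵉ hi lo up e ⟧ σ ≡ coord hi (reg σ lo) (reg σ up) (⟦ e ⟧ σ)
⟦coordᵉ⟧ false lo up e = refl
⟦coordᵉ⟧ true  lo up e = refl

cost-coordᵉ : ∀ hi lo up e → cost (coordᵉ hi lo up e) ≡ 2 + cost e
cost-coordᵉ false lo up e = refl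
cost-coordᵉ true  lo up e = refl

orient : Bool → ℕ → ℕ → Point
orient false a b = pos a , pos b
orient true  a b = pos b , pos a

putAt : Bool → Expr → Expr → Program
putAt false a b = put a b
putAt true  a b = put b a

runs-putAt : ∀ transposed {σ ea eb a b} → (∀ {μ} → ⟦ ea ⟧ ⟪ reg σ , μ ⟫ ≡ a) → (∀ {μ} → ⟦ eb ⟧ ⟪ reg σ , μ ⟫ ≡ b) →
  Runs (putAt transposed ea eb) σ (14 + cost ea + cost eb)
    (λ σ′ → out σ′ ≡ out σ ++ [ orient transposed a b ] × Counts σ σ′)
runs-putAt false pa pb = runs-put pa pb
runs-putAt true {ea = ea} {eb} pa pb = runs-weaken (≤-reflexive (trans (+-assoc 14 (cost eb) _)
  (trans (cong (14 +_) (+-comm (cost eb) (cost ea))) (sym (+-assoc 14 (cost ea) _))))) id (runs-put pb pa)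

lower upper : Bool → ℕ
lower false = 20
lower true  = 22
upper false = 21
upper true  = 23

lower<24 : ∀ b → lower b < 24
lower<24 false = m≤m+n 21 3
lower<24 true  = m≤m+n 23 1

upper<24 : ∀ b → upper b < 24
upper<24 false = m≤m+n 22 2
upper<24 true  = ≤-refl

-- The rectangle is swept along its major axis, whose bounds are in registers
-- lo, up; ma and mi tell whether the start corner has the upper major and
-- minor coordinate.
module Traversal (transposed ma mi : Bool) where

  -- `H` is the number of rows, `I` the current column, `J` the row counted in the direction of
  -- travel, `W` the number of columns left; `F` and `D` hold the flags `opp` and `down`, and `Z`
  -- the zigzag flag.
  lo₁ up₁ lo₂ up₂ H I J W F D Z : ℕ
  lo₁ = lower transposed
  up₁ = upper transposed
  lo₂ = lower (not transposed)
  up₂ = upper (not transposed)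
  H = 24
  I = 25
  J = 26
  W = 27
  F = 28
  D = 29
  Z = 30

  turned : Bool → Bool
  turned d = if d then mi else not mi

  rowᵉ : Bool → Expr
  rowᵉ d = coordᵉ (turned d) lo₂ up₂ (var J)

  cell : Bool → Program
  cell d =
    putAt transposed (coordᵉ ma lo₁ up₁ (var I)) (rowᵉ d) ⨾
    (ifᵖ var Z ≡ᵉ lit 1 then putAt transposed (coordᵉ ma lo₁ up₁ (var I ⊕ lit 1)) (rowᵉ d) else skip)

  rowBody rowLoop columnBody columnLoop : Program
  rowBody = (ifᵖ var D ≡ᵉ lit 1 then cell true else cell false) ⨾ J ≔ var J ⊕ lit 1
  rowLoop = while var J ⊕ lit 1 ≤ᵉ var H loop rowBody
  columnBody =
    (ifᵖ (var W ≡ᵉ lit 2) andᵇ (var F ≡ᵉ lit 1) then Z ≔ lit 1 else (Z ≔ lit 0)) ⨾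
    J ≔ lit 0 ⨾
    rowLoop ⨾
    W ≔ var W ⊖ (lit 1 ⊕ var Z) ⨾
    I ≔ var I ⊕ lit 1 ⨾
    F ≔ lit 1 ⊖ var F ⨾
    D ≔ lit 1 ⊖ var D
  columnLoop = while lit 1 ≤ᵉ var W loop columnBody

  module _ (A₁ A₂ B₁ g : ℕ) where

    open Boustrophedon g

    B₂ : ℕ
    B₂ = B₁ + g

    place : Cell → Point
    place (i , j) = orient transposed (coord ma A₁ A₂ i) (coord mi B₁ B₂ j)

    Adds : List Cell → State → State → Set
    Adds cs σ σ′ = out σ′ ≡ out σ ++ map place cs

    record Frame (σ : State) : Set where
      field
        major₁ : reg σ lo₁ ≡ A₁
        major₂ : reg σ up₁ ≡ A₂
        minor₁ : reg σ lo₂ ≡ B₁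
        minor₂ : reg σ up₂ ≡ B₂
        height : reg σ H ≡ h
    open Frame

    -- On the way back rows are counted from the other minor side. Thus `J` can count upwards in
    -- both directions and the program never computes g ∸ j.
    coord-row : ∀ d j → j ≤ g → coord (turned d) B₁ B₂ j ≡ coord mi B₁ B₂ (row d j)
    coord-row true  j _ = refl
    coord-row false j j≤g = flipped mi
      where
      flipped : ∀ mi → coord (not mi) B₁ B₂ j ≡ coord mi B₁ B₂ (g ∸ j)
      flipped false = +-∸-assoc B₁ j≤g
      flipped true  = sym (trans (+-∸-assoc B₁ (m∸n≤m g j)) (cong (B₁ +_) (m∸[m∸n]≡n j≤g)))

    record AtRow (σ : State) (z d : Bool) (i j : ℕ) : Set where
      field
        frame : Frame σ
        zig   : reg σ Z ≡ bit z
        dir   : reg σ D ≡ bit d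
        col   : reg σ I ≡ i
        ind   : reg σ J ≡ j
    open AtRow

    Fresh : State → State → Set
    Fresh σ σ′ = ∀ r → r ≢ J → r ≢ cnt → reg σ′ r ≡ reg σ r

    frame-keep : ∀ {σ σ′} → Keeps 25 σ σ′ → Frame σ → Frame σ′
    frame-keep keep fr = record
      { major₁ = trans (keep _ (m≤n⇒m≤1+n (lower<24 transposed))) (fr .major₁)
      ; major₂ = trans (keep _ (m≤n⇒m≤1+n (upper<24 transposed))) (fr .major₂)
      ; minor₁ = trans (keep _ (m≤n⇒m≤1+n (lower<24 (not transposed)))) (fr .minor₁)
      ; minor₂ = trans (keep _ (m≤n⇒m≤1+n (upper<24 (not transposed)))) (fr .minor₂)
      ; height = trans (keep _ ≤-refl) (fr .height) }

    frame-fresh : ∀ {σ σ′} → Fresh σ σ′ → Frame σ → Frame σ′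
    frame-fresh {σ} {σ′} fresh fr = frame-keep
      (λ r r<25 → fresh r (<⇒≢ (≤-trans r<25 (m≤m+n 25 1))) (<⇒≢ (≤-trans r<25 (m≤m+n 25 6)))) fr

    ⟦columnᵉ⟧ : ∀ {σ e} → Frame σ → (∀ {μ} → ⟦ coordᵉ ma lo₁ up₁ e ⟧ ⟪ reg σ , μ ⟫ ≡ coord ma A₁ A₂ (⟦ e ⟧ ⟪ reg σ , μ ⟫))
    ⟦columnᵉ⟧ {σ} {e} fr {μ} = trans (⟦coordᵉ⟧ ma lo₁ up₁ e) (cong₂ (λ a b → coord ma a b (⟦ e ⟧ ⟪ reg σ , μ ⟫)) (fr .major₁) (fr .major₂))

    ⟦rowᵉ⟧ : ∀ {σ} d {j} → Frame σ → reg σ J ≡ j → j ≤ g → ∀ {μ} → ⟦ rowᵉ d ⟧ ⟪ reg σ , μ ⟫ ≡ coord mi B₁ B₂ (row d j)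
    ⟦rowᵉ⟧ {σ} d fr refl j≤g = trans (⟦coordᵉ⟧ (turned d) lo₂ up₂ (var J))
      (trans (cong₂ (λ a b → coord (turned d) a b (reg σ J)) (fr .minor₁) (fr .minor₂)) (coord-row d _ j≤g))

    cost-row : ∀ d → cost (rowᵉ d) ≡ 3
    cost-row d = cost-coordᵉ (turned d) lo₂ up₂ (var J)

    runs-cell : ∀ {σ z d i j} → AtRow σ z d i j → j ≤ g →
      Runs (cell d) σ 46 (λ σ′ → Adds (cells z i (row d j)) σ σ′ × Counts σ σ′)
    runs-cell {σ} {z} {d} {i} {j} at j≤g =
      runs-weaken (≤-reflexive (cong₂ _+_ (cong₂ (λ a b → 14 + a + b) (cost-coordᵉ ma lo₁ up₁ (var I)) (cost-row d)) refl)) id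
        (runs-putAt transposed {ea = coordᵉ ma lo₁ up₁ (var I)} {rowᵉ d} (trans (⟦columnᵉ⟧ {e = var I} (at .frame)) (cong (coord ma A₁ A₂) (at .col))) (⟦rowᵉ⟧ d (at .frame) (at .ind) j≤g)
          ⟫= λ {σ₁} (o , keep) → runs-if {c = 22} (second z (at .zig) σ₁ o keep) (done z (at .zig) σ₁ o keep))
      where
      p₁ = place (i , row d j)
      second : ∀ z → reg σ Z ≡ bit z → ∀ σ₁ → out σ₁ ≡ out σ ++ [ p₁ ] → Counts σ σ₁ →
        (reg σ₁ Z ≡ᵇ 1) ≡ true → Runs (putAt transposed (coordᵉ ma lo₁ up₁ (var I ⊕ lit 1)) (rowᵉ d)) σ₁ 22
          (λ σ′ → Adds (cells z i (row d j)) σ σ′ × Counts σ σ′)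
      second false eqz σ₁ o keep t = contradiction (trans (sym t) (cong (_≡ᵇ 1) (trans (keep Z (λ ())) eqz))) λ ()
      second true  eqz σ₁ o keep t =
        runs-weaken (≤-reflexive (cong₂ (λ a b → 14 + a + b) (cost-coordᵉ ma lo₁ up₁ (var I ⊕ lit 1)) (cost-row d)))
          (λ (o′ , keep′) → trans o′ (trans (cong (_++ _) o) (++-assoc (out σ) _ _)) , λ r r≢ → trans (keep′ r r≢) (keep r r≢))
          (runs-putAt transposed {ea = coordᵉ ma lo₁ up₁ (var I ⊕ lit 1)} {rowᵉ d}
            (trans (⟦columnᵉ⟧ {e = var I ⊕ lit 1} fr₁) (cong (coord ma A₁ A₂) (trans (cong (_+ 1) (trans (keep I (λ ())) (at .col))) (+-comm i 1))))
            (⟦rowᵉ⟧ d fr₁ (trans (keep J (λ ())) (at .ind)) j≤g))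
        where
        fr₁ : Frame σ₁
        fr₁ = frame-fresh {σ} (λ r _ r≢ → keep r r≢) (at .frame)
      done : ∀ z → reg σ Z ≡ bit z → ∀ σ₁ → out σ₁ ≡ out σ ++ [ p₁ ] → Counts σ σ₁ →
        (reg σ₁ Z ≡ᵇ 1) ≡ false → Runs skip σ₁ 22
          (λ σ′ → Adds (cells z i (row d j)) σ σ′ × Counts σ σ′)
      done true  eqz σ₁ o keep f = contradiction (trans (sym f) (cong (_≡ᵇ 1) (trans (keep Z (λ ())) eqz))) λ ()
      done false eqz σ₁ o keep f = runs-weaken (s≤s z≤n) (λ { refl → o , keep }) runs-skip

    runs-turn : ∀ {σ z i j} d → AtRow σ z d i j → j ≤ g →
      Runs (ifᵖ var D ≡ᵉ lit 1 then cell true else cell false) σ 50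
        (λ σ′ → Adds (cells z i (row d j)) σ σ′ × Counts σ σ′)
    runs-turn true  at j≤g = runs-if (λ _ → runs-cell at j≤g) λ f → contradiction (trans (sym f) (cong (_≡ᵇ 1) (at .dir))) λ ()
    runs-turn false at j≤g = runs-if (λ t → contradiction (trans (sym t) (cong (_≡ᵇ 1) (at .dir))) λ ()) λ _ → runs-cell at j≤g

    runs-row : ∀ {σ z d i j} → AtRow σ z d i j → j ≤ g →
      Runs rowBody σ 54 (λ σ′ → Adds (cells z i (row d j)) σ σ′ × Fresh σ σ′ × reg σ′ J ≡ suc j)
    runs-row {d = d} {j = j} at j≤g = runs-turn d at j≤g
      ⟫= λ {σ₁} (o , keep) → runs-weaken ≤-refl (λ { refl → o , (λ r r≢J r≢ → trans (update-≢ (reg σ₁) J r≢J) (keep r r≢)) ,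
        trans (cong (_+ 1) (trans (keep J (λ ())) (at .ind))) (+-comm j 1) }) runs-assign

    runs-rowLoop : ∀ {σ z d i} j k → AtRow σ z d i j → j + k ≡ h →
      Runs rowLoop σ (60 * length (map place (strip z d i j k)) + 6)
        (λ σ′ → Adds (strip z d i j k) σ σ′ × Fresh σ σ′)
    runs-rowLoop {σ} j zero at eq = runs-weaken ≤-refl (λ { refl → sym (++-identityʳ _) , λ _ _ _ → refl })
      (runs-while-false (≤ᵇ-false λ le → <-irrefl (trans (at .ind) (trans (sym (+-identityʳ j)) (trans eq (sym (at .frame .height)))))
        (subst (_≤ reg σ H) (+-comm (reg σ J) 1) le)))
    runs-rowLoop {σ} {z} {d} {i} j (suc k) at eq = runs-weaken bound id
      (runs-while-true cond (runs-row at (s≤s⁻¹ (subst (j <_) eq (m<m+n j z<s)))) λ {σ₁} (o , fresh , ind₁) →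
        runs-weaken ≤-refl
          (λ (o′ , fresh′) → trans o′ (trans (cong (_++ rest) o) (trans (++-assoc (out σ) _ _)
              (cong (out σ ++_) (sym (map-++ place (cells z i (row d j)) _))))) , λ r p q → trans (fresh′ r p q) (fresh r p q))
          (runs-rowLoop (suc j) k (next fresh ind₁) (trans (sym (+-suc j k)) eq)))
      where
      rest = map place (strip z d i (suc j) k)
      cond : (reg σ J + 1 ≤ᵇ reg σ H) ≡ true
      cond rewrite at .ind | at .frame .height = ≤ᵇ-true (subst₂ _≤_ (+-comm 1 j) eq (subst (suc j ≤_) (sym (+-suc j k)) (s≤s (m≤m+n j k))))
      next : ∀ {σ₁} → Fresh σ σ₁ → reg σ₁ J ≡ suc j → AtRow σ₁ z d i (suc j)
      next fresh ind₁ = record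
        { frame = frame-fresh fresh (at .frame)
        ; zig = trans (fresh Z (λ ()) (λ ())) (at .zig)
        ; dir = trans (fresh D (λ ()) (λ ())) (at .dir)
        ; col = trans (fresh I (λ ()) (λ ())) (at .col)
        ; ind = ind₁ }
      bound : 60 + (60 * length rest + 6) ≤ 60 * length (map place (strip z d i j (suc k))) + 6
      bound = ≤-trans (≤-reflexive (sym (+-assoc 60 (60 * length rest) 6))) (+-monoˡ-≤ 6
        (≤-trans (≤-reflexive (sym (*-suc 60 (length rest)))) (*-monoʳ-≤ 60 (longer z))))
        where
        longer : ∀ z′ → suc (length rest) ≤ length (map place (cells z′ i (row d j) ++ strip z d i (suc j) k))
        longer false = ≤-refl
        longer true  = n≤1+n _

    record AtColumn (σ : State) (opp d : Bool) (i w : ℕ) : Set where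
      field
        frame : Frame σ
        mode  : reg σ F ≡ bit opp
        dir   : reg σ D ≡ bit d
        col   : reg σ I ≡ i
        width : reg σ W ≡ w
    open AtColumn

    keep-update : ∀ f x {a r} → 25 ≤ x → r < 25 → (f [ x ↦ a ]) r ≡ f r
    keep-update f x 25≤x r<25 = update-≢ f x (<⇒≢ (≤-trans r<25 25≤x))

    zigzags-test : ∀ opp w → (w ≡ᵇ 2) ∧ (bit opp ≡ᵇ 1) ≡ zigzags opp w
    zigzags-test true  0 = refl
    zigzags-test true  1 = refl
    zigzags-test true  2 = refl
    zigzags-test true  (suc (suc (suc w))) = refl
    zigzags-test false 0 = refl
    zigzags-test false 1 = refl
    zigzags-test false 2 = refl
    zigzags-test false (suc (suc (suc w))) = refl

    1∸bit : ∀ b → 1 ∸ bit b ≡ bit (not b)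
    1∸bit true  = refl
    1∸bit false = refl

    runs-columnBody : ∀ {σ opp d i w} → AtColumn σ opp d i w → let z = zigzags opp w in
      Runs columnBody σ (60 * length (map place (strip z d i 0 h)) + 36)
        (λ σ′ → Adds (strip z d i 0 h) σ σ′ ×
                Keeps 25 σ σ′ × AtColumn σ′ (not opp) (not d) (suc i) (w ∸ suc (bit z)))
    runs-columnBody {σ} {opp} {d} {i} {w} at = runs-weaken (≤-reflexive arith) id
      (setZ ⟫= λ { refl → runs-assign {J} {lit 0} ⟫= λ { refl → runs-rowLoop 0 h at₂ refl ⟫= λ {σ₃} (o , fresh) →
        runs-assign {W} ⟫= λ { refl → runs-assign {I} ⟫= λ { refl → runs-assign {F} ⟫= λ { refl → runs-weaken ≤-refl
          (λ { refl → o , keep σ₃ fresh , record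
            { frame = frame-keep (keep σ₃ fresh) (at .frame)
            ; mode  = trans (cong (1 ∸_) (trans (fresh F (λ ()) (λ ())) (at .mode))) (1∸bit opp)
            ; dir   = trans (cong (1 ∸_) (trans (fresh D (λ ()) (λ ())) (at .dir))) (1∸bit d)
            ; col   = trans (cong (_+ 1) (trans (fresh I (λ ()) (λ ())) (at .col))) (+-comm i 1)
            ; width = cong₂ (λ a b → a ∸ suc b) (trans (fresh W (λ ()) (λ ())) (at .width)) (fresh Z (λ ()) (λ ()))
            } }) (runs-assign {D}) }}}}})
      where
      z = zigzags opp w
      ρ₁ = reg σ [ Z ↦ bit z ]
      ρ₂ = ρ₁ [ J ↦ 0 ]
      σ₂ = ⟪ ρ₂ , mem σ ⟫
      test : ∀ {b} → ⟦ (var W ≡ᵉ lit 2) andᵇ (var F ≡ᵉ lit 1) ⟧ᵇ σ ≡ b → z ≡ b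
      test eq = trans (sym (zigzags-test opp w)) (trans (sym (cong₂ (λ a b → (a ≡ᵇ 2) ∧ (b ≡ᵇ 1)) (at .width) (at .mode))) eq)
      setZ : Runs (ifᵖ (var W ≡ᵉ lit 2) andᵇ (var F ≡ᵉ lit 1) then Z ≔ lit 1 else (Z ≔ lit 0)) σ 10 (_≡ ⟪ ρ₁ , mem σ ⟫)
      setZ = runs-if (λ t → runs-weaken ≤-refl (λ { refl → cong (λ b → ⟪ reg σ [ Z ↦ bit b ] , mem σ ⟫) (sym (test t)) }) runs-assign)
                     (λ f → runs-weaken ≤-refl (λ { refl → cong (λ b → ⟪ reg σ [ Z ↦ bit b ] , mem σ ⟫) (sym (test f)) }) runs-assign)
      keep₂ : ∀ r → r < 25 → ρ₂ r ≡ reg σ r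
      keep₂ r r<25 = trans (keep-update ρ₁ J (m≤m+n 25 1) r<25) (keep-update (reg σ) Z (m≤m+n 25 5) r<25)
      at₂ : AtRow σ₂ z d i 0
      at₂ = record { frame = frame-keep keep₂ (at .frame) ; zig = refl ; dir = at .dir ; col = at .col ; ind = refl }
      keep : ∀ σ₃ {a b c e} → Fresh σ₂ σ₃ → ∀ r → r < 25 → (reg σ₃ [ W ↦ a ] [ I ↦ b ] [ F ↦ c ] [ D ↦ e ]) r ≡ reg σ r
      keep σ₃ fresh r r<25 =
        trans (keep-update (reg σ₃ [ W ↦ _ ] [ I ↦ _ ] [ F ↦ _ ]) D (m≤m+n 25 4) r<25)
        (trans (keep-update (reg σ₃ [ W ↦ _ ] [ I ↦ _ ]) F (m≤m+n 25 3) r<25)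
        (trans (keep-update (reg σ₃ [ W ↦ _ ]) I (m≤m+n 25 0) r<25)
        (trans (keep-update (reg σ₃) W (m≤m+n 25 2) r<25)
        (trans (fresh r (<⇒≢ (≤-trans r<25 (m≤m+n 25 1))) (<⇒≢ (≤-trans r<25 (m≤m+n 25 6)))) (keep₂ r r<25)))))
      n = length (map place (strip z d i 0 h))
      arith : 10 + (2 + ((60 * n + 6) + (6 + (4 + (4 + 4))))) ≡ 60 * n + 36
      arith = trans (cong (12 +_) (+-assoc (60 * n) 6 18)) (trans (+-comm 12 (60 * n + 24)) (+-assoc (60 * n) 24 12))

    strip-nonempty : ∀ z d i → 1 ≤ length (map place (strip z d i 0 h))
    strip-nonempty false d i = s≤s z≤n
    strip-nonempty true  d i = s≤s z≤n

    -- The fixed cost of a column, 36 for its body and 4 for the test, is charged to one of its `a`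
    -- vertices; this raises the rate from 60 to 100.
    step-cost : ∀ a r → 1 ≤ a → 4 + (60 * a + 36) + (100 * r + 4) ≤ 100 * (a + r) + 4
    step-cost a@(suc _) r _ = begin
      4 + (60 * a + 36) + (100 * r + 4)  ≡⟨ cong (_+ (100 * r + 4)) (trans (+-comm 4 (60 * a + 36)) (+-assoc (60 * a) 36 4)) ⟩
      60 * a + 40 + (100 * r + 4)        ≤⟨ +-monoˡ-≤ (100 * r + 4) (+-monoʳ-≤ (60 * a) (m≤m*n 40 a)) ⟩
      60 * a + 40 * a + (100 * r + 4)    ≡⟨ cong (_+ (100 * r + 4)) (*-distribʳ-+ a 60 40) ⟨
      100 * a + (100 * r + 4)            ≡⟨ +-assoc (100 * a) (100 * r) 4 ⟨
      100 * a + 100 * r + 4              ≡⟨ cong (_+ 4) (*-distribˡ-+ 100 a r) ⟨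
      100 * (a + r) + 4                  ∎
      where open ≤-Reasoning

    exhausted : ∀ opp w → zigzags opp (suc w) ≡ true → suc w ∸ 2 ≡ 0
    exhausted true (suc zero) _ = refl

    columns-zigzag : ∀ n opp d i w → zigzags opp (suc w) ≡ true → columns (suc n) opp d i (suc w) ≡ strip true d i 0 h
    columns-zigzag n opp d i w eq with zigzags opp (suc w)
    ... | true = refl

    columns-straight : ∀ n opp d i w → zigzags opp (suc w) ≡ false →
      columns (suc n) opp d i (suc w) ≡ strip false d i 0 h ++ columns n (not opp) (not d) (suc i) w
    columns-straight n opp d i w eq with zigzags opp (suc w)
    ... | false = refl

    Draws : State → List Cell → Set
    Draws σ cs = Runs columnLoop σ (100 * length (map place cs) + 4)
      (λ σ′ → Adds cs σ σ′ × Keeps 25 σ σ′)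

    draws-none : ∀ {σ opp d i} → AtColumn σ opp d i 0 → Draws σ []
    draws-none at = runs-weaken ≤-refl (λ { refl → sym (++-identityʳ _) , λ _ _ → refl })
      (runs-while-false (≤ᵇ-false λ le → <-irrefl refl (subst (1 ≤_) (at .width) le)))

    draws-column : ∀ {σ opp d i w rest} → AtColumn σ opp d i (suc w) → let z = zigzags opp (suc w) in
      (∀ {σ′} → AtColumn σ′ (not opp) (not d) (suc i) (suc w ∸ suc (bit z)) → Draws σ′ rest) → Draws σ (strip z d i 0 h ++ rest)
    draws-column {σ} {opp} {d} {i} {w} {rest} at k = runs-weaken bound id
      (runs-while-true (subst (λ a → (1 ≤ᵇ a) ≡ true) (sym (at .width)) refl) (runs-columnBody at) λ (o , keep , at′) →
        runs-weaken ≤-refl (λ (o′ , keep′) → trans o′ (trans (cong (_++ map place rest) o) (trans (++-assoc (out σ) _ _)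
            (cong (out σ ++_) (sym (map-++ place this rest))))) , λ r p → trans (keep′ r p) (keep r p))
          (k at′))
      where
      this = strip (zigzags opp (suc w)) d i 0 h
      a = length (map place this)
      b = length (map place rest)
      total : length (map place (this ++ rest)) ≡ a + b
      total = trans (cong length (map-++ place this rest)) (length-++ (map place this))
      bound : 4 + (60 * a + 36) + (100 * b + 4) ≤ 100 * length (map place (this ++ rest)) + 4
      bound = subst (λ c → 4 + (60 * a + 36) + (100 * b + 4) ≤ 100 * c + 4) (sym total)
        (step-cost a b (strip-nonempty (zigzags opp (suc w)) d i))

    draws-columns : ∀ {σ} n opp d i w → AtColumn σ opp d i w → w ≤ n → Draws σ (columns n opp d i w)
    draws-columns zero    opp d i zero at _ = draws-none at
    draws-columns (suc n) opp d i zero at _ = draws-none at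
    draws-columns {σ} (suc n) opp d i (suc w) at (s≤s w≤n) = go (zigzags opp (suc w)) refl
      where
      go : ∀ z → zigzags opp (suc w) ≡ z → Draws σ (columns (suc n) opp d i (suc w))
      go false eq = subst (Draws σ) (sym (columns-straight n opp d i w eq))
        (subst (λ z → Draws σ (strip z d i 0 h ++ columns n (not opp) (not d) (suc i) w)) eq
          (draws-column at λ at′ → draws-columns n (not opp) (not d) (suc i) w (subst (λ z → AtColumn _ _ _ _ (w ∸ bit z)) eq at′) w≤n))
      go true eq = subst (Draws σ) (sym (trans (columns-zigzag n opp d i w eq) (sym (++-identityʳ _))))
        (subst (λ z → Draws σ (strip z d i 0 h ++ [])) eq
          (draws-column at λ at′ → draws-none (subst (AtColumn _ _ _ _) (exhausted opp w eq) (subst (λ z → AtColumn _ _ _ _ (w ∸ bit z)) eq at′))))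

  prelude : Bool → Program
  prelude opp = H ≔ var up₂ ⊕ lit 1 ⊖ var lo₂ ⨾ W ≔ var up₁ ⊕ lit 1 ⊖ var lo₁ ⨾ I ≔ lit 0 ⨾ F ≔ lit (bit opp) ⨾ D ≔ lit 1

  traverse : Bool → Program
  traverse opp = prelude opp ⨾ columnLoop

  runs-traverse : ∀ A₁ w B₁ g opp {σ} → reg σ lo₁ ≡ A₁ → reg σ up₁ ≡ A₁ + w → reg σ lo₂ ≡ B₁ → reg σ up₂ ≡ B₁ + g →
    let cs = Boustrophedon.columns g (suc w) opp true 0 (suc w) in
    Runs (traverse opp) σ (18 + (100 * length (map (place A₁ (A₁ + w) B₁ g) cs) + 4))
      (λ σ′ → out σ′ ≡ out σ ++ map (place A₁ (A₁ + w) B₁ g) cs × Keeps 20 σ σ′)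
  runs-traverse A₁ w B₁ g opp {σ} p₁ p₂ p₃ p₄ =
    (runs-assign {H} ⟫= λ { refl → runs-assign {W} ⟫= λ { refl → runs-assign {I} ⟫= λ { refl → runs-assign {F} ⟫= λ { refl → runs-assign {D} }}}})
    ⟫= λ { refl → runs-weaken ≤-refl (λ (o , keep′) → o , λ r r<20 → trans (keep′ r (≤-trans r<20 (m≤m+n 20 5))) (keep r (≤-trans r<20 (m≤m+n 20 4))))
      (draws-columns A₁ (A₁ + w) B₁ g (suc w) opp true 0 (suc w) start ≤-refl) }
    where
    extent : ∀ {a b} c → a ≡ c → ∀ n → b ≡ c + n → b + 1 ∸ a ≡ suc n
    extent c refl n refl = trans (cong (_∸ c) (+-assoc c n 1)) (trans (m+n∸m≡n c (n + 1)) (+-comm n 1))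
    ρ₁ = reg σ [ H ↦ reg σ up₂ + 1 ∸ reg σ lo₂ ]
    ρ₂ = ρ₁ [ W ↦ ρ₁ up₁ + 1 ∸ ρ₁ lo₁ ]
    ρ₃ = ρ₂ [ I ↦ 0 ]
    ρ₄ = ρ₃ [ F ↦ bit opp ]
    ρ₅ = ρ₄ [ D ↦ 1 ]
    keep₁ : ∀ r → r < 24 → ρ₁ r ≡ reg σ r
    keep₁ r r<24 = update-≢ (reg σ) H (<⇒≢ r<24)
    keep : ∀ r → r < 24 → ρ₅ r ≡ reg σ r
    keep r r<24 = trans (update-≢ ρ₄ D (<⇒≢ (≤-trans r<24 (m≤m+n 24 5))))
      (trans (update-≢ ρ₃ F (<⇒≢ (≤-trans r<24 (m≤m+n 24 4))))
      (trans (update-≢ ρ₂ I (<⇒≢ (≤-trans r<24 (m≤m+n 24 1))))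
      (trans (update-≢ ρ₁ W (<⇒≢ (≤-trans r<24 (m≤m+n 24 3)))) (keep₁ r r<24))))
    start : AtColumn A₁ (A₁ + w) B₁ g ⟪ ρ₅ , mem σ ⟫ opp true 0 (suc w)
    start = record
      { frame = record
        { major₁ = trans (keep _ (lower<24 transposed)) p₁
        ; major₂ = trans (keep _ (upper<24 transposed)) p₂
        ; minor₁ = trans (keep _ (lower<24 (not transposed))) p₃
        ; minor₂ = trans (keep _ (upper<24 (not transposed))) p₄
        ; height = extent B₁ p₃ g p₄ }
      ; mode = refl
      ; dir = refl
      ; col = refl
      ; width = extent A₁ (trans (keep₁ _ (lower<24 transposed)) p₁) w (trans (keep₁ _ (upper<24 transposed)) p₂) }

-- Corner-to-corner sweeps of rectangles

_≈ᶻ_ : ℤ → ℤ → Set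
i ≈ᶻ j = i ≤ℤ sucℤ j × j ≤ℤ sucℤ i

_~_ : Point → Point → Set
(x , y) ~ (x′ , y′) = x ≈ᶻ x′ × y ≈ᶻ y′

side : Bool → ∀ {A : Set} → A → A → A
side false lo up = lo
side true  lo up = up

coord-injective : ∀ hi lo w {i j} → i ≤ w → j ≤ w → coord hi lo (lo + w) i ≡ coord hi lo (lo + w) j → i ≡ j
coord-injective false lo w _ _ eq = +-cancelˡ-≡ lo _ _ eq
coord-injective true  lo w p q eq = ∸-cancelˡ-≡ (m≤n⇒m≤o+n lo p) (m≤n⇒m≤o+n lo q) eq

coord-near : ∀ hi lo up {i j} → i ≈₁ j → coord hi lo up i ≈₁ coord hi lo up j
coord-near false lo up {i} {j} (p , q) = ≤-trans (+-monoʳ-≤ lo p) (≤-reflexive (+-suc lo j)) , ≤-trans (+-monoʳ-≤ lo q) (≤-reflexive (+-suc lo i))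
coord-near true  lo up (p , q) = near up q , near up p
  where
  near : ∀ n {i j} → j ≤ suc i → n ∸ i ≤ suc (n ∸ j)
  near n {i} {j} p = ≤-trans (m∸n≤ n i) (s≤s (∸-monoʳ-≤ n p))
    where
    m∸n≤ : ∀ m n → m ∸ n ≤ suc (m ∸ suc n)
    m∸n≤ zero    n       = ≤-trans (≤-reflexive (0∸n≡0 n)) z≤n
    m∸n≤ (suc m) zero    = ≤-refl
    m∸n≤ (suc m) (suc n) = m∸n≤ m n

coord-inside : ∀ hi lo w {i} → i ≤ w → lo ≤ coord hi lo (lo + w) i × coord hi lo (lo + w) i ≤ lo + w
coord-inside false lo w p = m≤m+n lo _ , +-monoʳ-≤ lo p
coord-inside true  lo w {i} p = subst (lo ≤_) (sym (+-∸-assoc lo p)) (m≤m+n lo _) , m∸n≤m (lo + w) i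

coord-onto : ∀ hi lo w {x} → lo ≤ x → x ≤ lo + w → Σ[ i ∈ ℕ ] i ≤ w × x ≡ coord hi lo (lo + w) i
coord-onto false lo w {x} p q = x ∸ lo , m≤n+o⇒m∸n≤o x lo q , sym (m+[n∸m]≡n p)
coord-onto true  lo w {x} p q = lo + w ∸ x , ≤-trans (∸-monoʳ-≤ (lo + w) p) (≤-reflexive (m+n∸m≡n lo w)) , sym (m∸[m∸n]≡n q)

coord-0 : ∀ hi lo w → coord hi lo (lo + w) 0 ≡ side hi lo (lo + w)
coord-0 false lo w = +-identityʳ lo
coord-0 true  lo w = refl

coord-w : ∀ hi lo w → coord hi lo (lo + w) w ≡ side (not hi) lo (lo + w)
coord-w false lo w = refl
coord-w true  lo w = m+n∸n≡m lo w

near-pos : ∀ {i j} → i ≈₁ j → pos i ≈ᶻ pos j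
near-pos (p , q) = +≤+ p , +≤+ q

data Mode : Set where
  across along↔ along↕ : Mode

Corner : Set
Corner = Bool × Bool

-- A corner is given by whether it is at the right and at the bottom.
opposite : Mode → Corner → Corner
opposite across  (r , b) = not r , not b
opposite along↔ (r , b) = not r , b
opposite along↕ (r , b) = r , not b

cornerAt : Corner → (x₁ x₂ y₁ y₂ : ℤ) → Point
cornerAt (r , b) x₁ x₂ y₁ y₂ = side r x₁ x₂ , side b y₁ y₂

-- Sweeping column by column always ends at the other vertical side, so ending on the same vertical
-- side takes the transposed traversal, row by row.
route : Corner → Mode → Program
route (r , b) across  = Traversal.traverse false r b true
route (r , b) along↔ = Traversal.traverse false r b false
route (r , b) along↕ = Traversal.traverse true  b r false

-- The price is `K` per emitted vertex instead of a total. Rates simply add when programs are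
-- joined, and constant overhead is absorbed because a path is never empty.
record Emits (P : Program) (σ : State) (K k : ℕ) (R : Point → Set) (p q : Point) : Set where
  constructor emits
  field
    {path}  : List Point
    sweep   : Sweep _~_ R p q path
    running : Runs P σ (K * length path) (λ σ′ → out σ′ ≡ out σ ++ path × Keeps k σ σ′)

sweep-nonempty : ∀ {R p q xs} → Sweep _~_ R p q xs → 1 ≤ length xs
sweep-nonempty {xs = _ ∷ _} s = s≤s z≤n

module _ (A₁ w B₁ g : ℕ) (ma mi opp : Bool) (feasible : Boustrophedon.Feasible g opp (suc w)) where

  private
    X = coord ma A₁ (A₁ + w)
    Y = coord mi B₁ (B₁ + g)
    cs = Boustrophedon.columns g (suc w) opp true 0 (suc w)
    InBox′ = InBox (pos A₁) (pos (A₁ + w)) (pos B₁) (pos (B₁ + g))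

  sweep-rectangle :
    Sweep _~_ InBox′ (pos (side ma A₁ (A₁ + w)) , pos (side mi B₁ (B₁ + g)))
      (pos (side (not ma) A₁ (A₁ + w)) , pos (side (if opp then not mi else mi) B₁ (B₁ + g)))
      (map (λ (i , j) → pos (X i) , pos (Y j)) cs)
  sweep-rectangle = sweep-start startEq (sweep-end endEq
    (sweep-map _ inj hom into onto (Boustrophedon.sweep-columns g (suc w) opp true 0 w ≤-refl feasible)))
    where
    R = Boustrophedon.InColumns g 0 (suc w)
    point : Cell → Point
    point (i , j) = pos (X i) , pos (Y j)
    startEq : point (0 , 0) ≡ (pos (side ma A₁ (A₁ + w)) , pos (side mi B₁ (B₁ + g)))
    startEq = cong₂ (λ a b → pos a , pos b) (coord-0 ma A₁ w) (coord-0 mi B₁ g)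
    last-row : ∀ opp → Y (Boustrophedon.finish g opp true) ≡ side (if opp then not mi else mi) B₁ (B₁ + g)
    last-row true  = coord-w mi B₁ g
    last-row false = coord-0 mi B₁ g
    endEq : point (w , Boustrophedon.finish g opp true) ≡ (pos (side (not ma) A₁ (A₁ + w)) , pos (side (if opp then not mi else mi) B₁ (B₁ + g)))
    endEq = cong₂ (λ a b → pos a , pos b) (coord-w ma A₁ w) (last-row opp)
    inj : ∀ {u v} → R u → R v → point u ≡ point v → u ≡ v
    inj {i , j} {i′ , j′} ((_ , p) , q) ((_ , p′) , q′) eq = cong₂ _,_
      (coord-injective ma A₁ w (s≤s⁻¹ p) (s≤s⁻¹ p′) (ℤₚ.+-injective (cong proj₁ eq)))
      (coord-injective mi B₁ g (s≤s⁻¹ q) (s≤s⁻¹ q′) (ℤₚ.+-injective (cong proj₂ eq)))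
    hom : ∀ {u v} → R u → R v → u ~ᶜ v → point u ~ point v
    hom _ _ (p , q) = near-pos (coord-near ma A₁ (A₁ + w) p) , near-pos (coord-near mi B₁ (B₁ + g) q)
    into : ∀ {u} → R u → InBox′ (point u)
    into ((_ , p) , q) = let (a , b) = coord-inside ma A₁ w (s≤s⁻¹ p); (c , d) = coord-inside mi B₁ g (s≤s⁻¹ q) in
      (+≤+ a , +≤+ b) , (+≤+ c , +≤+ d)
    onto : ∀ {z} → InBox′ z → Σ[ u ∈ Cell ] R u × z ≡ point u
    onto ((+≤+ a , +≤+ b) , (+≤+ c , +≤+ d)) =
      let (i , i≤w , eqx) = coord-onto ma A₁ w a b; (j , j≤g , eqy) = coord-onto mi B₁ g c d in
      (i , j) , ((z≤n , s≤s i≤w) , s≤s j≤g) , cong₂ (λ a b → pos a , pos b) eqx eqy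

sweep-transpose : ∀ {x₁ x₂ y₁ y₂ p₁ p₂ q₁ q₂ xs} → Sweep _~_ (InBox y₁ y₂ x₁ x₂) (p₁ , p₂) (q₁ , q₂) xs →
  Sweep _~_ (InBox x₁ x₂ y₁ y₂) (p₂ , p₁) (q₂ , q₁) (map swap xs)
sweep-transpose = sweep-map swap (λ _ _ eq → cong swap eq) (λ _ _ (p , q) → q , p) (λ (p , q) → q , p)
  λ {z} (p , q) → swap z , (q , p) , refl

Feasible-route : Mode → (w g : ℕ) → Set
Feasible-route across  w g = ⊤
Feasible-route along↔ w g = 1 ≤ w ⊎ g ≡ 0
Feasible-route along↕ w g = 1 ≤ g ⊎ w ≡ 0

emits-route : ∀ c mode X₁ w Y₁ g {σ} → Feasible-route mode w g →
  reg σ 20 ≡ X₁ → reg σ 21 ≡ X₁ + w → reg σ 22 ≡ Y₁ → reg σ 23 ≡ Y₁ + g →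
  let x₁ = pos X₁; x₂ = pos (X₁ + w); y₁ = pos Y₁; y₂ = pos (Y₁ + g) in
  Emits (route c mode) σ 122 20 (InBox x₁ x₂ y₁ y₂) (cornerAt c x₁ x₂ y₁ y₂) (cornerAt (opposite mode c) x₁ x₂ y₁ y₂)
emits-route (r , b) mode X₁ w Y₁ g feasible p₁ p₂ p₃ p₄ = go mode feasible
  where
  -- 122 = 18 + 100 + 4, with the prelude and the final test charged to a vertex that exists.
  linear : ∀ {n} → 1 ≤ n → 18 + (100 * n + 4) ≤ 122 * n
  linear {n@(suc _)} _ = begin
    18 + (100 * n + 4)  ≡⟨ trans (+-comm 18 (100 * n + 4)) (+-assoc (100 * n) 4 18) ⟩
    100 * n + 22        ≤⟨ +-monoʳ-≤ (100 * n) (m≤m*n 22 n) ⟩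
    100 * n + 22 * n    ≡⟨ *-distribʳ-+ n 100 22 ⟨
    122 * n             ∎
    where open ≤-Reasoning
  side-pos : ∀ b {m n} → pos (side b m n) ≡ side b (pos m) (pos n)
  side-pos false = refl
  side-pos true  = refl
  loose : ∀ {w g} → 1 ≤ w ⊎ g ≡ 0 → Boustrophedon.Feasible g false (suc w)
  loose (inj₁ p) = inj₁ (s≤s p)
  loose {zero}  (inj₂ q) = inj₂ (refl , q)
  loose {suc w} (inj₂ q) = inj₁ (s≤s (s≤s z≤n))
  x₁ = pos X₁
  x₂ = pos (X₁ + w)
  y₁ = pos Y₁
  y₂ = pos (Y₁ + g)
  go : ∀ mode → Feasible-route mode w g → Emits (route (r , b) mode) _ 122 20 (InBox x₁ x₂ y₁ y₂) (cornerAt (r , b) x₁ x₂ y₁ y₂) (cornerAt (opposite mode (r , b)) x₁ x₂ y₁ y₂)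
  go across _ = emits s (runs-weaken (linear (sweep-nonempty s)) id (Traversal.runs-traverse false r b X₁ w Y₁ g true p₁ p₂ p₃ p₄))
    where s = sweep-start (cong₂ _,_ (side-pos r) (side-pos b)) (sweep-end (cong₂ _,_ (side-pos (not r)) (side-pos (not b))) (sweep-rectangle X₁ w Y₁ g r b true (s≤s z≤n)))
  go along↔ f = emits s (runs-weaken (linear (sweep-nonempty s)) id (Traversal.runs-traverse false r b X₁ w Y₁ g false p₁ p₂ p₃ p₄))
    where s = sweep-start (cong₂ _,_ (side-pos r) (side-pos b)) (sweep-end (cong₂ _,_ (side-pos (not r)) (side-pos b)) (sweep-rectangle X₁ w Y₁ g r b false (loose f)))
  go along↕ f = emits s (runs-weaken (linear (sweep-nonempty s)) id (Traversal.runs-traverse true b r Y₁ g X₁ w false p₃ p₄ p₁ p₂))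
    where s = subst (Sweep _~_ _ _ _) (sym (map-∘ _)) (sweep-start (cong₂ _,_ (side-pos r) (side-pos b)) (sweep-end (cong₂ _,_ (side-pos r) (side-pos (not b))) (sweep-transpose (sweep-rectangle Y₁ g X₁ w b r false (loose f)))))

-- Difference constraints

private variable
  n : ℕ

data Axis : Set where
  ξ η : Axis

record Term (n : ℕ) : Set where
  constructor _⊹_
  field
    variable-of : Fin n
    offset      : ℤ
open Term public

infix 8 _⊹_

Env : ℕ → Set
Env n = Axis → Fin n → ℤ

val : ∀ {n} → (Fin n → ℤ) → Term n → ℤ
val ρ (v ⊹ k) = ρ v +ℤ k

-- Both sides share one axis: horizontal and vertical coordinates are never compared, so a context
-- consists of two independent matrices.
record Atom (n : ℕ) : Set where
  constructor atom
  field
    axis : Axis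
    lhs rhs : Term n
open Atom public

Clause : ℕ → Set
Clause n = List (Atom n)

record Guard (n : ℕ) : Set where
  constructor guard
  field
    units   : List (Atom n)
    clauses : List (Clause n)
open Guard public

Holds : Env n → Atom n → Set
Holds ρ (atom ax t u) = val (ρ ax) t ≤ℤ val (ρ ax) u

Meets : Env n → Guard n → Set
Meets ρ g = All (Holds ρ) (units g) × All (Any (Holds ρ)) (clauses g)

holds? : (ρ : Env n) (a : Atom n) → Dec (Holds ρ a)
holds? ρ (atom ax t u) = val (ρ ax) t ℤₚ.≤? val (ρ ax) u

raise : Term n → Term n
raise (v ⊹ k) = v ⊹ (1ℤ +ℤ k)

val-raise : ∀ (ρ : Fin n → ℤ) t → val ρ (raise t) ≡ sucℤ (val ρ t)
val-raise ρ (v ⊹ k) = begin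
  ρ v +ℤ (1ℤ +ℤ k)   ≡⟨ ℤₚ.+-assoc (ρ v) 1ℤ k ⟨
  ρ v +ℤ 1ℤ +ℤ k     ≡⟨ cong (_+ℤ k) (ℤₚ.+-comm (ρ v) 1ℤ) ⟩
  1ℤ +ℤ ρ v +ℤ k     ≡⟨ ℤₚ.+-assoc 1ℤ (ρ v) k ⟩
  1ℤ +ℤ (ρ v +ℤ k)   ∎
  where open ≡-Reasoning

-- Over the integers the negation of a difference constraint is again one, so case distinctions stay
-- inside the class.
negate : Atom n → Atom n
negate (atom ax t u) = atom ax (raise u) t

holds-negate : ∀ (ρ : Env n) a → ¬ Holds ρ a → Holds ρ (negate a)
holds-negate ρ (atom ax t u) ¬h = subst (_≤ℤ val (ρ ax) t) (sym (val-raise (ρ ax) u)) (ℤₚ.i<j⇒suc[i]≤j (ℤₚ.≰⇒> ¬h))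

¬holds-negate : ∀ (ρ : Env n) a → Holds ρ (negate a) → ¬ Holds ρ a
¬holds-negate ρ (atom ax t u) h h′ = ℤₚ.<-irrefl refl (ℤₚ.<-≤-trans (ℤₚ.suc[i]≤j⇒i<j (subst (_≤ℤ val (ρ ax) t) (val-raise (ρ ax) u) h)) h′)

-- Difference bound matrices: entry i j bounds ρ i - ρ j from above.

DBM : ℕ → Set
DBM n = Vec (Vec (Maybe ℤ) n) n

Below : ℤ → ℤ → Maybe ℤ → Set
Below i j nothing  = ⊤
Below i j (just c) = i ≤ℤ j +ℤ c

Fits : (Fin n → ℤ) → DBM n → Set
Fits ρ M = ∀ i j → Below (ρ i) (ρ j) (lookupⱽ (lookupⱽ M i) j)

_⊓ᴹ_ : Maybe ℤ → Maybe ℤ → Maybe ℤ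
nothing ⊓ᴹ b       = b
just a  ⊓ᴹ nothing = just a
just a  ⊓ᴹ just b  = just (if a ≤ᵇℤ b then a else b)

_+ᴹ_ : Maybe ℤ → Maybe ℤ → Maybe ℤ
just a  +ᴹ just b = just (a +ℤ b)
just _  +ᴹ nothing = nothing
nothing +ᴹ _       = nothing

below-⊓ : ∀ {i j} a b → Below i j a → Below i j b → Below i j (a ⊓ᴹ b)
below-⊓ nothing  b        p q = q
below-⊓ (just a) nothing  p q = p
below-⊓ (just a) (just b) p q with a ≤ᵇℤ b
... | true  = p
... | false = q

below-+ : ∀ {i j k} a b → Below i j a → Below j k b → Below i k (a +ᴹ b)
below-+ {i} {j} {k} (just a) (just b) p q = begin
  i                  ≤⟨ p ⟩
  j +ℤ a            ≤⟨ ℤₚ.+-monoˡ-≤ a q ⟩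
  k +ℤ b +ℤ a      ≡⟨ trans (ℤₚ.+-assoc k b a) (cong (k +ℤ_) (ℤₚ.+-comm b a)) ⟩
  k +ℤ (a +ℤ b)    ∎
  where open ℤₚ.≤-Reasoning
below-+ (just a) nothing p q = tt
below-+ nothing  b       p q = tt

-- The update of all-pairs shortest paths for one new edge from `u` to `v`: a path that gains from
-- the edge uses it once. Starting from `unconstrained` the matrices thus stay closed, and a single
-- entry decides entailment. The proofs below establish soundness of the bounds.
tighten : DBM n → Fin n → Fin n → ℤ → DBM n
tighten M u v c = mapⱽ (λ row → zipWith _⊓ᴹ_ row (mapⱽ ((lookupⱽ row u +ᴹ just c) +ᴹ_) (lookupⱽ M v))) M

fits-tighten : ∀ {ρ : Fin n → ℤ} M u v c → Fits ρ M → ρ u ≤ℤ ρ v +ℤ c → Fits ρ (tighten M u v c)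
fits-tighten {ρ = ρ} M u v c fits le i j = subst (Below (ρ i) (ρ j)) (sym entry)
  (below-⊓ (lookupⱽ (lookupⱽ M i) j) _ (fits i j)
    (below-+ (lookupⱽ (lookupⱽ M i) u +ᴹ just c) (lookupⱽ (lookupⱽ M v) j)
      (below-+ (lookupⱽ (lookupⱽ M i) u) (just c) (fits i u) le) (fits v j)))
  where
  f = λ row → zipWith _⊓ᴹ_ row (mapⱽ ((lookupⱽ row u +ᴹ just c) +ᴹ_) (lookupⱽ M v))
  entry : lookupⱽ (lookupⱽ (mapⱽ f M) i) j ≡ lookupⱽ (lookupⱽ M i) j ⊓ᴹ ((lookupⱽ (lookupⱽ M i) u +ᴹ just c) +ᴹ lookupⱽ (lookupⱽ M v) j)
  entry = trans (cong (λ r → lookupⱽ r j) (lookup-map i f M)) (trans (lookup-zipWith _⊓ᴹ_ j (lookupⱽ M i) _)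
    (cong (lookupⱽ (lookupⱽ M i) j ⊓ᴹ_) (lookup-map j ((lookupⱽ (lookupⱽ M i) u +ᴹ just c) +ᴹ_) (lookupⱽ M v))))

-- nothing is the inconsistent context.
Context : ℕ → Set
Context n = Maybe (DBM n × DBM n)

Sat : Env n → Context n → Set
Sat ρ nothing        = ⊥
Sat ρ (just (M , N)) = Fits (ρ ξ) M × Fits (ρ η) N

slack : Atom n → ℤ
slack (atom _ (_ ⊹ k) (_ ⊹ l)) = l -ℤ k

holds⇒slack : ∀ (ρ : Env n) a → Holds ρ a → ρ (axis a) (variable-of (lhs a)) ≤ℤ ρ (axis a) (variable-of (rhs a)) +ℤ slack a
holds⇒slack ρ (atom ax (u ⊹ k) (v ⊹ l)) h = begin
  ρ ax u                      ≡⟨ ℤₚ.+-identityʳ (ρ ax u) ⟨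
  ρ ax u +ℤ 0ℤ             ≡⟨ cong (ρ ax u +ℤ_) (ℤₚ.+-inverseʳ k) ⟨
  ρ ax u +ℤ (k -ℤ k)        ≡⟨ ℤₚ.+-assoc (ρ ax u) k (-ℤ k) ⟨
  ρ ax u +ℤ k -ℤ k          ≤⟨ ℤₚ.+-monoˡ-≤ (-ℤ k) h ⟩
  ρ ax v +ℤ l -ℤ k          ≡⟨ ℤₚ.+-assoc (ρ ax v) l (-ℤ k) ⟩
  ρ ax v +ℤ (l -ℤ k)        ∎
  where open ℤₚ.≤-Reasoning

slack⇒holds : ∀ (ρ : Env n) a → ρ (axis a) (variable-of (lhs a)) ≤ℤ ρ (axis a) (variable-of (rhs a)) +ℤ slack a → Holds ρ a
slack⇒holds ρ (atom ax (u ⊹ k) (v ⊹ l)) h = begin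
  ρ ax u +ℤ k                      ≤⟨ ℤₚ.+-monoˡ-≤ k h ⟩
  ρ ax v +ℤ (l -ℤ k) +ℤ k        ≡⟨ ℤₚ.+-assoc (ρ ax v) (l -ℤ k) k ⟩
  ρ ax v +ℤ (l -ℤ k +ℤ k)        ≡⟨ cong (ρ ax v +ℤ_) (trans (ℤₚ.+-assoc l (-ℤ k) k) (trans (cong (l +ℤ_) (ℤₚ.+-inverseˡ k)) (ℤₚ.+-identityʳ l))) ⟩
  ρ ax v +ℤ l                      ∎
  where open ℤₚ.≤-Reasoning

within-bound : Maybe ℤ → ℤ → Bool
within-bound nothing  c = false
within-bound (just d) c = d ≤ᵇℤ c

tight-sound : ∀ {i j} b c → within-bound b c ≡ true → Below i j b → i ≤ℤ j +ℤ c
tight-sound {j = j} (just d) c eq p = ℤₚ.≤-trans p (ℤₚ.+-monoʳ-≤ j (ℤₚ.≤ᵇ⇒≤ (subst T (sym eq) tt)))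

contradictory : Maybe ℤ → ℤ → Bool
contradictory nothing  c = false
contradictory (just d) c = d +ℤ c ≤ᵇℤ -1ℤ

contradictory-sound : ∀ {i j} b c → contradictory b c ≡ true → Below j i b → i ≤ℤ j +ℤ c → ⊥
contradictory-sound {i} {j} (just d) c eq p q = ℤₚ.<-irrefl refl (ℤₚ.≤-<-trans
  (below-+ {i} {j} {i} (just c) (just d) q p) (subst₂ _<ℤ_ (cong (i +ℤ_) (ℤₚ.+-comm d c)) (ℤₚ.+-identityʳ i) (ℤₚ.+-monoʳ-< i negative)))
  where
  negative : d +ℤ c <ℤ 0ℤ
  negative = ℤₚ.≤-<-trans (ℤₚ.≤ᵇ⇒≤ (subst T (sym eq) tt)) -<+

-- A bound that is already implied leaves the matrix unchanged, and a cycle of negative weight makes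
-- the context inconsistent.
addᴹ : DBM n → Fin n → Fin n → ℤ → Maybe (DBM n)
addᴹ M u v c =
  if within-bound (lookupⱽ (lookupⱽ M u) v) c then just M else
  if contradictory (lookupⱽ (lookupⱽ M v) u) c then nothing else
  just (tighten M u v c)

assume : Context n → Atom n → Context n
assume nothing _ = nothing
assume (just (M , N)) a@(atom ξ (u ⊹ _) (v ⊹ _)) = mapᴹ (_, N) (addᴹ M u v (slack a))
assume (just (M , N)) a@(atom η (u ⊹ _) (v ⊹ _)) = mapᴹ (M ,_) (addᴹ N u v (slack a))

Fits? : (Fin n → ℤ) → Maybe (DBM n) → Set
Fits? ρ nothing  = ⊥
Fits? ρ (just M) = Fits ρ M

fits-add : ∀ {ρ : Fin n → ℤ} M u v c → Fits ρ M → ρ u ≤ℤ ρ v +ℤ c → Fits? ρ (addᴹ M u v c)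
fits-add M u v c fits le with within-bound (lookupⱽ (lookupⱽ M u) v) c
... | true = fits
... | false with contradictory (lookupⱽ (lookupⱽ M v) u) c in eq
...   | true  = contradictory-sound (lookupⱽ (lookupⱽ M v) u) c eq (fits v u) le
...   | false = fits-tighten M u v c fits le

sat-assume : ∀ {ρ : Env n} c a → Sat ρ c → Holds ρ a → Sat ρ (assume c a)
sat-assume {ρ = ρ} (just (M , N)) a@(atom ξ (u ⊹ _) (v ⊹ _)) (p , q) h
  with addᴹ M u v (slack a) | fits-add {ρ = ρ ξ} M u v (slack a) p (holds⇒slack ρ a h)
... | just _ | p′ = p′ , q
sat-assume {ρ = ρ} (just (M , N)) a@(atom η (u ⊹ _) (v ⊹ _)) (p , q) h
  with addᴹ N u v (slack a) | fits-add {ρ = ρ η} N u v (slack a) q (holds⇒slack ρ a h)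
... | just _ | q′ = p , q′

assumeAll : Context n → List (Atom n) → Context n
assumeAll c []       = c
assumeAll c (a ∷ as) = assumeAll (assume c a) as

sat-assumeAll : ∀ {ρ : Env n} c as → Sat ρ c → All (Holds ρ) as → Sat ρ (assumeAll c as)
sat-assumeAll c []       s []       = s
sat-assumeAll c (a ∷ as) s (h ∷ hs) = sat-assumeAll (assume c a) as (sat-assume c a s h) hs

weaken : DBM n → DBM (suc n)
weaken {n} M = (just 0ℤ ∷ replicate n nothing) ∷ mapⱽ (nothing ∷_) M

fits-weaken : ∀ (ρ : Fin (suc n) → ℤ) M → Fits (ρ ∘ suc) M → Fits ρ (weaken M)
fits-weaken ρ M fits zero zero = ℤₚ.≤-reflexive (sym (ℤₚ.+-identityʳ (ρ zero)))
fits-weaken ρ M fits zero (suc j) = subst (Below (ρ zero) (ρ (suc j))) (sym (lookup-replicate j nothing)) tt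
fits-weaken ρ M fits (suc i) zero = subst (λ r → Below (ρ (suc i)) (ρ zero) (lookupⱽ r zero)) (sym (lookup-map i (nothing ∷_) M)) tt
fits-weaken ρ M fits (suc i) (suc j) = subst (λ r → Below (ρ (suc i)) (ρ (suc j)) (lookupⱽ r (suc j))) (sym (lookup-map i (nothing ∷_) M)) (fits i j)

unconstrained : DBM n
unconstrained {zero}  = []
unconstrained {suc n} = weaken unconstrained

fits-unconstrained : (ρ : Fin n → ℤ) → Fits ρ unconstrained
fits-unconstrained {suc n} ρ = fits-weaken ρ unconstrained (fits-unconstrained (ρ ∘ suc))

anything : Context n
anything = just (unconstrained , unconstrained)

sat-anything : ∀ (ρ : Env n) → Sat ρ anything
sat-anything ρ = fits-unconstrained (ρ ξ) , fits-unconstrained (ρ η)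

-- Proof search in a context

Under : Context n → (Env n → Set) → Set
Under c X = ∀ ρ → Sat ρ c → X ρ

-- The checks below search for proofs; nothing means that none was found.
Check : Context n → (Env n → Set) → Set
Check c X = Maybe (Under c X)

found : ∀ {A : Set} (x : Maybe A) → is-just x ≡ true → A
found (just a) _ = a

vacuous : {X : Env n → Set} → Under nothing X
vacuous ρ ()

entail : (c : Context n) (a : Atom n) → Check c (λ ρ → Holds ρ a)
entail nothing a = just vacuous
entail (just (M , N)) a@(atom ξ (u ⊹ _) (v ⊹ _)) with within-bound (lookupⱽ (lookupⱽ M u) v) (slack a) in eq
... | true  = just λ ρ (p , _) → slack⇒holds ρ a (tight-sound (lookupⱽ (lookupⱽ M u) v) _ eq (p u v))
... | false = nothing
entail (just (M , N)) a@(atom η (u ⊹ _) (v ⊹ _)) with within-bound (lookupⱽ (lookupⱽ N u) v) (slack a) in eq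
... | true  = just λ ρ (_ , q) → slack⇒holds ρ a (tight-sound (lookupⱽ (lookupⱽ N u) v) _ eq (q u v))
... | false = nothing

refute : (c : Context n) (a : Atom n) → Check c (λ ρ → ¬ Holds ρ a)
refute c a = mapᴹ (λ f ρ s → ¬holds-negate ρ a (f ρ s)) (entail c (negate a))

entailAll : (c : Context n) (as : List (Atom n)) → Check c (λ ρ → All (Holds ρ) as)
entailAll c []       = just λ _ _ → []
entailAll c (a ∷ as) = zipWithᴹ (λ f g ρ s → f ρ s ∷ g ρ s) (entail c a) (entailAll c as)

entailAny : (c : Context n) (as : List (Atom n)) → Check c (λ ρ → Any (Holds ρ) as)
entailAny c []       = nothing
entailAny c (a ∷ as) = mapᴹ (λ f ρ s → here (f ρ s)) (entail c a) <∣> mapᴹ (λ f ρ s → there (f ρ s)) (entailAny c as)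

refuteClause : (c : Context n) (as : Clause n) → Check c (λ ρ → ¬ Any (Holds ρ) as)
refuteClause c []       = just λ _ _ ()
refuteClause c (a ∷ as) = zipWithᴹ (λ f g ρ s → λ { (here h) → f ρ s h ; (there h) → g ρ s h }) (refute c a) (refuteClause c as)

refuteGuard : (c : Context n) (g : Guard n) → Check c (λ ρ → ¬ Meets ρ g)
refuteGuard c (guard us cs) = mapᴹ (λ f ρ s → f ρ s ∘ proj₁) (inUnits us) <∣> mapᴹ (λ f ρ s → f ρ s ∘ proj₂) (inClauses cs)
  where
  inUnits : ∀ us → Check c (λ ρ → ¬ All (Holds ρ) us)
  inUnits []       = nothing
  inUnits (a ∷ as) = mapᴹ (λ f ρ s → λ { (h ∷ _) → f ρ s h }) (refute c a) <∣> mapᴹ (λ f ρ s → λ { (_ ∷ hs) → f ρ s hs }) (inUnits as)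
  inClauses : ∀ cs → Check c (λ ρ → ¬ All (Any (Holds ρ)) cs)
  inClauses []       = nothing
  inClauses (a ∷ as) = mapᴹ (λ f ρ s → λ { (h ∷ _) → f ρ s h }) (refuteClause c a) <∣> mapᴹ (λ f ρ s → λ { (_ ∷ hs) → f ρ s hs }) (inClauses as)

module _ {X : Env n → Set} (k : (c : Context n) → Check c X) where

  -- Prunes the search: no work is done in an inconsistent case, which keeps the case trees finite
  -- in practice.
  continue : (c : Context n) → Check c X
  continue nothing    = just vacuous
  continue c@(just _) = k c

  -- The cases in which a guard fails, explored one failing constraint at a time.
  otherwise : (c : Context n) (g : Guard n) → Check c (λ ρ → ¬ Meets ρ g → X ρ)
  otherwise c (guard us cs) = inUnits c us
    where
    inClauses : ∀ c cs → Check c (λ ρ → ¬ All (Any (Holds ρ)) cs → X ρ)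
    inClauses c []       = just λ ρ s ¬h → contradiction [] ¬h
    -- For the later clauses the context does not record that `a` holds: that is a disjunction,
    -- which no matrix expresses.
    inClauses c (a ∷ as) = zipWithᴹ
      (λ f g ρ s ¬h → step f g ρ s ¬h (Any.any? (holds? ρ) a))
      (continue (assumeAll c (map negate a))) (inClauses c as)
      where
      negated : ∀ ρ as → ¬ Any (Holds ρ) as → All (Holds ρ) (map negate as)
      negated ρ []       ¬h = []
      negated ρ (a ∷ as) ¬h = holds-negate ρ a (¬h ∘ here) ∷ negated ρ as (¬h ∘ there)
      step : Under (assumeAll c (map negate a)) X → Under c (λ ρ → ¬ All (Any (Holds ρ)) as → X ρ) →
        ∀ ρ → Sat ρ c → ¬ All (Any (Holds ρ)) (a ∷ as) → Dec (Any (Holds ρ) a) → X ρ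
      step f g ρ s ¬h (yes h) = g ρ s (λ hs → ¬h (h ∷ hs))
      step f g ρ s ¬h (no ¬a) = f ρ (sat-assumeAll c _ s (negated ρ a ¬a))
    inUnits : ∀ c us → Check c (λ ρ → ¬ (All (Holds ρ) us × All (Any (Holds ρ)) cs) → X ρ)
    inUnits c []       = mapᴹ (λ f ρ s ¬h → f ρ s (λ hs → ¬h ([] , hs))) (inClauses c cs)
    inUnits c (a ∷ as) = zipWithᴹ (λ f g ρ s ¬h → step f g ρ s ¬h (holds? ρ a))
      (continue (assume c (negate a))) (inUnits (assume c a) as)
      where
      step : Under (assume c (negate a)) X → Under (assume c a) (λ ρ → ¬ (All (Holds ρ) as × All (Any (Holds ρ)) cs) → X ρ) →
        ∀ ρ → Sat ρ c → ¬ (All (Holds ρ) (a ∷ as) × All (Any (Holds ρ)) cs) → Dec (Holds ρ a) → X ρ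
      step f g ρ s ¬h (yes h) = g ρ (sat-assume c a s h) (λ (hs , hs′) → ¬h (h ∷ hs , hs′))
      step f g ρ s ¬h (no ¬a) = f ρ (sat-assume c (negate a) s (holds-negate ρ a ¬a))

  -- One case for every choice of a disjunct from each clause; contradictory choices end in
  -- `continue`.
  supposing : (c : Context n) (g : Guard n) → Check c (λ ρ → Meets ρ g → X ρ)
  supposing c (guard us cs) = mapᴹ (λ f ρ s (h , h′) → f ρ (sat-assumeAll c us s h) h′) (inClauses (assumeAll c us) cs)
    where
    inClauses : ∀ c cs → Check c (λ ρ → All (Any (Holds ρ)) cs → X ρ)
    inClause  : ∀ c as cs → Check c (λ ρ → Any (Holds ρ) as → All (Any (Holds ρ)) cs → X ρ)
    inClauses c []       = mapᴹ (λ f ρ s _ → f ρ s) (continue c)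
    inClauses c (a ∷ as) = mapᴹ (λ f ρ s → λ { (h ∷ hs) → f ρ s h hs }) (inClause c a as)
    inClause c []       cs = just λ _ _ ()
    inClause c (a ∷ as) cs = zipWithᴹ (λ f g ρ s → λ { (here h) → f ρ (sat-assume c a s h) ; (there h) → g ρ s h })
      (inClauses (assume c a) cs) (inClause c as cs)

-- Rectangles with symbolic corners

record Rect (n : ℕ) : Set where
  constructor rect
  field
    left right top bottom : Term n
open Rect public

InRect : Env n → Rect n → Point → Set
InRect ρ (rect x₁ x₂ y₁ y₂) = InBox (val (ρ ξ) x₁) (val (ρ ξ) x₂) (val (ρ η) y₁) (val (ρ η) y₂)

-- Membership of a point in a rectangle is expressed by making the coordinates
-- of the point an additional variable.
extend : Env n → Point → Env (suc n)
extend ρ (x , y) ξ zero = x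
extend ρ (x , y) η zero = y
extend ρ _ ax (suc v) = ρ ax v

weakenᶜ : Context n → Context (suc n)
weakenᶜ = mapᴹ λ (M , N) → weaken M , weaken N

sat-weaken : ∀ {ρ : Env n} z c → Sat ρ c → Sat (extend ρ z) (weakenᶜ c)
sat-weaken (x , y) (just (M , N)) (p , q) = fits-weaken _ M p , fits-weaken _ N q

lift : Term n → Term (suc n)
lift (v ⊹ k) = suc v ⊹ k

here! : Term (suc n)
here! = zero ⊹ 0ℤ

inside : Rect n → List (Atom (suc n))
inside (rect x₁ x₂ y₁ y₂) =
  atom ξ (lift x₁) here! ∷ atom ξ here! (lift x₂) ∷ atom η (lift y₁) here! ∷ atom η here! (lift y₂) ∷ []

inside-sound : ∀ {ρ : Env n} {z} R → All (Holds (extend ρ z)) (inside R) → InRect ρ R z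
inside-sound {z = x , y} R (a ∷ b ∷ c ∷ d ∷ []) =
  (ℤₚ.≤-trans a (ℤₚ.≤-reflexive (ℤₚ.+-identityʳ x)) , ℤₚ.≤-trans (ℤₚ.≤-reflexive (sym (ℤₚ.+-identityʳ x))) b) ,
  (ℤₚ.≤-trans c (ℤₚ.≤-reflexive (ℤₚ.+-identityʳ y)) , ℤₚ.≤-trans (ℤₚ.≤-reflexive (sym (ℤₚ.+-identityʳ y))) d)

inside-complete : ∀ {ρ : Env n} {z} R → InRect ρ R z → All (Holds (extend ρ z)) (inside R)
inside-complete {z = x , y} R ((a , b) , (c , d)) =
  ℤₚ.≤-trans a (ℤₚ.≤-reflexive (sym (ℤₚ.+-identityʳ x))) ∷ ℤₚ.≤-trans (ℤₚ.≤-reflexive (ℤₚ.+-identityʳ x)) b ∷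
  ℤₚ.≤-trans c (ℤₚ.≤-reflexive (sym (ℤₚ.+-identityʳ y))) ∷ ℤₚ.≤-trans (ℤₚ.≤-reflexive (ℤₚ.+-identityʳ y)) d ∷ []

-- Set difference by cases. What `R` has outside the first rectangle is split by the first side that
-- is violated into at most four pieces, and each piece must be empty, that is, have an inconsistent
-- context, or be covered by the remaining rectangles.
covers : (c : Context n) (R : Rect n) (Rs : List (Rect n)) →
  Check c (λ ρ → ∀ z → InRect ρ R z → Any (λ R′ → InRect ρ R′ z) Rs)
covers {n} c R Rs = mapᴹ (λ f ρ s z i → f ρ z (sat-assumeAll (weakenᶜ c) (inside R) (sat-weaken z c s) (inside-complete {z = z} R i)))
  (search (assumeAll (weakenᶜ c) (inside R)) Rs)
  where
  Goal : Context (suc n) → List (Rect n) → Set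
  Goal c Rs = ∀ ρ z → Sat (extend ρ z) c → Any (λ R′ → InRect ρ R′ z) Rs
  search : ∀ c Rs → Maybe (Goal c Rs)
  missing : ∀ c as Rs → Maybe (∀ ρ z → Sat (extend ρ z) c → All (Holds (extend ρ z)) as ⊎ Any (λ R′ → InRect ρ R′ z) Rs)
  search nothing    Rs       = just λ _ _ ()
  search (just _)   []       = nothing
  search c@(just _) (R ∷ Rs) = mapᴹ (λ f ρ z s → [ here ∘ inside-sound {z = z} R , there ]′ (f ρ z s)) (missing c (inside R) Rs)
  missing c []       Rs = just λ _ _ _ → inj₁ []
  missing c (a ∷ as) Rs = zipWithᴹ
    (λ f g ρ z s → case holds? (extend ρ z) a of λ
      { (no ¬h) → inj₂ (f ρ z (sat-assume c (negate a) s (holds-negate (extend ρ z) a ¬h)))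
      ; (yes h) → Sum.map₁ (h ∷_) (g ρ z s) })
    (search (assume c (negate a)) Rs) (missing c as Rs)

-- Evaluating terms and guards at run time

Layout : ℕ → Set
Layout n = Axis → Fin n → ℕ

Agrees : Layout n → State → Env n → Set
Agrees lay σ ρ = ∀ ax v → ρ ax v ≡ pos (reg σ (lay ax v))

termᵉ : Layout n → Axis → Term n → Expr
termᵉ lay ax (v ⊹ pos k)    = var (lay ax v) ⊕ lit k
termᵉ lay ax (v ⊹ -[1+ k ]) = var (lay ax v) ⊖ lit (suc k)

-- A negative offset becomes a truncated subtraction, which is exact only if the value is
-- nonnegative.
⟦termᵉ⟧ : ∀ (lay : Layout n) {σ ρ} → Agrees lay σ ρ → ∀ ax t → 0ℤ ≤ℤ val (ρ ax) t → pos (⟦ termᵉ lay ax t ⟧ σ) ≡ val (ρ ax) t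
⟦termᵉ⟧ lay agrees ax (v ⊹ pos k) _ rewrite agrees ax v = refl
⟦termᵉ⟧ lay {σ} agrees ax (v ⊹ -[1+ k ]) nonneg rewrite agrees ax v = exact (reg σ (lay ax v)) (suc k) nonneg
  where
  exact : ∀ m k → 0ℤ ≤ℤ pos m +ℤ -ℤ pos k → pos (m ∸ k) ≡ pos m +ℤ -ℤ pos k
  exact m k p = trans (sym (ℤₚ.⊖-≥ (ℤₚ.drop‿+≤+ (ℤₚ.0≤i-j⇒j≤i {pos m} {pos k} p)))) (sym (ℤₚ.m-n≡m⊖n m k))

cost-termᵉ : ∀ (lay : Layout n) ax t → cost (termᵉ lay ax t) ≡ 3
cost-termᵉ lay ax (v ⊹ pos k)    = refl
cost-termᵉ lay ax (v ⊹ -[1+ k ]) = refl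

-- The difference of the two offsets is put, as a natural number, on the side where it is added. No
-- subtraction occurs, so the test is right for all values of the registers.
atomᵉ : Layout n → Atom n → Cond
atomᵉ lay a@(atom ax (u ⊹ _) (v ⊹ _)) with slack a
... | pos k    = var (lay ax u) ≤ᵉ var (lay ax v) ⊕ lit k
... | -[1+ k ] = var (lay ax u) ⊕ lit (suc k) ≤ᵉ var (lay ax v)

reflects-map : ∀ {P Q : Set} {b} → (P → Q) → (Q → P) → Reflects P b → Reflects Q b
reflects-map f g (ofʸ p)  = ofʸ (f p)
reflects-map f g (ofⁿ ¬p) = ofⁿ (¬p ∘ g)

atom-reflects : ∀ (lay : Layout n) {σ ρ} → Agrees lay σ ρ → ∀ a → Reflects (Holds ρ a) (⟦ atomᵉ lay a ⟧ᵇ σ)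
atom-reflects lay {σ} {ρ} agrees a@(atom ax (u ⊹ _) (v ⊹ _)) with slack a | slack⇒holds ρ a | holds⇒slack ρ a
... | pos k | f | g rewrite agrees ax u | agrees ax v = reflects-map (f ∘ +≤+) (ℤₚ.drop‿+≤+ ∘ g) (≤ᵇ-reflects-≤ _ _)
... | -[1+ k ] | f | g rewrite agrees ax u | agrees ax v = reflects-map (f ∘ to) (from ∘ g) (≤ᵇ-reflects-≤ (reg σ (lay ax u) + suc k) _)
  where
  to : ∀ {i j} → i + suc k ≤ j → pos i ≤ℤ pos j +ℤ -[1+ k ]
  to {i} {j} p = subst (pos i ≤ℤ_) (sym (ℤₚ.⊖-≥ (m+n≤o⇒n≤o i p))) (+≤+ (subst (_≤ j ∸ suc k) (m+n∸n≡m i (suc k)) (∸-monoˡ-≤ (suc k) p)))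
  from : ∀ {i j} → pos i ≤ℤ pos j +ℤ -[1+ k ] → i + suc k ≤ j
  from {i} {j} p = ℤₚ.drop‿+≤+ (subst (pos (i + suc k) ≤ℤ_) eq (ℤₚ.+-monoˡ-≤ (pos (suc k)) p))
    where
    eq : pos j +ℤ -[1+ k ] +ℤ pos (suc k) ≡ pos j
    eq = trans (ℤₚ.+-assoc (pos j) -[1+ k ] (pos (suc k))) (trans (cong (pos j +ℤ_) (ℤₚ.+-inverseˡ (pos (suc k)))) (ℤₚ.+-identityʳ (pos j)))

clauseᵉ : Layout n → Clause n → Cond
clauseᵉ lay []       = lit 1 ≤ᵉ lit 0
clauseᵉ lay (a ∷ as) = notᵇ (notᵇ (atomᵉ lay a) andᵇ notᵇ (clauseᵉ lay as))

clause-reflects : ∀ (lay : Layout n) {σ ρ} → Agrees lay σ ρ → ∀ as → Reflects (Any (Holds ρ) as) (⟦ clauseᵉ lay as ⟧ᵇ σ)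
clause-reflects lay agrees []       = ofⁿ λ ()
clause-reflects lay agrees (a ∷ as) = disjunction (atom-reflects lay agrees a) (clause-reflects lay agrees as)
  where
  disjunction : ∀ {b c} → Reflects _ b → Reflects _ c → Reflects _ (not (not b ∧ not c))
  disjunction (ofʸ h) _ = ofʸ (here h)
  disjunction (ofⁿ ¬h) (ofʸ h) = ofʸ (there h)
  disjunction (ofⁿ ¬h) (ofⁿ ¬h′) = ofⁿ λ { (here h) → ¬h h ; (there h) → ¬h′ h }

allᵉ : ∀ {A : Set} → (A → Cond) → List A → Cond
allᵉ f []       = lit 0 ≤ᵉ lit 0
allᵉ f (a ∷ as) = f a andᵇ allᵉ f as

all-reflects : ∀ {A : Set} {P : A → Set} (f : A → Cond) {σ} → (∀ a → Reflects (P a) (⟦ f a ⟧ᵇ σ)) → ∀ as → Reflects (All P as) (⟦ allᵉ f as ⟧ᵇ σ)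
all-reflects f r []       = ofʸ []
all-reflects f r (a ∷ as) = reflects-map (λ (p , q) → p ∷ q) (λ { (p ∷ q) → p , q }) (r a ×-reflects all-reflects f r as)

guardᵉ : Layout n → Guard n → Cond
guardᵉ lay (guard us cs) = allᵉ (atomᵉ lay) us andᵇ allᵉ (clauseᵉ lay) cs

guard-reflects : ∀ (lay : Layout n) {σ ρ} → Agrees lay σ ρ → ∀ g → Reflects (Meets ρ g) (⟦ guardᵉ lay g ⟧ᵇ σ)
guard-reflects lay agrees (guard us cs) =
  all-reflects (atomᵉ lay) (atom-reflects lay agrees) us ×-reflects all-reflects (clauseᵉ lay) (clause-reflects lay agrees) cs

runs-if-reflects : ∀ {X : Set} {b P P′ σ c Q} → Reflects X (⟦ b ⟧ᵇ σ) → (X → Runs P σ c Q) → (¬ X → Runs P′ σ c Q) →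
  Runs (ifᵖ b then P else P′) σ (1 + costᵇ b + c) Q
runs-if-reflects {X} {b} {σ = σ} r t f = runs-if (λ eq → t (invert (subst (Reflects X) eq r))) (λ eq → f (invert (subst (Reflects X) eq r)))

-- Blocks and plans

-- The estimate by which constant overhead is turned into a rate everywhere below.
linear-step : ∀ a {K n} → 1 ≤ n → a + K * n ≤ (a + K) * n
linear-step a {K} {n@(suc _)} _ = ≤-trans (+-monoˡ-≤ (K * n) (m≤m*n a n)) (≤-reflexive (sym (*-distribʳ-+ n a K)))

emits-assign : ∀ {x e P σ K k R p q} → k ≤ x → x ≢ cnt →
  Emits P ⟪ reg σ [ x ↦ ⟦ e ⟧ σ ] , mem σ ⟫ K k R p q → Emits (x ≔ e ⨾ P) σ (1 + cost e + K) k R p q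
emits-assign {x} {e} {σ = σ} {K} k≤x x≢ (emits s r) = emits s (runs-weaken (linear-step (1 + cost e) (sweep-nonempty s))
  (λ (o , keep) → trans o (cong (_++ _) same) , λ r r<k → trans (keep r r<k) (update-≢ (reg σ) x (<⇒≢ (≤-trans r<k k≤x))))
  (runs-assign {x} {e} ⟫= λ { refl → r }))
  where
  same : out ⟪ reg σ [ x ↦ ⟦ e ⟧ σ ] , mem σ ⟫ ≡ out σ
  same rewrite update-≢ (reg σ) x {⟦ e ⟧ σ} (x≢ ∘ sym) = refl

emits-weaken : ∀ {P σ K K′ k k′ R p q} → K ≤ K′ → k′ ≤ k → Emits P σ K k R p q → Emits P σ K′ k′ R p q
emits-weaken K≤ k≤ (emits s r) = emits s (runs-weaken (*-monoˡ-≤ _ K≤) (λ (o , keep) → o , λ r r<k → keep r (≤-trans r<k k≤)) r)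

emits-cong : ∀ {P σ K k R R′ p q} → (∀ {z} → R z → R′ z) → (∀ {z} → R′ z → R z) → Emits P σ K k R p q → Emits P σ K k R′ p q
emits-cong f g (emits s r) = emits (sweep-cong f g s) r

emits-seq : ∀ {P P′ σ K K′ k R R′ p q p′ q′} → Emits P σ K k R p q → q ~ p′ →
  (∀ {σ′} → Keeps k σ σ′ → Emits P′ σ′ K′ k R′ p′ q′) → (∀ {z} → R z → R′ z → ⊥) →
  Emits (P ⨾ P′) σ (K + K′) k (λ z → R z ⊎ R′ z) p q′
emits-seq {σ = σ} {K} {K′} (emits {path} s (runs e b (o , keep))) q~p next disjoint with next keep
... | emits {path′} s′ (runs e′ c (o′ , keep′)) = emits (sweep-++ s q~p s′ disjoint)
  (runs (⇓seq e e′) (≤-trans (+-mono-≤ b c) bound)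
    (trans o′ (trans (cong (_++ path′) o) (++-assoc (out σ) path path′)) , λ r r<k → trans (keep′ r r<k) (keep r r<k)))
  where
  a = length path
  b′ = length path′
  bound : K * a + K′ * b′ ≤ (K + K′) * length (path ++ path′)
  bound rewrite length-++ path {path′} = ≤-trans
    (+-mono-≤ (*-monoʳ-≤ K (m≤m+n a b′)) (*-monoʳ-≤ K′ (m≤n+m b′ a))) (≤-reflexive (sym (*-distribʳ-+ (a + b′) K K′)))

Pt : ℕ → Set
Pt n = Term n × Term n

at : Env n → Pt n → Point
at ρ (x , y) = val (ρ ξ) x , val (ρ η) y

cornerOf : Corner → Rect n → Pt n
cornerOf (r , b) (rect x₁ x₂ y₁ y₂) = side r x₁ x₂ , side b y₁ y₂

modeGuard : Mode → Rect n → List (Clause n)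
modeGuard across  R = []
modeGuard along↔ (rect x₁ x₂ y₁ y₂) = (atom ξ (raise x₁) x₂ ∷ atom η y₂ y₁ ∷ []) ∷ []
modeGuard along↕ (rect x₁ x₂ y₁ y₂) = (atom η (raise y₁) y₂ ∷ atom ξ x₂ x₁ ∷ []) ∷ []

agrees-keep : ∀ {lay : Layout n} σ σ′ {ρ k} → (∀ ax v → lay ax v < k) → Keeps k σ σ′ → Agrees lay σ ρ → Agrees lay σ′ ρ
agrees-keep σ σ′ lay<k keep agrees ax v = trans (agrees ax v) (cong pos (sym (keep _ (lay<k ax v))))

load-from : Layout n → ℕ → List (Axis × Term n) → Program → Program
load-from lay x []              P = P
load-from lay x ((ax , t) ∷ ts) P = x ≔ termᵉ lay ax t ⨾ load-from lay (suc x) ts P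

Loaded : Env n → State → ℕ → List (Axis × Term n) → Set
Loaded ρ σ x []              = ⊤
Loaded ρ σ x ((ax , t) ∷ ts) = pos (reg σ x) ≡ val (ρ ax) t × Loaded ρ σ (suc x) ts

-- The terms read registers below `k` and the loads write from `x` on, so an earlier load cannot
-- spoil a later one. Each load costs 4.
emits-load : ∀ {lay : Layout n} {σ ρ k P K R p q} x ts → (∀ ax v → lay ax v < k) → k ≤ x → x + length ts ≤ cnt → Agrees lay σ ρ →
  All (λ (ax , t) → 0ℤ ≤ℤ val (ρ ax) t) ts →
  (∀ σ′ → (∀ r → r < x → reg σ′ r ≡ reg σ r) → Loaded ρ σ′ x ts → Emits P σ′ K k R p q) →
  Emits (load-from lay x ts P) σ (length ts * 4 + K) k R p q
emits-load x [] lay<k k≤x _ agrees [] next = next _ (λ _ _ → refl) tt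
emits-load {lay = lay} {σ} {ρ} x ((ax , t) ∷ ts) lay<k k≤x x≤ agrees (nonneg ∷ nonnegs) next =
  emits-weaken (≤-reflexive (cong (λ c → 1 + c + _) (cost-termᵉ lay ax t))) ≤-refl
    (emits-assign k≤x (<⇒≢ (≤-trans (m<m+n x z<s) x≤))
      (emits-load (suc x) ts lay<k (m≤n⇒m≤1+n k≤x) (subst (_≤ cnt) (+-suc x (length ts)) x≤)
        (agrees-keep σ σ₁ lay<k (λ r r<k → update-≢ (reg σ) x (<⇒≢ (≤-trans r<k k≤x))) agrees) nonnegs
        λ σ′ keep loaded → next σ′ (λ r r<x → trans (keep r (m≤n⇒m≤1+n r<x)) (update-≢ (reg σ) x (<⇒≢ r<x)))
          (trans (cong pos (trans (keep x ≤-refl) (update-≡ (reg σ) x refl))) (⟦termᵉ⟧ lay agrees ax t nonneg) , loaded)))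
  where σ₁ = ⟪ reg σ [ x ↦ ⟦ termᵉ lay ax t ⟧ σ ] , mem σ ⟫

sweepᵖ : Layout n → Rect n → Corner → Mode → Program
sweepᵖ lay (rect x₁ x₂ y₁ y₂) c mode = load-from lay 20 ((ξ , x₁) ∷ (ξ , x₂) ∷ (η , y₁) ∷ (η , y₂) ∷ []) (route c mode)

val-side : ∀ (ρ : Fin n → ℤ) b {t u} → side b (val ρ t) (val ρ u) ≡ val ρ (side b t u)
val-side ρ false = refl
val-side ρ true  = refl

Loose : Mode → (x₁ x₂ y₁ y₂ : ℤ) → Set
Loose across  x₁ x₂ y₁ y₂ = ⊤
Loose along↔ x₁ x₂ y₁ y₂ = sucℤ x₁ ≤ℤ x₂ ⊎ y₂ ≤ℤ y₁
Loose along↕ x₁ x₂ y₁ y₂ = sucℤ y₁ ≤ℤ y₂ ⊎ x₂ ≤ℤ x₁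

emits-box : ∀ c mode {σ x₁ x₂ y₁ y₂} → pos (reg σ 20) ≡ x₁ → pos (reg σ 21) ≡ x₂ → pos (reg σ 22) ≡ y₁ → pos (reg σ 23) ≡ y₂ →
  x₁ ≤ℤ x₂ → y₁ ≤ℤ y₂ → Loose mode x₁ x₂ y₁ y₂ →
  Emits (route c mode) σ 122 20 (InBox x₁ x₂ y₁ y₂) (cornerAt c x₁ x₂ y₁ y₂) (cornerAt (opposite mode c) x₁ x₂ y₁ y₂)
emits-box c mode {σ} refl refl refl refl (+≤+ p) (+≤+ q) loose =
  subst₂ (λ X₂ Y₂ → Emits (route c mode) σ 122 20 (InBox (pos X₁) (pos X₂) (pos Y₁) (pos Y₂)) (cornerAt c (pos X₁) (pos X₂) (pos Y₁) (pos Y₂)) (cornerAt (opposite mode c) (pos X₁) (pos X₂) (pos Y₁) (pos Y₂)))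
    (m+[n∸m]≡n p) (m+[n∸m]≡n q)
    (emits-route c mode X₁ (reg σ 21 ∸ X₁) Y₁ (reg σ 23 ∸ Y₁) (fits mode loose) refl (sym (m+[n∸m]≡n p)) refl (sym (m+[n∸m]≡n q)))
  where
  X₁ = reg σ 20
  Y₁ = reg σ 22
  gap : ∀ {a b c d} → sucℤ (pos a) ≤ℤ pos b ⊎ pos d ≤ℤ pos c → 1 ≤ b ∸ a ⊎ d ∸ c ≡ 0
  gap (inj₁ (+≤+ p)) = inj₁ (m<n⇒0<n∸m p)
  gap (inj₂ (+≤+ p)) = inj₂ (m≤n⇒m∸n≡0 p)
  fits : ∀ mode → Loose mode (pos X₁) (pos (reg σ 21)) (pos Y₁) (pos (reg σ 23)) → Feasible-route mode (reg σ 21 ∸ X₁) (reg σ 23 ∸ Y₁)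
  fits across  _ = tt
  fits along↔ l = gap l
  fits along↕ l = gap l

-- 138 = 4 * 4 + 122: four bounds are loaded, then the rectangle is traversed.
emits-sweep : ∀ {lay : Layout n} {σ ρ} → (∀ ax v → lay ax v < 20) → Agrees lay σ ρ → ∀ R c mode →
  0ℤ ≤ℤ val (ρ ξ) (left R) → 0ℤ ≤ℤ val (ρ η) (top R) →
  val (ρ ξ) (left R) ≤ℤ val (ρ ξ) (right R) → val (ρ η) (top R) ≤ℤ val (ρ η) (bottom R) → All (Any (Holds ρ)) (modeGuard mode R) →
  Emits (sweepᵖ lay R c mode) σ 138 20 (InRect ρ R) (at ρ (cornerOf c R)) (at ρ (cornerOf (opposite mode c) R))
emits-sweep {ρ = ρ} lay<20 agrees R@(rect x₁ x₂ y₁ y₂) c mode 0≤x₁ 0≤y₁ x₁≤x₂ y₁≤y₂ ok =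
  emits-load 20 _ lay<20 ≤-refl (m≤m+n 24 7) agrees (0≤x₁ ∷ ℤₚ.≤-trans 0≤x₁ x₁≤x₂ ∷ 0≤y₁ ∷ ℤₚ.≤-trans 0≤y₁ y₁≤y₂ ∷ [])
    λ σ′ _ (p₁ , p₂ , p₃ , p₄ , _) → subst₂ (Emits (route c mode) σ′ 122 20 (InRect ρ R)) (corner-at c) (corner-at (opposite mode c))
      (emits-box c mode p₁ p₂ p₃ p₄ x₁≤x₂ y₁≤y₂ (loose mode ok))
  where
  corner-at : ∀ c → cornerAt c (val (ρ ξ) x₁) (val (ρ ξ) x₂) (val (ρ η) y₁) (val (ρ η) y₂) ≡ at ρ (cornerOf c R)
  corner-at (r , b) = cong₂ _,_ (val-side (ρ ξ) r) (val-side (ρ η) b)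
  loose : ∀ mode → All (Any (Holds ρ)) (modeGuard mode R) → Loose mode (val (ρ ξ) x₁) (val (ρ ξ) x₂) (val (ρ η) y₁) (val (ρ η) y₂)
  loose across  [] = tt
  loose along↔ (here h ∷ []) = inj₁ (subst (_≤ℤ val (ρ ξ) x₂) (val-raise (ρ ξ) x₁) h)
  loose along↔ (there (here h) ∷ []) = inj₂ h
  loose along↕ (here h ∷ []) = inj₁ (subst (_≤ℤ val (ρ η) y₂) (val-raise (ρ η) y₁) h)
  loose along↕ (there (here h) ∷ []) = inj₂ h

data Kind : Set where
  sweep       : Corner → Mode → Kind
  source sink : Corner → Kind

record Block (n : ℕ) : Set where
  constructor block
  field
    area : Rect n
    kind : Kind
open Block public

blk : (x₁ x₂ y₁ y₂ : Term n) → Kind → Block n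
blk x₁ x₂ y₁ y₂ = block (rect x₁ x₂ y₁ y₂)

Plan : ℕ → Set
Plan n = List (Block n)

_⊎ᵍ_ : Guard n → Guard n → Guard n
guard us cs ⊎ᵍ guard us′ cs′ = guard (us ++ us′) (cs ++ cs′)

meets-⊎ : ∀ (ρ : Env n) g g′ → Meets ρ (g ⊎ᵍ g′) → Meets ρ g × Meets ρ g′
meets-⊎ ρ g g′ (us , cs) with Allₚ.++⁻ (units g) us | Allₚ.++⁻ (clauses g) cs
... | us₁ , us₂ | cs₁ , cs₂ = (us₁ , cs₁) , (us₂ , cs₂)

impossible : Guard n
impossible = guard [] ([] ∷ [])

coincide close : Pt n → Pt n → List (Atom n)
coincide (x , y) (x′ , y′) = atom ξ x x′ ∷ atom ξ x′ x ∷ atom η y y′ ∷ atom η y′ y ∷ []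
close (x , y) (x′ , y′) = atom ξ x (raise x′) ∷ atom ξ x′ (raise x) ∷ atom η y (raise y′) ∷ atom η y′ (raise y) ∷ []

apart : Rect n → Rect n → Clause n
apart (rect x₁ x₂ y₁ y₂) (rect x₁′ x₂′ y₁′ y₂′) =
  atom ξ (raise x₂) x₁′ ∷ atom ξ (raise x₂′) x₁ ∷ atom η (raise y₂) y₁′ ∷ atom η (raise y₂′) y₁ ∷ []

at-coincide : ∀ (ρ : Env n) p q → All (Holds ρ) (coincide p q) → at ρ p ≡ at ρ q
at-coincide ρ p q (a ∷ b ∷ c ∷ d ∷ []) = cong₂ _,_ (ℤₚ.≤-antisym a b) (ℤₚ.≤-antisym c d)

at-close : ∀ (ρ : Env n) p q → All (Holds ρ) (close p q) → at ρ p ~ at ρ q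
at-close ρ (x , y) (x′ , y′) (a ∷ b ∷ c ∷ d ∷ []) = (up ξ x x′ a , up ξ x′ x b) , (up η y y′ c , up η y′ y d)
  where
  up : ∀ ax t u → val (ρ ax) t ≤ℤ val (ρ ax) (raise u) → val (ρ ax) t ≤ℤ sucℤ (val (ρ ax) u)
  up ax t u = subst (val (ρ ax) t ≤ℤ_) (val-raise (ρ ax) u)

at-apart : ∀ (ρ : Env n) R R′ → Any (Holds ρ) (apart R R′) → ∀ {z} → InRect ρ R z → InRect ρ R′ z → ⊥
at-apart ρ (rect x₁ x₂ y₁ y₂) (rect x₁′ x₂′ y₁′ y₂′) h ((a , b) , (c , d)) ((a′ , b′) , (c′ , d′)) = go h
  where
  clash : ∀ ax t u {i} → val (ρ ax) (raise t) ≤ℤ val (ρ ax) u → i ≤ℤ val (ρ ax) t → val (ρ ax) u ≤ℤ i → ⊥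
  clash ax t u t<u i≤t u≤i = ℤₚ.<-irrefl refl (ℤₚ.<-≤-trans (ℤₚ.suc[i]≤j⇒i<j (subst (_≤ℤ val (ρ ax) u) (val-raise (ρ ax) t) t<u)) (ℤₚ.≤-trans u≤i i≤t))
  go : Any (Holds ρ) (apart (rect x₁ x₂ y₁ y₂) (rect x₁′ x₂′ y₁′ y₂′)) → ⊥
  go (here h) = clash ξ x₂ x₁′ h b a′
  go (there (here h)) = clash ξ x₂′ x₁ h b′ a
  go (there (there (here h))) = clash η y₂ y₁′ h d c′
  go (there (there (there (here h)))) = clash η y₂′ y₁ h d′ c

-- Plans occur on two levels: inside one rectangle, with its bounds and a point as variables, and in
-- the whole region, where blocks may start at s or end at t by means of the inner level.
record Layer (n : ℕ) : Set where
  field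
    layout       : Layout n
    frame        : ℕ
    layout<frame : ∀ ax v → layout ax v < frame
    enter leave  : Block n → Pt n
    demand       : Block n → Guard n
    emit         : Block n → Program
    rate         : Block n → ℕ
    emits-block  : ∀ {σ ρ} → Agrees layout σ ρ → ∀ b → Meets ρ (demand b) →
      Emits (emit b) σ (rate b) frame (InRect ρ (area b)) (at ρ (enter b)) (at ρ (leave b))

module Plans (layer : Layer n) where
  open Layer layer

  InPlan : Env n → Plan n → Point → Set
  InPlan ρ bs z = Any (λ b → InRect ρ (area b) z) bs

  chain : Block n → Plan n → Pt n → Guard n
  chain b []        q = demand b ⊎ᵍ guard (coincide (leave b) q) []
  chain b (b′ ∷ bs) q = (demand b ⊎ᵍ guard (close (leave b) (enter b′)) (map (λ c → apart (area b) (area c)) (b′ ∷ bs))) ⊎ᵍ chain b′ bs q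

  requires : Pt n → Pt n → Plan n → Guard n
  requires p q []       = impossible
  requires p q (b ∷ bs) = guard (coincide p (enter b)) [] ⊎ᵍ chain b bs q

  emitPlan : Plan n → Program
  emitPlan []            = skip
  emitPlan (b ∷ [])      = emit b
  emitPlan (b ∷ b′ ∷ bs) = emit b ⨾ emitPlan (b′ ∷ bs)

  ratePlan : Plan n → ℕ
  ratePlan []            = 0
  ratePlan (b ∷ [])      = rate b
  ratePlan (b ∷ b′ ∷ bs) = rate b + ratePlan (b′ ∷ bs)

  demands : ∀ ρ b bs q → Meets ρ (chain b bs q) → All (λ c → Meets ρ (demand c)) (b ∷ bs)
  demands ρ b []        q g = proj₁ (meets-⊎ ρ (demand b) _ g) ∷ []
  demands ρ b (b′ ∷ bs) q g = let (h , g′) = meets-⊎ ρ _ (chain b′ bs q) g in proj₁ (meets-⊎ ρ (demand b) _ h) ∷ demands ρ b′ bs q g′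

  emits-chain : ∀ {σ ρ} → Agrees layout σ ρ → ∀ b bs q → Meets ρ (chain b bs q) →
    Emits (emitPlan (b ∷ bs)) σ (ratePlan (b ∷ bs)) frame (InPlan ρ (b ∷ bs)) (at ρ (enter b)) (at ρ q)
  emits-chain {σ} {ρ} agrees b [] q g = let (d , (e , _)) = meets-⊎ ρ (demand b) (guard (coincide (leave b) q) []) g in
    emits-cong here (λ { (here i) → i }) (subst (Emits _ _ _ _ _ (at ρ (enter b))) (at-coincide ρ (leave b) q e) (emits-block agrees b d))
  emits-chain {σ} {ρ} agrees b (b′ ∷ bs) q g =
    let (h , g′) = meets-⊎ ρ _ (chain b′ bs q) g
        (d , (c , a)) = meets-⊎ ρ (demand b) (guard (close (leave b) (enter b′)) _) h in
    emits-cong [ here , there ]′ (λ { (here i) → inj₁ i ; (there i) → inj₂ i })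
      (emits-seq (emits-block agrees b d) (at-close ρ (leave b) (enter b′) c)
        (λ {σ′} keep → emits-chain (agrees-keep σ σ′ layout<frame keep agrees) b′ bs q g′) (disjoint (b′ ∷ bs) a))
    where
    disjoint : ∀ cs → All (Any (Holds ρ)) (map (λ c → apart (area b) (area c)) cs) → ∀ {z} → InRect ρ (area b) z → InPlan ρ cs z → ⊥
    disjoint (c ∷ cs) (h ∷ hs) i (here j)  = at-apart ρ (area b) (area c) h i j
    disjoint (c ∷ cs) (h ∷ hs) i (there j) = disjoint cs hs i j

  emits-plan : ∀ {σ ρ} → Agrees layout σ ρ → ∀ p q bs → Meets ρ (requires p q bs) →
    Emits (emitPlan bs) σ (ratePlan bs) frame (InPlan ρ bs) (at ρ p) (at ρ q)
  emits-plan agrees p q [] (_ , () ∷ _)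
  emits-plan {ρ = ρ} agrees p q (b ∷ bs) g = let ((e , _) , g′) = meets-⊎ ρ (guard (coincide p (enter b)) []) (chain b bs q) g in
    subst (λ u → Emits _ _ _ _ _ u (at ρ q)) (sym (at-coincide ρ p (enter b) e)) (emits-chain agrees b bs q g′)

  plan-demands : ∀ ρ p q bs → Meets ρ (requires p q bs) → All (λ c → Meets ρ (demand c)) bs
  plan-demands ρ p q [] (_ , () ∷ _)
  plan-demands ρ p q (b ∷ bs) g = demands ρ b bs q (proj₂ (meets-⊎ ρ (guard (coincide p (enter b)) []) (chain b bs q) g))

-- From a point of a rectangle to one of its corners

pattern lo = zero
pattern hi = suc zero
pattern pt = suc (suc zero)

lo0 lo+ hi0 hi- pt0 pt+ pt- : Term 3
lo0 = lo ⊹ 0ℤ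
lo+ = lo ⊹ 1ℤ
hi0 = hi ⊹ 0ℤ
hi- = hi ⊹ -1ℤ
pt0 = pt ⊹ 0ℤ
pt+ = pt ⊹ 1ℤ
pt- = pt ⊹ -1ℤ

layoutᴾ : Layout 3
layoutᴾ ξ lo = 12
layoutᴾ ξ hi = 13
layoutᴾ ξ pt = 14
layoutᴾ η lo = 15
layoutᴾ η hi = 16
layoutᴾ η pt = 17

layoutᴾ<20 : ∀ ax v → layoutᴾ ax v < 20
layoutᴾ<20 ξ lo = m≤m+n 13 7
layoutᴾ<20 ξ hi = m≤m+n 14 6
layoutᴾ<20 ξ pt = m≤m+n 15 5
layoutᴾ<20 η lo = m≤m+n 16 4
layoutᴾ<20 η hi = m≤m+n 17 3
layoutᴾ<20 η pt = m≤m+n 18 2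

whole : Rect 3
whole = rect lo0 hi0 lo0 hi0

thePoint : Pt 3
thePoint = pt0 , pt0

contained : Rect n → Rect n → List (Atom n)
contained (rect x₁ x₂ y₁ y₂) (rect x₁′ x₂′ y₁′ y₂′) = atom ξ x₁′ x₁ ∷ atom ξ x₂ x₂′ ∷ atom η y₁′ y₁ ∷ atom η y₂ y₂′ ∷ []

contained-sound : ∀ (ρ : Env n) R R′ → All (Holds ρ) (contained R R′) → ∀ {z} → InRect ρ R z → InRect ρ R′ z
contained-sound ρ R R′ (a ∷ b ∷ c ∷ d ∷ []) ((p , q) , (r , s)) =
  (ℤₚ.≤-trans a p , ℤₚ.≤-trans q b) , (ℤₚ.≤-trans c r , ℤₚ.≤-trans s d)

nonempty : Rect n → List (Atom n)
nonempty (rect x₁ x₂ y₁ y₂) = atom ξ x₁ x₂ ∷ atom η y₁ y₂ ∷ []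

nonnegative : ∀ (lay : Layout n) σ {ρ} → Agrees lay σ ρ → ∀ ax v k → 0ℤ ≤ℤ val (ρ ax) (v ⊹ pos k)
nonnegative lay σ agrees ax v k rewrite agrees ax v = +≤+ z≤n

enterSweep leaveSweep : Block n → Pt n
enterSweep (block R (sweep c mode)) = cornerOf c R
enterSweep (block R (source c))     = cornerOf c R
enterSweep (block R (sink c))       = cornerOf c R
leaveSweep (block R (sweep c mode)) = cornerOf (opposite mode c) R
leaveSweep (block R (source c))     = cornerOf c R
leaveSweep (block R (sink c))       = cornerOf c R

local : Layer 3
local = record
  { layout       = layoutᴾ
  ; frame        = 20
  ; layout<frame = layoutᴾ<20
  ; enter        = enterSweep
  ; leave        = leaveSweep
  ; demand       = demand′
  ; emit         = emit′
  ; rate         = λ _ → 138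
  ; emits-block  = emits′
  }
  where
  demand′ : Block 3 → Guard 3
  demand′ (block R (sweep c mode)) = guard (contained R whole ++ nonempty R) (modeGuard mode R)
  demand′ (block R _)              = impossible
  emit′ : Block 3 → Program
  emit′ (block R (sweep c mode)) = sweepᵖ layoutᴾ R c mode
  emit′ _                        = skip
  emits′ : ∀ {σ ρ} → Agrees layoutᴾ σ ρ → ∀ b → Meets ρ (demand′ b) →
    Emits (emit′ b) σ 138 20 (InRect ρ (area b)) (at ρ (enterSweep b)) (at ρ (leaveSweep b))
  emits′ {σ} agrees (block R (sweep c mode)) (a ∷ _ ∷ b ∷ _ ∷ p ∷ q ∷ [] , cs) = emits-sweep layoutᴾ<20 agrees R c mode
    (ℤₚ.≤-trans (nonnegative layoutᴾ σ agrees ξ lo 0) a) (ℤₚ.≤-trans (nonnegative layoutᴾ σ agrees η lo 0) b) p q cs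
  emits′ agrees (block R (source c)) (_ , () ∷ _)
  emits′ agrees (block R (sink c))   (_ , () ∷ _)

open Plans local using () renaming (InPlan to InPlan₃; requires to requires₃; emitPlan to emitPlan₃; ratePlan to ratePlan₃; emits-plan to emits-plan₃; plan-demands to plan-demands₃)

mirror : Term 3 → Term 3
mirror (lo ⊹ k) = hi ⊹ (-ℤ k)
mirror (hi ⊹ k) = lo ⊹ (-ℤ k)
mirror (pt ⊹ k) = pt ⊹ (-ℤ k)

reflect : Corner → Block 3 → Block 3
reflect (r , b) (block (rect x₁ x₂ y₁ y₂) kind) = block
  (rect (if r then mirror x₂ else x₁) (if r then mirror x₁ else x₂) (if b then mirror y₂ else y₁) (if b then mirror y₁ else y₂)) (turn kind)
  where
  turn : Kind → Kind
  turn (sweep (r′ , b′) mode) = sweep ((if r then not r′ else r′) , (if b then not b′ else b′)) mode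
  turn k = k

backward : Block n → Block n
backward (block R (sweep c mode)) = block R (sweep (opposite mode c) mode)
backward b = b

pattern ◰ = (false , false)
pattern ◳ = (true , false)
pattern ◱ = (false , true)
pattern ◲ = (true , true)

-- The cases are a point at the lower right corner, on the bottom row, in the left column, in the
-- right column, and elsewhere. Unusual bounds encode conditions: a block from `hi0` to `pt0` inside
-- the rectangle is nonempty only if the point lies in the last column. The plans for the whole
-- region use the same device.
toUpperLeft : List (Plan 3)
toUpperLeft =
  (blk lo0 hi0 lo0 hi0 (sweep ◲ across) ∷ []) ∷
  (blk pt0 hi0 hi0 hi0 (sweep ◱ across) ∷
   blk pt0 hi0 lo0 hi- (sweep ◲ along↔) ∷
   blk lo0 pt- lo0 hi0 (sweep ◲ across) ∷ []) ∷
  (blk lo0 hi0 pt0 hi0 (sweep ◰ along↔) ∷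
   blk lo0 hi0 lo0 pt- (sweep ◲ across) ∷ []) ∷
  (blk hi0 pt0 pt0 hi0 (sweep ◳ across) ∷
   blk lo0 pt- pt0 hi0 (sweep ◲ along↕) ∷
   blk lo0 pt0 lo0 pt- (sweep ◲ across) ∷ []) ∷
  (blk pt0 hi0 lo0 pt0 (sweep ◱ along↔) ∷
   blk pt0 hi0 pt+ hi0 (sweep ◳ across) ∷
   blk lo0 pt- lo0 hi0 (sweep ◲ across) ∷ []) ∷ []

data Direction : Set where
  toCorner fromCorner : Direction

localPlans : Direction → Corner → List (Plan 3)
localPlans toCorner   c = map (map (reflect c)) toUpperLeft
localPlans fromCorner c = map (reverse ∘ map (backward ∘ reflect c)) toUpperLeft

startOf endOf : Direction → Corner → Pt 3
startOf toCorner   c = thePoint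
startOf fromCorner c = cornerOf c whole
endOf   toCorner   c = cornerOf c whole
endOf   fromCorner c = thePoint

-- There is a sweep from the point to the corner unless the rectangle has at
-- least two rows and columns and the point is the corner, or it has only one
-- row or column and the point is not at its far end.
reachable : Corner → Guard 3
reachable (r , b) = guard
  (atom ξ lo0 pt0 ∷ atom ξ pt0 hi0 ∷ atom η lo0 pt0 ∷ atom η pt0 hi0 ∷ [])
  ((atom ξ lo+ hi0 ∷ far b η ∷ []) ∷
   (atom η lo+ hi0 ∷ far r ξ ∷ []) ∷
   (off r ξ ∷ off b η ∷ atom ξ hi0 lo0 ∷ atom η hi0 lo0 ∷ []) ∷ [])
  where
  far off : Bool → Axis → Atom 3
  far true  ax = atom ax pt0 lo0
  far false ax = atom ax hi0 pt0
  off true  ax = atom ax pt+ hi0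
  off false ax = atom ax lo+ pt0

emits-if : ∀ {X : Set} {b P P′ σ K K′ k R p q} → Reflects X (⟦ b ⟧ᵇ σ) →
  (X → Emits P σ K k R p q) → (¬ X → Emits P′ σ K′ k R p q) → Emits (ifᵖ b then P else P′) σ (1 + costᵇ b + (K + K′)) k R p q
emits-if {b = b} {σ = σ} {K} {K′} r t f with ⟦ b ⟧ᵇ σ in eq | r
... | true | ofʸ x with emits s (runs e bound post) ← t x = emits s (runs (⇓if-true eq e)
  (≤-trans (+-monoʳ-≤ (1 + costᵇ b) (≤-trans bound (*-monoˡ-≤ _ (m≤m+n K K′)))) (linear-step (1 + costᵇ b) (sweep-nonempty s))) post)
... | false | ofⁿ ¬x with emits s (runs e bound post) ← f ¬x = emits s (runs (⇓if-false eq e)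
  (≤-trans (+-monoʳ-≤ (1 + costᵇ b) (≤-trans bound (*-monoˡ-≤ _ (m≤n+m K′ K)))) (linear-step (1 + costᵇ b) (sweep-nonempty s))) post)

module _ (p q : Pt 3) where

  -- Follows the chain of tests in `tryPlans`: the first plan whose guard holds covers the
  -- rectangle, and ⊥ at the end says that the chain does not run out.
  Sweepable : Env 3 → List (Plan 3) → Set
  Sweepable ρ []         = ⊥
  Sweepable ρ (bs ∷ bss) =
    (Meets ρ (requires₃ p q bs) → ∀ z → InRect ρ whole z → InPlan₃ ρ bs z) × (¬ Meets ρ (requires₃ p q bs) → Sweepable ρ bss)

  sweepable? : ∀ bss c → Check c (λ ρ → Sweepable ρ bss)
  sweepable? []         c = nothing
  sweepable? (bs ∷ bss) c =
    zipWithᴹ (λ f k ρ s → (λ h → contradiction h (f ρ s)) , λ _ → k ρ s) (refuteGuard c g) (sweepable? bss c)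
    <∣> zipWithᴹ (λ f k ρ s → (λ h z i → Anyₚ.map⁻ (f ρ (sat-assumeAll c (units g) s (proj₁ h)) z i)) , k ρ s)
      (covers (assumeAll c (units g)) whole (map area bs)) (otherwise (sweepable? bss) c g)
    where g = requires₃ p q bs

  tryPlans : List (Plan 3) → Program
  tryPlans []         = skip
  tryPlans (bs ∷ bss) = ifᵖ guardᵉ layoutᴾ (requires₃ p q bs) then emitPlan₃ bs else tryPlans bss

  rateTry : List (Plan 3) → ℕ
  rateTry []         = 0
  rateTry (bs ∷ bss) = 1 + costᵇ (guardᵉ layoutᴾ (requires₃ p q bs)) + (ratePlan₃ bs + rateTry bss)

  emits-try : ∀ {σ ρ} → Agrees layoutᴾ σ ρ → ∀ bss → Sweepable ρ bss →
    Emits (tryPlans bss) σ (rateTry bss) 20 (InRect ρ whole) (at ρ p) (at ρ q)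
  emits-try {σ} {ρ} agrees (bs ∷ bss) (yes? , no?) = emits-if (guard-reflects layoutᴾ agrees (requires₃ p q bs))
    (λ h → emits-cong (into bs (plan-demands₃ ρ p q bs h)) (yes? h _) (emits-plan₃ agrees p q bs h))
    (λ ¬h → emits-try agrees bss (no? ¬h))
    where
    into : ∀ bs → All (λ b → Meets ρ (Layer.demand local b)) bs → ∀ {z} → InPlan₃ ρ bs z → InRect ρ whole z
    into (block R (sweep c mode) ∷ bs) ((us , _) ∷ ds) (here i) = contained-sound ρ R whole (proj₁ (Allₚ.++⁻ (contained R whole) us)) i
    into (block R (source c) ∷ bs) ((_ , () ∷ _) ∷ ds) (here i)
    into (block R (sink c) ∷ bs) ((_ , () ∷ _) ∷ ds) (here i)
    into (b ∷ bs) (d ∷ ds) (there i) = into bs ds i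

-- One evaluation of the search for each direction and corner, valid for rectangles of every size
-- because the bounds are variables.
sweepable : ∀ dir c ρ → Meets ρ (reachable c) → Sweepable (startOf dir c) (endOf dir c) ρ (localPlans dir c)
sweepable dir c ρ = proof dir c ρ (sat-anything ρ)
  where
  check : ∀ dir c → Check anything (λ ρ → Meets ρ (reachable c) → Sweepable (startOf dir c) (endOf dir c) ρ (localPlans dir c))
  check dir c = supposing (sweepable? (startOf dir c) (endOf dir c) (localPlans dir c)) anything (reachable c)
  proof : ∀ dir c → Under anything (λ ρ → Meets ρ (reachable c) → Sweepable (startOf dir c) (endOf dir c) ρ (localPlans dir c))
  proof toCorner ◰   = found (check toCorner ◰) refl
  proof toCorner ◳   = found (check toCorner ◳) refl
  proof toCorner ◱   = found (check toCorner ◱) refl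
  proof toCorner ◲   = found (check toCorner ◲) refl
  proof fromCorner ◰ = found (check fromCorner ◰) refl
  proof fromCorner ◳ = found (check fromCorner ◳) refl
  proof fromCorner ◱ = found (check fromCorner ◱) refl
  proof fromCorner ◲ = found (check fromCorner ◲) refl

-- Blocks of an L-shaped region

-- Reachability inside a rectangle is stated in its own three variables per axis. Substituting the
-- bounds and the point makes it a guard of the region, to be decided in the outer context.
Substitution : ℕ → Set
Substitution n = Axis → Fin 3 → Term n

instᵗ : Substitution n → Axis → Term 3 → Term n
instᵗ τ ax (v ⊹ k) = variable-of (τ ax v) ⊹ (offset (τ ax v) +ℤ k)

instᵃ : Substitution n → Atom 3 → Atom n
instᵃ τ (atom ax t u) = atom ax (instᵗ τ ax t) (instᵗ τ ax u)

instᵍ : Substitution n → Guard 3 → Guard n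
instᵍ τ (guard us cs) = guard (map (instᵃ τ) us) (map (map (instᵃ τ)) cs)

under : Substitution n → Env n → Env 3
under τ ρ ax v = val (ρ ax) (τ ax v)

val-inst : ∀ (τ : Substitution n) ρ ax t → val (ρ ax) (instᵗ τ ax t) ≡ val (under τ ρ ax) t
val-inst τ ρ ax (v ⊹ k) = sym (ℤₚ.+-assoc (ρ ax (variable-of (τ ax v))) (offset (τ ax v)) k)

holds-inst : ∀ (τ : Substitution n) ρ a → Holds ρ (instᵃ τ a) → Holds (under τ ρ) a
holds-inst τ ρ (atom ax t u) = subst₂ _≤ℤ_ (val-inst τ ρ ax t) (val-inst τ ρ ax u)

meets-inst : ∀ (τ : Substitution n) ρ g → Meets ρ (instᵍ τ g) → Meets (under τ ρ) g
meets-inst τ ρ (guard us cs) (p , q) =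
  All.map (λ {a} → holds-inst τ ρ a) (Allₚ.map⁻ p) ,
  All.map (λ h → Any.map (λ {a} → holds-inst τ ρ a) (Anyₚ.map⁻ h)) (Allₚ.map⁻ q)

placed : Rect n → Pt n → Substitution n
placed R P ξ lo = left R
placed R P ξ hi = right R
placed R P ξ pt = proj₁ P
placed R P η lo = top R
placed R P η hi = bottom R
placed R P η pt = proj₂ P

transfer : Layout n → Rect n → Pt n → Direction → Corner → Program
transfer lay (rect x₁ x₂ y₁ y₂) (px , py) dir c =
  load-from lay 12 ((ξ , x₁) ∷ (ξ , x₂) ∷ (ξ , px) ∷ (η , y₁) ∷ (η , y₂) ∷ (η , py) ∷ [])
    (tryPlans (startOf dir c) (endOf dir c) (localPlans dir c))

rateTransfer : Direction → Corner → ℕ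
rateTransfer dir c = 24 + rateTry (startOf dir c) (endOf dir c) (localPlans dir c)

first final : Direction → Rect n → Pt n → Corner → Pt n
first toCorner   R P c = P
first fromCorner R P c = cornerOf c R
final toCorner   R P c = cornerOf c R
final fromCorner R P c = P

emits-transfer : ∀ {lay : Layout n} {σ ρ} → (∀ ax v → lay ax v < 12) → Agrees lay σ ρ → ∀ R P dir c →
  (∀ ax v → 0ℤ ≤ℤ under (placed R P) ρ ax v) → Meets ρ (instᵍ (placed R P) (reachable c)) →
  Emits (transfer lay R P dir c) σ (rateTransfer dir c) 12 (InRect ρ R) (at ρ (first dir R P c)) (at ρ (final dir R P c))
emits-transfer {n} {lay} {σ} {ρ} lay<12 agrees R P dir c nonneg ok =
  emits-load 12 _ lay<12 ≤-refl (m≤m+n 18 13) agrees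
    (nonneg ξ lo ∷ nonneg ξ hi ∷ nonneg ξ pt ∷ nonneg η lo ∷ nonneg η hi ∷ nonneg η pt ∷ [])
    λ σ′ _ (p₁ , p₂ , p₃ , p₄ , p₅ , p₆ , _) →
      subst₂ (Emits (tryPlans (startOf dir c) (endOf dir c) (localPlans dir c)) σ′ _ 12 (InRect ρ R)) (first-at dir) (final-at dir)
        (emits-cong (subst id (same _)) (subst id (sym (same _))) (emits-weaken ≤-refl (m≤m+n 12 8)
          (emits-try (startOf dir c) (endOf dir c) (agrees′ σ′ p₁ p₂ p₃ p₄ p₅ p₆) (localPlans dir c)
            (sweepable dir c ρ′ (meets-inst (placed R P) ρ (reachable c) ok)))))
  where
  ρ′ = under (placed R P) ρ
  0+ : ∀ i → i +ℤ 0ℤ ≡ i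
  0+ = ℤₚ.+-identityʳ
  same : ∀ z → InRect ρ′ whole z ≡ InRect ρ R z
  same z rewrite 0+ (val (ρ ξ) (left R)) | 0+ (val (ρ ξ) (right R)) | 0+ (val (ρ η) (top R)) | 0+ (val (ρ η) (bottom R)) = refl
  agrees′ : ∀ σ′ → pos (reg σ′ 12) ≡ ρ′ ξ lo → pos (reg σ′ 13) ≡ ρ′ ξ hi → pos (reg σ′ 14) ≡ ρ′ ξ pt →
    pos (reg σ′ 15) ≡ ρ′ η lo → pos (reg σ′ 16) ≡ ρ′ η hi → pos (reg σ′ 17) ≡ ρ′ η pt → Agrees layoutᴾ σ′ ρ′
  agrees′ σ′ p₁ p₂ p₃ p₄ p₅ p₆ ξ lo = sym p₁
  agrees′ σ′ p₁ p₂ p₃ p₄ p₅ p₆ ξ hi = sym p₂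
  agrees′ σ′ p₁ p₂ p₃ p₄ p₅ p₆ ξ pt = sym p₃
  agrees′ σ′ p₁ p₂ p₃ p₄ p₅ p₆ η lo = sym p₄
  agrees′ σ′ p₁ p₂ p₃ p₄ p₅ p₆ η hi = sym p₅
  agrees′ σ′ p₁ p₂ p₃ p₄ p₅ p₆ η pt = sym p₆
  point-at : at ρ′ thePoint ≡ at ρ P
  point-at = cong₂ _,_ (0+ _) (0+ _)
  corner-at : ∀ c → at ρ′ (cornerOf c whole) ≡ at ρ (cornerOf c R)
  corner-at ◰ = cong₂ _,_ (0+ _) (0+ _)
  corner-at ◳ = cong₂ _,_ (0+ _) (0+ _)
  corner-at ◱ = cong₂ _,_ (0+ _) (0+ _)
  corner-at ◲ = cong₂ _,_ (0+ _) (0+ _)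
  first-at : ∀ dir → at ρ′ (startOf dir c) ≡ at ρ (first dir R P c)
  first-at toCorner   = point-at
  first-at fromCorner = corner-at c
  final-at : ∀ dir → at ρ′ (endOf dir c) ≡ at ρ (final dir R P c)
  final-at toCorner   = corner-at c
  final-at fromCorner = point-at

-- `𝕠` is the constant 0, held by register 8, which is never written. It makes absolute bounds into
-- differences. `𝕤` and `𝕥` are the coordinates of s and t.
pattern 𝕠 = zero
pattern 𝕖 = suc zero
pattern 𝕗 = suc (suc zero)
pattern 𝕤 = suc (suc (suc zero))
pattern 𝕥 = suc (suc (suc (suc zero)))

-- Horizontally, 𝕖 is m − k and 𝕗 is m; vertically, 𝕖 is l and 𝕗 is n.
layoutᴸ : Layout 5
layoutᴸ ξ 𝕠 = 8
layoutᴸ ξ 𝕖 = 9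
layoutᴸ ξ 𝕗 = 0
layoutᴸ ξ 𝕤 = 4
layoutᴸ ξ 𝕥 = 6
layoutᴸ η 𝕠 = 8
layoutᴸ η 𝕖 = 3
layoutᴸ η 𝕗 = 1
layoutᴸ η 𝕤 = 5
layoutᴸ η 𝕥 = 7

layoutᴸ<11 : ∀ ax v → layoutᴸ ax v < 11
layoutᴸ<11 ξ 𝕠 = m≤m+n 9 2
layoutᴸ<11 ξ 𝕖 = m≤m+n 10 1
layoutᴸ<11 ξ 𝕗 = m≤m+n 1 10
layoutᴸ<11 ξ 𝕤 = m≤m+n 5 6
layoutᴸ<11 ξ 𝕥 = m≤m+n 7 4
layoutᴸ<11 η 𝕠 = m≤m+n 9 2
layoutᴸ<11 η 𝕖 = m≤m+n 4 7
layoutᴸ<11 η 𝕗 = m≤m+n 2 9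
layoutᴸ<11 η 𝕤 = m≤m+n 6 5
layoutᴸ<11 η 𝕥 = m≤m+n 8 3

layoutᴸ<12 : ∀ ax v → layoutᴸ ax v < 12
layoutᴸ<12 ax v = m≤n⇒m≤1+n (layoutᴸ<11 ax v)

sᴾ tᴾ : Pt 5
sᴾ  = 𝕤 ⊹ 0ℤ , 𝕤 ⊹ 0ℤ
tᴾ = 𝕥 ⊹ 0ℤ , 𝕥 ⊹ 0ℤ

box : Rect 5
box = rect (𝕠 ⊹ 1ℤ) (𝕗 ⊹ 0ℤ) (𝕠 ⊹ 1ℤ) (𝕗 ⊹ 0ℤ)

-- A nonempty rectangle of the bounding box misses the removed corner exactly if it ends to its left
-- or begins below it.
inL : Rect 5 → Guard 5
inL R = guard (contained R box) ((atom ξ (right R) (𝕖 ⊹ 0ℤ) ∷ atom η (𝕖 ⊹ 1ℤ) (top R) ∷ []) ∷ [])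

positive : ∀ σ {ρ} → Agrees layoutᴸ σ ρ → ∀ R P c → Meets ρ (inL R) → Meets (under (placed R P) ρ) (reachable c) →
  ∀ ax v → 0ℤ ≤ℤ under (placed R P) ρ ax v
positive σ {ρ} agrees R P c (a ∷ _ ∷ b ∷ _ ∷ [] , _) (x₁ ∷ x₂ ∷ y₁ ∷ y₂ ∷ [] , _) = nonneg
  where
  below : ∀ {i j} → i +ℤ 0ℤ ≤ℤ j +ℤ 0ℤ → 0ℤ ≤ℤ i → 0ℤ ≤ℤ j
  below {i} {j} p q = ℤₚ.≤-trans q (subst₂ _≤ℤ_ (ℤₚ.+-identityʳ i) (ℤₚ.+-identityʳ j) p)
  0≤x₁ = ℤₚ.≤-trans (nonnegative layoutᴸ σ agrees ξ 𝕠 1) a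
  0≤y₁ = ℤₚ.≤-trans (nonnegative layoutᴸ σ agrees η 𝕠 1) b
  0≤px : 0ℤ ≤ℤ val (ρ ξ) (proj₁ P)
  0≤px = below x₁ 0≤x₁
  0≤py : 0ℤ ≤ℤ val (ρ η) (proj₂ P)
  0≤py = below y₁ 0≤y₁
  nonneg : ∀ ax v → 0ℤ ≤ℤ under (placed R P) ρ ax v
  nonneg ξ lo = 0≤x₁
  nonneg ξ hi = below x₂ 0≤px
  nonneg ξ pt = 0≤px
  nonneg η lo = 0≤y₁
  nonneg η hi = below y₂ 0≤py
  nonneg η pt = 0≤py

global : Layer 5
global = record
  { layout       = layoutᴸ
  ; frame        = 12
  ; layout<frame = layoutᴸ<12
  ; enter        = enter′
  ; leave        = leave′
  ; demand       = λ b → inL (area b) ⊎ᵍ specific b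
  ; emit         = emit′
  ; rate         = rate′
  ; emits-block  = λ {σ} {ρ} agrees b ok → let (i , d) = meets-⊎ ρ (inL (area b)) (specific b) ok in emits′ agrees b i d
  }
  where
  specific : Block 5 → Guard 5
  specific (block R (sweep c mode)) = guard (nonempty R) (modeGuard mode R)
  specific (block R (source c))     = instᵍ (placed R sᴾ) (reachable c)
  specific (block R (sink c))       = instᵍ (placed R tᴾ) (reachable c)
  enter′ leave′ : Block 5 → Pt 5
  enter′ (block R (source c)) = sᴾ
  enter′ b                    = enterSweep b
  leave′ (block R (sink c))   = tᴾ
  leave′ b                    = leaveSweep b
  emit′ : Block 5 → Program
  emit′ (block R (sweep c mode)) = sweepᵖ layoutᴸ R c mode
  emit′ (block R (source c))     = transfer layoutᴸ R sᴾ toCorner c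
  emit′ (block R (sink c))       = transfer layoutᴸ R tᴾ fromCorner c
  rate′ : Block 5 → ℕ
  rate′ (block R (sweep c mode)) = 138
  rate′ (block R (source c))     = rateTransfer toCorner c
  rate′ (block R (sink c))       = rateTransfer fromCorner c
  emits′ : ∀ {σ ρ} → Agrees layoutᴸ σ ρ → ∀ b → Meets ρ (inL (area b)) → Meets ρ (specific b) →
    Emits (emit′ b) σ (rate′ b) 12 (InRect ρ (area b)) (at ρ (enter′ b)) (at ρ (leave′ b))
  emits′ {σ} agrees (block R (sweep c mode)) (a ∷ _ ∷ b ∷ _ ∷ [] , _) (p ∷ q ∷ [] , cs) = emits-weaken ≤-refl (m≤m+n 12 8)
    (emits-sweep (λ ax v → ≤-trans (layoutᴸ<12 ax v) (m≤m+n 12 8)) agrees R c mode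
      (ℤₚ.≤-trans (nonnegative layoutᴸ σ agrees ξ 𝕠 1) a) (ℤₚ.≤-trans (nonnegative layoutᴸ σ agrees η 𝕠 1) b) p q cs)
  emits′ {σ} {ρ} agrees (block R (source c)) i d = emits-transfer layoutᴸ<12 agrees R sᴾ toCorner c
    (positive σ agrees R sᴾ c i (meets-inst (placed R sᴾ) ρ (reachable c) d)) d
  emits′ {σ} {ρ} agrees (block R (sink c)) i d = emits-transfer layoutᴸ<12 agrees R tᴾ fromCorner c
    (positive σ agrees R tᴾ c i (meets-inst (placed R tᴾ) ρ (reachable c) d)) d

open Plans global

-- Which parts of the region a path from s to t can visit

-- Every path from s to t avoids, for some option, the regions whose indices
-- are listed in it; the plan of the option covers the other regions.
record Item : Set where
  constructor item
  field
    extra   : List (Atom 5)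
    regions : List (List (Rect 5))
    options : List (List ℕ × Plan 5)
open Item public

InRegion : Env 5 → List (Rect 5) → Point → Set
InRegion ρ Rs z = Any (λ R → InRect ρ R z) Rs

shape : List (Rect 5)
shape = rect (𝕠 ⊹ 1ℤ) (𝕖 ⊹ 0ℤ) (𝕠 ⊹ 1ℤ) (𝕗 ⊹ 0ℤ) ∷ rect (𝕖 ⊹ 1ℤ) (𝕗 ⊹ 0ℤ) (𝕖 ⊹ 1ℤ) (𝕗 ⊹ 0ℤ) ∷ []

record Suffix (ρ : Env 5) (xs : List Point) : Set where
  constructor suffix
  field
    valid  : All (InRegion ρ shape) xs
    linked : Linked _~_ xs
    simple : Unique xs
    ends   : last xs ≡ just (at ρ tᴾ)

has : List ℕ → ℕ → Bool
has D j = any (_≡ᵇ j) D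

-- The first four alternatives are a distance of at least two along an axis, so that no king's move
-- leads across; in the last four one of the rectangles is empty.
gaps : Rect n → Rect n → List (Atom n)
gaps (rect x₁ x₂ y₁ y₂) (rect x₁′ x₂′ y₁′ y₂′) =
  atom ξ (raise (raise x₂)) x₁′ ∷ atom ξ (raise (raise x₂′)) x₁ ∷ atom η (raise (raise y₂)) y₁′ ∷ atom η (raise (raise y₂′)) y₁ ∷
  atom ξ (raise x₂) x₁ ∷ atom η (raise y₂) y₁ ∷ atom ξ (raise x₂′) x₁′ ∷ atom η (raise y₂′) y₁′ ∷ []

gaps-sound : ∀ (ρ : Env n) R R′ → Any (Holds ρ) (gaps R R′) → ∀ {z w} → InRect ρ R z → InRect ρ R′ w → ¬ (z ~ w)
gaps-sound ρ (rect x₁ x₂ y₁ y₂) (rect x₁′ x₂′ y₁′ y₂′) h ((a , b) , (c , d)) ((a′ , b′) , (c′ , d′)) ((p , q) , (p′ , q′)) = go h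
  where
  empty : ∀ ax t u {i} → val (ρ ax) (raise t) ≤ℤ val (ρ ax) u → i ≤ℤ val (ρ ax) t → val (ρ ax) u ≤ℤ i → ⊥
  empty ax t u t<u i≤t u≤i = ℤₚ.<-irrefl refl (ℤₚ.<-≤-trans (ℤₚ.suc[i]≤j⇒i<j (subst (_≤ℤ val (ρ ax) u) (val-raise (ρ ax) t) t<u)) (ℤₚ.≤-trans u≤i i≤t))
  wide-gap : ∀ ax t u {i j} → val (ρ ax) (raise (raise t)) ≤ℤ val (ρ ax) u → i ≤ℤ val (ρ ax) t → val (ρ ax) u ≤ℤ j → j ≤ℤ sucℤ i → ⊥
  wide-gap ax t u {i} gap i≤t u≤j j≤i = empty ax (raise t) u gap (ℤₚ.≤-trans j≤i (subst (sucℤ i ≤ℤ_) (sym (val-raise (ρ ax) t)) (ℤₚ.suc-mono i≤t))) u≤j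
  go : Any (Holds ρ) (gaps (rect x₁ x₂ y₁ y₂) (rect x₁′ x₂′ y₁′ y₂′)) → ⊥
  go (here h) = wide-gap ξ x₂ x₁′ h b a′ q
  go (there (here h)) = wide-gap ξ x₂′ x₁ h b′ a p
  go (there (there (here h))) = wide-gap η y₂ y₁′ h d c′ q′
  go (there (there (there (here h)))) = wide-gap η y₂′ y₁ h d′ c p′
  go (there (there (there (there (here h))))) = empty ξ x₂ x₁ h b a
  go (there (there (there (there (there (here h)))))) = empty η y₂ y₁ h d c
  go (there (there (there (there (there (there (here h))))))) = empty ξ x₂′ x₁′ h b′ a′
  go (there (there (there (there (there (there (there (here h)))))))) = empty η y₂′ y₁′ h d′ c′

excludes : Rect n → Pt n → List (Atom n)
excludes (rect x₁ x₂ y₁ y₂) (x , y) = atom ξ (raise x) x₁ ∷ atom ξ (raise x₂) x ∷ atom η (raise y) y₁ ∷ atom η (raise y₂) y ∷ []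

excludes-sound : ∀ (ρ : Env n) R P → Any (Holds ρ) (excludes R P) → ¬ InRect ρ R (at ρ P)
excludes-sound ρ R (x , y) h i = at-apart ρ (rect x x y y) R (reorder h) ((ℤₚ.≤-refl , ℤₚ.≤-refl) , (ℤₚ.≤-refl , ℤₚ.≤-refl)) i
  where
  reorder : Any (Holds ρ) (excludes R (x , y)) → Any (Holds ρ) (apart (rect x x y y) R)
  reorder (here h) = here h
  reorder (there (here h)) = there (here h)
  reorder (there (there (here h))) = there (there (here h))
  reorder (there (there (there (here h)))) = there (there (there (here h)))

forEach : ∀ {A : Set} {P : A → Set} → (∀ a → Maybe (P a)) → ∀ as → Maybe (All P as)
forEach f []       = just []
forEach f (a ∷ as) = zipWithᴹ _∷_ (f a) (forEach f as)

forEachᶠ : ∀ {k} {P : Fin k → Set} → (∀ j → Maybe (P j)) → Maybe (∀ j → P j)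
forEachᶠ {zero}  f = just λ ()
forEachᶠ {suc k} f = zipWithᴹ (λ p ps → λ { zero → p ; (suc j) → ps j }) (f zero) (forEachᶠ (f ∘ suc))

-- The regions become the nodes of a small graph in which separate regions are not joined. A path of
-- the grid projects to a walk that enters one-cell regions at most once but may return to larger
-- ones. Which regions such walks can combine is found by exhaustive search.
module Exploration (c : Context 5) (regions : List (List (Rect 5))) (options : List (List ℕ × Plan 5)) where

  k : ℕ
  k = length regions

  region : Fin k → List (Rect 5)
  region = lookup regions

  Single : Env 5 → Fin k → Set
  Single ρ j = ∀ {z w} → InRegion ρ (region j) z → InRegion ρ (region j) w → z ≡ w

  single? : ∀ j → Check c (λ ρ → Single ρ j)
  single? j with region j
  ... | R ∷ [] = mapᴹ (λ f ρ s → λ { (here i) (here i′) → unique ρ R (f ρ s) i i′ })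
        (entailAll c (atom ξ (right R) (left R) ∷ atom η (bottom R) (top R) ∷ []))
    where
    unique : ∀ ρ R → All (Holds ρ) (atom ξ (right R) (left R) ∷ atom η (bottom R) (top R) ∷ []) → ∀ {z w} → InRect ρ R z → InRect ρ R w → z ≡ w
    unique ρ R (h ∷ v ∷ []) ((a , b) , (c , d)) ((a′ , b′) , (c′ , d′)) = cong₂ _,_ (pinch a b h a′ b′) (pinch c d v c′ d′)
      where
      pinch : ∀ {lo hi i j} → lo ≤ℤ i → i ≤ℤ hi → hi ≤ℤ lo → lo ≤ℤ j → j ≤ℤ hi → i ≡ j
      pinch p q r p′ q′ = ℤₚ.≤-antisym (ℤₚ.≤-trans q (ℤₚ.≤-trans r p′)) (ℤₚ.≤-trans q′ (ℤₚ.≤-trans r p))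
  ... | _ = nothing

  Separate : Env 5 → Fin k → Fin k → Set
  Separate ρ i j = ∀ {z w} → InRegion ρ (region i) z → InRegion ρ (region j) w → ¬ (z ~ w)

  separate? : ∀ i j → Check c (λ ρ → Separate ρ i j)
  separate? i j = mapᴹ (λ h ρ s {z} {w} p q → let (h′ , r) = All.lookupAny h p; (g , r′) = All.lookupAny h′ q in g ρ s z w r r′)
    (forEach (λ R → forEach (λ R′ → rects? R R′) (region j)) (region i))
    where
    rects? : ∀ R R′ → Check c (λ ρ → ∀ z w → InRect ρ R z → InRect ρ R′ w → ¬ (z ~ w))
    rects? R R′ = mapᴹ (λ f ρ s z w → gaps-sound ρ R R′ (f ρ s) {z} {w}) (entailAny c (gaps R R′))

  elsewhere? : ∀ P j → Check c (λ ρ → ¬ InRegion ρ (region j) (at ρ P))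
  elsewhere? P j = mapᴹ (λ h ρ s i → let (g , i′) = All.lookupAny h i in g ρ s i′)
    (forEach (λ R → mapᴹ (λ f ρ s → excludes-sound ρ R P (f ρ s)) (entailAny c (excludes R P))) (region j))

  clear : List (Fin k) → List ℕ × Plan 5 → Bool
  clear V (D , _) = all (λ j → not (has D (toℕ j))) V

  clear-∈ : ∀ opt {j} V → clear V opt ≡ true → j ∈ V → has (proj₁ opt) (toℕ j) ≡ false
  clear-∈ (D , _) {j} (i ∷ V) eq (here refl) = not-true (∧-conicalˡ (not (has D (toℕ j))) _ eq)
    where
    not-true : ∀ {b} → not b ≡ true → b ≡ false
    not-true {false} _ = refl
  clear-∈ (D , p) (i ∷ V) eq (there j∈) = clear-∈ (D , p) V (∧-conicalʳ (not (has D (toℕ i))) _ eq) j∈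

  Kept : Env 5 → List ℕ → Point → Set
  Kept ρ D z = Σ[ j ∈ Fin k ] has D (toℕ j) ≡ false × InRegion ρ (region j) z

  Avoided : Env 5 → List (Fin k) → List Point → Set
  Avoided ρ V xs = Any (λ opt → clear V opt ≡ true × All (Kept ρ (proj₁ opt)) xs) options

  Fresh : Env 5 → List (Fin k) → List Point → Set
  Fresh ρ V xs = ∀ j → j ∈ V → Single ρ j → All (λ w → ¬ InRegion ρ (region j) w) xs

  -- Every way to continue a path that has visited the regions V and is now in
  -- region i avoids the discarded regions of some option.
  Explored : Env 5 → List (Fin k) → Fin k → Set
  Explored ρ V i = ∀ z xs → InRegion ρ (region i) z → Suffix ρ (z ∷ xs) → Fresh ρ V xs → Avoided ρ V (z ∷ xs)

  fresh-start : ∀ ρ {j V z xs} → InRegion ρ (region j) z → Unique (z ∷ xs) → Fresh ρ V xs → Fresh ρ (j ∷ V) xs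
  fresh-start ρ z∈ (z∉ ∷ _) fresh j (here refl) single = All.map (λ z≢w w∈ → z≢w (single z∈ w∈)) z∉
  fresh-start ρ z∈ _ fresh j (there j∈) single = fresh j j∈ single

  Located : Env 5 → Set
  Located ρ = ∀ z → InRegion ρ shape z → Σ[ j ∈ Fin k ] InRegion ρ (region j) z

  module _ {ρ V i} (i∈ : i ∈ V) (located : Located ρ)
    (stop : InRegion ρ (region i) (at ρ tᴾ) → Any (λ opt → clear V opt ≡ true) options)
    (step : ∀ j → j ≢ i → Separate ρ i j ⊎ (j ∈ V × Single ρ j) ⊎ Explored ρ (j ∷ V) j) where

    -- Induction on the path. While it stays in region `i`, the induction hypothesis applies; when
    -- it leaves, the region entered is either not adjacent, or a cell already used, or one from
    -- which all continuations are known. An option compatible with the longer list of visited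
    -- regions is compatible with `V`.
    explored : Explored ρ V i
    explored z [] z∈ (suffix _ _ _ refl) _ = Any.map (λ {opt} cl → cl , (i , clear-∈ opt V cl i∈ , z∈) ∷ []) (stop z∈)
    explored z (w ∷ xs) z∈ (suffix (_ ∷ v@(w∈L ∷ _)) (z~w ∷ l) (_ ∷ u) ends) fresh with located w w∈L
    ... | j , w∈ = Any.map (λ {opt} (cl , kept) → cl , (i , clear-∈ opt V cl i∈ , z∈) ∷ kept) (onward (j ≟ᶠ i))
      where
      tail : Suffix ρ (w ∷ xs)
      tail = suffix v l u ends
      fresh′ : Fresh ρ V xs
      fresh′ j j∈ single = All.tail (fresh j j∈ single)
      onward : Dec (j ≡ i) → Avoided ρ V (w ∷ xs)
      onward (yes refl) = explored w xs w∈ tail fresh′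
      onward (no j≢i) with step j j≢i
      ... | inj₁ separate = contradiction z~w (separate z∈ w∈)
      ... | inj₂ (inj₁ (j∈ , single)) = contradiction w∈ (All.head (fresh j j∈ single))
      ... | inj₂ (inj₂ explored′) = Any.map (λ { {D , _} (cl , kept) → ∧-conicalʳ (not (has D (toℕ j))) _ cl , kept })
              (explored′ w xs w∈ tail (fresh-start ρ w∈ u fresh′))

  anyClear? : ∀ V opts → Maybe (Any (λ opt → clear V opt ≡ true) opts)
  anyClear? V []           = nothing
  anyClear? V (opt ∷ opts) with clear V opt in eq
  ... | true  = just (here eq)
  ... | false = mapᴹ there (anyClear? V opts)

  visited? : ∀ (j : Fin k) V → Maybe (j ∈ V)
  visited? j []      = nothing
  visited? j (i ∷ V) with j ≟ᶠ i
  ... | yes eq = just (here eq)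
  ... | no _   = mapᴹ there (visited? j V)

  -- Depth-first search. The fuel is there because larger regions may be entered again; it runs out,
  -- and the search fails, if two of them touch.
  explore : ℕ → ∀ V i → i ∈ V → Check c (λ ρ → Located ρ → Explored ρ V i)
  explore zero    V i i∈ = nothing
  explore (suc d) V i i∈ = zipWithᴹ (λ f g ρ s located → explored i∈ located (f ρ s) (λ j j≢i → g j ρ s located j≢i))
    (mapᴹ (λ f ρ s t∈ → contradiction t∈ (f ρ s)) (elsewhere? tᴾ i) <∣> mapᴹ (λ cl ρ s _ → cl) (anyClear? V options))
    (forEachᶠ next)
    where
    next : ∀ j → Check c (λ ρ → Located ρ → j ≢ i → Separate ρ i j ⊎ (j ∈ V × Single ρ j) ⊎ Explored ρ (j ∷ V) j)
    next j with j ≟ᶠ i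
    ... | yes j≡i = just λ _ _ _ j≢i → contradiction j≡i j≢i
    ... | no _ = mapᴹ (λ f ρ s _ _ → inj₁ (λ {z} {w} → f ρ s {z} {w})) (separate? i j)
      <∣> zipWithᴹ (λ j∈ f ρ s _ _ → inj₂ (inj₁ (j∈ , f ρ s))) (visited? j V) (single? j)
      <∣> mapᴹ (λ f ρ s located _ → inj₂ (inj₂ (f ρ s located))) (explore d (j ∷ V) j (here refl))

  located? : Check c Located
  located? = mapᴹ (λ h ρ s z z∈ → let (g , i) = All.lookupAny h z∈; a = Anyₚ.concat⁻ regions (g ρ s z i) in Any.index a , Anyₚ.lookup-index a)
    (forEach (λ R → covers c R (concat regions)) shape)

-- Decision trees

STPath : Env 5 → List Point → Set
STPath ρ q = head q ≡ just (at ρ sᴾ) × Suffix ρ q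

Optimal : Env 5 → Item → Set
Optimal ρ it = ∀ q → STPath ρ q → Any (λ opt → All (InPlan ρ (proj₂ opt)) q) (options it)

Valid : Env 5 → Plan 5 → Set
Valid ρ bs = Meets ρ (requires sᴾ tᴾ bs)

-- All plans of an item must apply together, since the program runs each of them to compare the
-- lengths.
planGuards : List (List ℕ × Plan 5) → Guard 5
planGuards []                      = impossible
planGuards ((D , bs) ∷ [])         = requires sᴾ tᴾ bs
planGuards ((D , bs) ∷ opt ∷ opts) = requires sᴾ tᴾ bs ⊎ᵍ planGuards (opt ∷ opts)

itemGuard : Item → Guard 5
itemGuard it = guard (extra it) [] ⊎ᵍ planGuards (options it)

optimal? : ∀ c it → Check c (λ ρ → Optimal ρ it)
optimal? c (item _ regions options) =
  zipWithᴹ (λ (f , g) h ρ s q path → conclude ρ s h (begins ρ (f ρ s) (λ i → g i ρ s (f ρ s)) q path))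
    (zipWithᴹ _,_ located? (forEachᶠ begin?)) (forEach kept? options)
  where
  open Exploration c regions options

  begin? : ∀ i → Check c (λ ρ → Located ρ → InRegion ρ (region i) (at ρ sᴾ) → Explored ρ (i ∷ []) i)
  begin? i = mapᴹ (λ f ρ s _ i∈ → contradiction i∈ (f ρ s)) (elsewhere? sᴾ i)
    -- The items have at most five one-cell regions, and their larger regions do not touch, so a
    -- walk has at most 5 + 6 nodes.
    <∣> mapᴹ (λ f ρ s located _ → f ρ s located) (explore 12 (i ∷ []) i (here refl))

  begins : ∀ ρ → Located ρ → (∀ i → InRegion ρ (region i) (at ρ sᴾ) → Explored ρ (i ∷ []) i) → ∀ q → STPath ρ q →
    Any (λ opt → All (Kept ρ (proj₁ opt)) q) options
  begins ρ located explored (z ∷ q) (refl , path@(suffix (z∈L ∷ _) _ u _)) with located z z∈L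
  ... | i , z∈ = Any.map proj₂ (explored i z∈ z q z∈ path (fresh-start ρ z∈ u λ _ ()))

  kept? : ∀ opt → Maybe (∀ j → has (proj₁ opt) (toℕ j) ≡ false → Under c (λ ρ → ∀ z → InRegion ρ (region j) z → InPlan ρ (proj₂ opt) z))
  kept? (D , bs) = forEachᶠ λ j → region? j (has D (toℕ j))
    where
    region? : ∀ j b → Maybe (b ≡ false → Under c (λ ρ → ∀ z → InRegion ρ (region j) z → InPlan ρ bs z))
    region? j true  = just λ ()
    region? j false = mapᴹ (λ h _ ρ s z z∈ → let (g , i) = All.lookupAny h z∈ in Anyₚ.map⁻ (g ρ s z i))
      (forEach (λ R → covers c R (map area bs)) (region j))

  conclude : ∀ ρ → Sat ρ c → ∀ {opts q} →
    All (λ opt → ∀ j → has (proj₁ opt) (toℕ j) ≡ false → Under c (λ ρ → ∀ z → InRegion ρ (region j) z → InPlan ρ (proj₂ opt) z)) opts →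
    Any (λ opt → All (Kept ρ (proj₁ opt)) q) opts → Any (λ opt → All (InPlan ρ (proj₂ opt)) q) opts
  conclude ρ s (h ∷ _)  (here kept) = here (All.map (λ (j , eq , i) → h j eq ρ s _ i) kept)
  conclude ρ s (_ ∷ hs) (there a)   = there (conclude ρ s hs a)

-- An item whose guard fails hands over to the tree after it. `stuck` marks a branch that no legal
-- input reaches; its outcome is ⊥, so a proof of `Outcome` includes exhaustiveness.
data Tree : Set where
  split : Atom 5 → Tree → Tree → Tree
  try   : Item → Tree → Tree
  stuck : Tree

Outcome : Env 5 → Tree → Set
Outcome ρ (split a t u) = (Holds ρ a → Outcome ρ t) × (¬ Holds ρ a → Outcome ρ u)
Outcome ρ (try it t)    = (Meets ρ (itemGuard it) → Optimal ρ it) × (¬ Meets ρ (itemGuard it) → Outcome ρ t)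
Outcome ρ stuck         = ⊥

Legal : Env 5 → Set
Legal ρ = InRegion ρ shape (at ρ sᴾ) × InRegion ρ shape (at ρ tᴾ) × at ρ sᴾ ≢ at ρ tᴾ

illegal? : ∀ c → Check c (λ ρ → ¬ Legal ρ)
illegal? c =
  mapᴹ (λ f ρ s (_ , _ , s≢t) → s≢t (at-coincide ρ sᴾ tᴾ (f ρ s))) (entailAll c (coincide sᴾ tᴾ))
  <∣> mapᴹ (λ f ρ s (s∈ , _) → f ρ s s∈) (outside? sᴾ)
  <∣> mapᴹ (λ f ρ s (_ , t∈ , _) → f ρ s t∈) (outside? tᴾ)
  where
  outside? : ∀ P → Check c (λ ρ → ¬ InRegion ρ shape (at ρ P))
  outside? P = mapᴹ (λ h ρ s i → let (g , i′) = All.lookupAny h i in g ρ s i′)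
    (forEach (λ R → mapᴹ (λ f ρ s → excludes-sound ρ R P (f ρ s)) (entailAny c (excludes R P))) shape)

-- An item that cannot apply in the context is skipped before its optimality is examined. Otherwise
-- the rest of the tree has to deal with every way in which the guard can fail.
solves? : ∀ t c → Check c (λ ρ → Legal ρ → Outcome ρ t)
solves? stuck c = mapᴹ (λ f ρ s legal → f ρ s legal) (illegal? c)
solves? (split a t u) c = zipWithᴹ (λ f g ρ s legal → (λ h → f ρ (sat-assume c a s h) legal) , λ ¬h → g ρ (sat-assume c (negate a) s (holds-negate ρ a ¬h)) legal)
  (continue (solves? t) (assume c a)) (continue (solves? u) (assume c (negate a)))
solves? (try it t) c =
  zipWithᴹ (λ f k ρ s legal → (λ h → contradiction h (f ρ s)) , λ _ → k ρ s legal) (refuteGuard c g) (solves? t c)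
  <∣> zipWithᴹ (λ f k ρ s legal → (λ h → f ρ (sat-assumeAll c (units g) s (proj₁ h))) , λ ¬h → k ρ s ¬h legal)
    (optimal? (assumeAll c (units g)) it) (otherwise (solves? t) c g)
  where g = itemGuard it

-- Programs

Dominates : (Point → Set) → List Point → Set
Dominates R xs = ∀ q → Unique q → All R q → length q ≤ length xs

sweep-dominates : ∀ {R p q xs} → Sweep _~_ R p q xs → Dominates R xs
sweep-dominates s q u r = unique-⊆⇒length≤ u (λ z∈ → Sweep.complete s (All.lookup r z∈))

-- Only one path is kept in memory. If the new plan turns out shorter, the earlier winner is
-- computed again instead of being copied; register 11 remembers its length. The number of options
-- is fixed by the table, so this costs a constant factor.
best : List (Plan 5) → Program
best []              = skip
best (bs ∷ [])       = cnt ≔ lit 0 ⨾ emitPlan bs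
best (bs ∷ b ∷ bss) =
  best (b ∷ bss) ⨾ 11 ≔ var cnt ⨾ cnt ≔ lit 0 ⨾ emitPlan bs ⨾
  (ifᵖ var 11 ≤ᵉ var cnt then skip else best (b ∷ bss))

rateBest : List (Plan 5) → ℕ
rateBest []             = 0
rateBest (bs ∷ [])      = 2 + ratePlan bs
rateBest (bs ∷ b ∷ bss) = rateBest (b ∷ bss) + (2 + (2 + (ratePlan bs + (4 + (1 + rateBest (b ∷ bss))))))

compile : Tree → Program
compile (split a t u) = ifᵖ atomᵉ layoutᴸ a then compile t else compile u
compile (try it t)    = ifᵖ guardᵉ layoutᴸ (itemGuard it) then best (map proj₂ (options it)) else compile t
compile stuck         = skip

rateTree : Tree → ℕ
rateTree (split a t u) = 1 + costᵇ (atomᵉ layoutᴸ a) + (rateTree t + rateTree u)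
rateTree (try it t)    = 1 + costᵇ (guardᵉ layoutᴸ (itemGuard it)) + (rateBest (map proj₂ (options it)) + rateTree t)
rateTree stuck         = 0
plan-inside : ∀ ρ bs → Valid ρ bs → ∀ {z} → InPlan ρ bs z → InRegion ρ shape z
plan-inside ρ bs ok i = let (d , i′) = All.lookupAny (plan-demands ρ sᴾ tᴾ bs ok) i in rect-inside _ (proj₁ (meets-⊎ ρ (inL _) _ d)) i′
  where
  rect-inside : ∀ R → Meets ρ (inL R) → ∀ {z} → InRect ρ R z → InRegion ρ shape z
  rect-inside R (us , cl ∷ []) {x , y} i with contained-sound ρ R box us i | x ℤₚ.≤? val (ρ ξ) (𝕖 ⊹ 0ℤ)
  ... | (p , _) , v | yes q = here ((p , q) , v)
  ... | (_ , q) , (_ , w) | no x≰ = there (here ((beyond , q) , (deep cl , w)))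
    where
    beyond : val (ρ ξ) (𝕖 ⊹ 1ℤ) ≤ℤ x
    beyond = subst (_≤ℤ x) (sym (val-raise (ρ ξ) (𝕖 ⊹ 0ℤ))) (ℤₚ.i<j⇒suc[i]≤j (ℤₚ.≰⇒> x≰))
    deep : Any (Holds ρ) (atom ξ (right R) (𝕖 ⊹ 0ℤ) ∷ atom η (𝕖 ⊹ 1ℤ) (top R) ∷ []) → val (ρ η) (𝕖 ⊹ 1ℤ) ≤ℤ y
    deep (here h) = contradiction (ℤₚ.≤-trans (proj₂ (proj₁ i)) h) x≰
    deep (there (here h)) = ℤₚ.≤-trans h (proj₁ (proj₂ i))

SweptBy : Env 5 → Plan 5 → List Point → Set
SweptBy ρ bs = Sweep _~_ (InPlan ρ bs) (at ρ sᴾ) (at ρ tᴾ)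

record Best (ρ : Env 5) (bss : List (Plan 5)) (σ σ′ : State) : Set where
  field
    swept     : Any (λ bs → SweptBy ρ bs (out σ′)) bss
    dominates : All (λ bs → Dominates (InPlan ρ bs) (out σ′)) bss
    keeps     : ∀ r → r < 11 → reg σ′ r ≡ reg σ r
open Best

module _ {ρ : Env 5} {N : ℕ} (1≤N : 1 ≤ N) (small : ∀ xs → Unique xs → All (InRegion ρ shape) xs → length xs ≤ N) where

  constant : ∀ c {x} y → x ≤ y * N → c + x ≤ (c + y) * N
  constant c y p = ≤-trans (+-monoʳ-≤ c p) (linear-step c 1≤N)

  short : ∀ {R xs} → (∀ {z} → R z → InRegion ρ shape z) → Sweep _~_ R (at ρ sᴾ) (at ρ tᴾ) xs → length xs ≤ N
  short into s = small _ (Sweep.simple s) (All.tabulate (into ∘ Sweep.sound s))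

  runs-plan : ∀ {σ} → Agrees layoutᴸ σ ρ → ∀ bs → Valid ρ bs →
    Runs (cnt ≔ lit 0 ⨾ emitPlan bs) σ ((2 + ratePlan bs) * N)
      (λ σ′ → SweptBy ρ bs (out σ′) × Keeps 12 σ σ′)
  runs-plan {σ} agrees bs ok with emits-plan {⟪ reg σ [ cnt ↦ 0 ] , mem σ ⟫} (agrees-keep σ ⟪ reg σ [ cnt ↦ 0 ] , mem σ ⟫ layoutᴸ<12 (λ r r<12 → update-≢ (reg σ) cnt (<⇒≢ (≤-trans r<12 (m≤m+n 12 19)))) agrees) sᴾ tᴾ bs ok
  ... | emits {path} s r = runs-weaken (constant 2 (ratePlan bs) (*-monoʳ-≤ (ratePlan bs) (short (plan-inside ρ bs ok) s)))
    (λ (o , keep) → subst (Sweep _~_ _ _ _) (sym o) s , λ r r<12 → trans (keep r r<12) (update-≢ (reg σ) cnt (<⇒≢ (≤-trans r<12 (m≤m+n 12 19)))))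
    (runs-assign {cnt} {lit 0} ⟫= λ { refl → r })

  length-out : ∀ σ → length (out σ) ≡ reg σ cnt
  length-out σ = length-applyUpTo _ (reg σ cnt)

  runs-best : ∀ {σ} → Agrees layoutᴸ σ ρ → ∀ bs bss → All (λ bs → Valid ρ bs) (bs ∷ bss) →
    Runs (best (bs ∷ bss)) σ (rateBest (bs ∷ bss) * N) (Best ρ (bs ∷ bss) σ)
  runs-best agrees bs [] (ok ∷ []) = runs-weaken ≤-refl
    (λ (s , keep) → record { swept = here s ; dominates = sweep-dominates s ∷ [] ; keeps = λ r r<11 → keep r (m≤n⇒m≤1+n r<11) }) (runs-plan agrees bs ok)
  runs-best {σ} agrees bs (b ∷ bss) (ok ∷ oks) = runs-weaken bound id
    (runs-best agrees b bss oks ⟫= λ {σ₁} B₁ → runs-assign {11} {var cnt} ⟫= λ { refl →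
      reassoc (runs-plan (agrees-keep σ ⟪ reg σ₁ [ 11 ↦ reg σ₁ cnt ] , mem σ₁ ⟫ layoutᴸ<11 (λ r r<11 → trans (update-≢ (reg σ₁) 11 (<⇒≢ r<11)) (B₁ .keeps r r<11)) agrees) bs ok ⟫= λ {σ₂} (s , keep) →
        runs-if {c = (1 + rateBest (b ∷ bss)) * N} (stay σ₁ B₁ σ₂ s keep) (again σ₁ B₁ σ₂ s keep)) })
    where
    Kept₂ : State → State → Set
    Kept₂ σ₁ σ₂ = ∀ r → r < 12 → reg σ₂ r ≡ (reg σ₁ [ 11 ↦ reg σ₁ cnt ]) r
    keep₂ : ∀ σ₁ σ₂ → Best ρ (b ∷ bss) σ σ₁ → Kept₂ σ₁ σ₂ → ∀ r → r < 11 → reg σ₂ r ≡ reg σ r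
    keep₂ σ₁ σ₂ B₁ keep r r<11 = trans (keep r (m≤n⇒m≤1+n r<11)) (trans (update-≢ (reg σ₁) 11 (<⇒≢ r<11)) (B₁ .keeps r r<11))
    stay : ∀ σ₁ → Best ρ (b ∷ bss) σ σ₁ → ∀ σ₂ → SweptBy ρ bs (out σ₂) → Kept₂ σ₁ σ₂ →
      (reg σ₂ 11 ≤ᵇ reg σ₂ cnt) ≡ true → Runs skip σ₂ ((1 + rateBest (b ∷ bss)) * N) (Best ρ (bs ∷ b ∷ bss) σ)
    stay σ₁ B₁ σ₂ s keep t = runs-weaken (≤-trans 1≤N (m≤m+n N _))
      (λ { refl → record { swept = here s ; dominates = sweep-dominates s ∷ All.map (λ d q u r → ≤-trans (d q u r) longer) (B₁ .dominates) ; keeps = keep₂ σ₁ σ₂ B₁ keep } }) runs-skip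
      where
      longer : length (out σ₁) ≤ length (out σ₂)
      longer = subst₂ _≤_ (trans (keep 11 ≤-refl) (sym (length-out σ₁))) (sym (length-out σ₂)) (≤ᵇ⇒≤ (reg σ₂ 11) (reg σ₂ cnt) (subst T (sym t) tt))
    again : ∀ σ₁ → Best ρ (b ∷ bss) σ σ₁ → ∀ σ₂ → SweptBy ρ bs (out σ₂) → Kept₂ σ₁ σ₂ →
      (reg σ₂ 11 ≤ᵇ reg σ₂ cnt) ≡ false → Runs (best (b ∷ bss)) σ₂ ((1 + rateBest (b ∷ bss)) * N) (Best ρ (bs ∷ b ∷ bss) σ)
    again σ₁ B₁ σ₂ s keep f = runs-weaken (m≤n+m _ N)
      (λ {σ₃} B₃ → record
        { swept = there (B₃ .swept)
        ; dominates = (λ q u r → ≤-trans (sweep-dominates s q u r) (≤-trans shorter (outdone B₃ (B₁ .swept)))) ∷ B₃ .dominates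
        ; keeps = λ r r<11 → trans (B₃ .keeps r r<11) (keep₂ σ₁ σ₂ B₁ keep r r<11) })
      (runs-best (agrees-keep σ σ₂ layoutᴸ<11 (keep₂ σ₁ σ₂ B₁ keep) agrees) b bss oks)
      where
      shorter : length (out σ₂) ≤ length (out σ₁)
      shorter = subst₂ _≤_ (sym (length-out σ₂)) (trans (keep 11 ≤-refl) (sym (length-out σ₁)))
        (<⇒≤ (≰⇒> λ le → contradiction (trans (sym (≤ᵇ-true le)) f) λ ()))
      -- The second run need not be identified with the first: its result dominates every plan of
      -- the list, in particular the one swept by the first run.
      outdone : ∀ {σ₃} → Best ρ (b ∷ bss) σ₂ σ₃ → Any (λ bs → SweptBy ρ bs (out σ₁)) (b ∷ bss) → length (out σ₁) ≤ length (out σ₃)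
      outdone B₃ a = let (d , s₁) = All.lookupAny (B₃ .dominates) a in d _ (Sweep.simple s₁) (All.tabulate (Sweep.sound s₁))
    reassoc : ∀ {P Q R σ c Q′} → Runs ((P ⨾ Q) ⨾ R) σ c Q′ → Runs (P ⨾ Q ⨾ R) σ c Q′
    reassoc (runs (⇓seq {d = d′} (⇓seq {c = c} {d} p q) r) b post) = runs (⇓seq p (⇓seq q r)) (≤-trans (≤-reflexive (sym (+-assoc c d d′))) b) post
    rb = rateBest (b ∷ bss)
    rp = ratePlan bs
    bound : rb * N + (2 + ((2 + rp) * N + (4 + (1 + rb) * N))) ≤ rateBest (bs ∷ b ∷ bss) * N
    bound = ≤-trans (+-monoʳ-≤ (rb * N) (constant 2 (2 + (rp + (4 + (1 + rb))))
        (≤-trans (+-monoʳ-≤ ((2 + rp) * N) (constant 4 (1 + rb) ≤-refl))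
          (≤-reflexive (trans (sym (*-distribʳ-+ N (2 + rp) (4 + (1 + rb)))) (cong (_* N) (+-assoc 2 rp (4 + (1 + rb)))))))))
      (≤-reflexive (sym (*-distribʳ-+ N rb (2 + (2 + (rp + (4 + (1 + rb))))))))

  meets-plans : ∀ opts → Meets ρ (planGuards opts) → All (λ bs → Valid ρ bs) (map proj₂ opts)
  meets-plans []                      _  = []
  meets-plans ((D , bs) ∷ [])         ok = ok ∷ []
  meets-plans ((D , bs) ∷ opt ∷ opts) ok =
    let (p , q) = meets-⊎ ρ (requires sᴾ tᴾ bs) (planGuards (opt ∷ opts)) ok in p ∷ meets-plans (opt ∷ opts) q

  Longest : List Point → Set
  Longest xs = STPath ρ xs × (∀ q → STPath ρ q → length q ≤ length xs)

  longest : ∀ {σ σ′} (opts : List (List ℕ × Plan 5)) → All (λ bs → Valid ρ bs) (map proj₂ opts) →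
    (∀ q → STPath ρ q → Any (λ opt → All (InPlan ρ (proj₂ opt)) q) opts) → Best ρ (map proj₂ opts) σ σ′ → Longest (out σ′)
  longest opts oks optimal B =
    (let (ok , s) = All.lookupAny oks (B .swept) in Sweep.starts s , suffix (All.tabulate (plan-inside ρ _ ok ∘ Sweep.sound s)) (Sweep.linked s) (Sweep.simple s) (Sweep.ends s)) ,
    λ q path → let (d , inside) = All.lookupAny (B .dominates) (Anyₚ.map⁺ (optimal q path)) in d q (Suffix.simple (proj₂ path)) inside

  runs-tree : ∀ {σ} → Agrees layoutᴸ σ ρ → ∀ t → Outcome ρ t →
    Runs (compile t) σ (rateTree t * N) (Longest ∘ out)
  runs-tree agrees (split a t u) (yes? , no?) = runs-weaken (constant (1 + costᵇ (atomᵉ layoutᴸ a)) (rateTree t + rateTree u) ≤-refl) id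
    (runs-if-reflects (atom-reflects layoutᴸ agrees a)
      (λ h → runs-weaken (*-monoˡ-≤ N (m≤m+n (rateTree t) (rateTree u))) id (runs-tree agrees t (yes? h)))
      (λ ¬h → runs-weaken (*-monoˡ-≤ N (m≤n+m (rateTree u) (rateTree t))) id (runs-tree agrees u (no? ¬h))))
  runs-tree agrees (try it t) (yes? , no?) = runs-weaken (constant (1 + costᵇ (guardᵉ layoutᴸ (itemGuard it))) (rateBest (map proj₂ (options it)) + rateTree t) ≤-refl) id
    (runs-if-reflects (guard-reflects layoutᴸ agrees (itemGuard it))
      (λ h → runs-weaken (*-monoˡ-≤ N (m≤m+n (rateBest (map proj₂ (options it))) (rateTree t))) id
        (runs-options (options it) (proj₂ (meets-⊎ ρ (guard (extra it) []) (planGuards (options it)) h)) (yes? h)))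
      (λ ¬h → runs-weaken (*-monoˡ-≤ N (m≤n+m (rateTree t) (rateBest (map proj₂ (options it))))) id (runs-tree agrees t (no? ¬h))))
    where
    runs-options : ∀ opts → Meets ρ (planGuards opts) →
      (∀ q → STPath ρ q → Any (λ opt → All (InPlan ρ (proj₂ opt)) q) opts) →
      Runs (best (map proj₂ opts)) _ (rateBest (map proj₂ opts) * N) (Longest ∘ out)
    runs-options [] (_ , () ∷ _)
    runs-options (opt ∷ opts) ok optimal = let oks = meets-plans (opt ∷ opts) ok in
      runs-weaken ≤-refl (longest (opt ∷ opts) oks optimal) (runs-best agrees (proj₂ opt) (map proj₂ opts) oks)

-- The decompositions

-- With the whole shape as the only region and nothing discarded, optimality amounts to covering
-- everything.
hamiltonian : List (Plan 5) → Item
hamiltonian = item [] (shape ∷ []) ∘ zip ([] ∷ [])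

tries : (List (Plan 5) → Item) → List (List (Plan 5)) → Tree → Tree
tries goal plans t = foldr (λ bss → try (goal bss)) t plans

o+ o++ o+++ e- e0 e+ e++ f- f0 s- s0 s+ t- t0 t+ : Term 5
o+   = 𝕠 ⊹ 1ℤ
o++  = 𝕠 ⊹ pos 2
o+++ = 𝕠 ⊹ pos 3
e-   = 𝕖 ⊹ -1ℤ
e0   = 𝕖 ⊹ 0ℤ
e+   = 𝕖 ⊹ 1ℤ
e++  = 𝕖 ⊹ pos 2
f-   = 𝕗 ⊹ -1ℤ
f0   = 𝕗 ⊹ 0ℤ
s-   = 𝕤 ⊹ -1ℤ
s0   = 𝕤 ⊹ 0ℤ
s+   = 𝕤 ⊹ 1ℤ
t-   = 𝕥 ⊹ -1ℤ
t0   = 𝕥 ⊹ 0ℤ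
t+   = 𝕥 ⊹ 1ℤ

-- K is where the two arms meet, T the part above it and E the part to its right.
-- For example, thick-TK is for s in T and t in K; thin means that m − k is 1.
thin-TT : Tree
thin-TT =
  tries (item []
    ((rect s0 s0 s0 s0 ∷ []) ∷ (rect t0 t0 t0 t0 ∷ []) ∷ (rect o+ o+ s+ t- ∷ []) ∷ (rect o+ o+ o+ s- ∷ []) ∷
     (rect o+ o+ t+ f0 ∷ rect e+ f0 e+ f0 ∷ []) ∷ [])
    ∘ zip ((3 ∷ 4 ∷ []) ∷ [])) (
    ((blk t0 s0 s0 t0 (source ◲) ∷ []) ∷ []) ∷ []) stuck

-- For n - l at least 2. The column above K has width one, so s blocks the way to what lies above
-- it, and only that is lost.
thin-T-thick : Tree
thin-T-thick =
  tries (item []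
    ((rect s0 s0 s0 s0 ∷ []) ∷ (rect o+ o+ o+ s- ∷ []) ∷ (rect o+ o+ s+ e0 ∷ rect o+ f0 e+ f0 ∷ []) ∷ [])
    ∘ zip ((1 ∷ []) ∷ [])) (
    ((blk o+ s0 s0 e0 (source ◲) ∷ blk o+ f0 e+ f0 (sink ◰) ∷ []) ∷ []) ∷
    ((blk o+ o+ s0 t- (source ◱) ∷ blk s+ f0 e+ f0 (sweep ◰ along↕) ∷ blk s0 s0 t0 f0 (sink ◲) ∷ []) ∷ []) ∷ []) stuck

thin-TE : Tree
thin-TE =
  tries (item []
    ((rect s0 s0 s0 s0 ∷ []) ∷ (rect t0 t0 t0 t0 ∷ []) ∷ (rect o+ o+ o+ s- ∷ []) ∷ (rect t+ f0 f0 f0 ∷ []) ∷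
     (rect o+ o+ s+ f0 ∷ rect e+ t- f0 f0 ∷ []) ∷ [])
    ∘ zip ((2 ∷ 3 ∷ []) ∷ [])) (
    ((blk o+ o+ s0 t- (source ◱) ∷ blk s0 t0 e+ t0 (sink ◰) ∷ []) ∷ []) ∷ []) stuck

-- For n - l = 1, hence t = (1 , n). One cell beyond t can still be visited: (2 , n) is a diagonal
-- neighbour of (1 , n - 1), so the path may pass through it just before t.
thin-TK : Tree
thin-TK =
  tries (item []
    ((rect s0 s0 s0 s0 ∷ []) ∷ (rect t0 t0 t0 t0 ∷ []) ∷ (rect o+ o+ o+ s- ∷ []) ∷ (rect o++ o++ f0 f0 ∷ []) ∷
     (rect o+++ f0 f0 f0 ∷ []) ∷ (rect o+ o+ s+ f- ∷ []) ∷ [])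
    ∘ zip ((2 ∷ 4 ∷ []) ∷ [])) (
    ((blk s0 o+ s0 e0 (source ◲) ∷ blk t0 o++ f0 t0 (sink ◲) ∷ []) ∷ []) ∷ []) stuck

thin-KE : Tree
thin-KE =
  tries (item []
    ((rect s0 s0 s0 s0 ∷ []) ∷ (rect t0 t0 t0 t0 ∷ []) ∷ (rect o+ o+ e0 e0 ∷ []) ∷ (rect o+ o+ o+ e- ∷ []) ∷
     (rect t+ f0 f0 f0 ∷ []) ∷ (rect o++ t- f0 f0 ∷ []) ∷ [])
    ∘ zip ((3 ∷ 4 ∷ []) ∷ [])) (
    ((blk o+ e0 e0 f0 (source ◳) ∷ blk e+ t0 e+ f0 (sink ◰) ∷ []) ∷ []) ∷ []) stuck

thin-EE : Tree
thin-EE =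
  tries (item []
    ((rect s0 s0 s0 s0 ∷ []) ∷ (rect t0 t0 t0 t0 ∷ []) ∷ (rect s+ t- f0 f0 ∷ []) ∷ (rect t+ f0 f0 f0 ∷ []) ∷
     (rect o+ e0 o+ f0 ∷ rect e+ s- f0 f0 ∷ []) ∷ [])
    ∘ zip ((3 ∷ 4 ∷ []) ∷ [])) (
    ((blk s0 t0 t0 f0 (source ◳) ∷ []) ∷ []) ∷ []) stuck

-- For m - k = 1 and n - l at least 2, with neither end above K. Of the column above K only its
-- lowest cell (1 , l) can be visited, since going higher would use that cell twice. In the first
-- five items s and t block that cell or cut a band of two rows or columns, so that several options
-- compete; the last item covers all the rest.
thin-rest : Tree
thin-rest =
  -- The neighbours of (1 , l) below it are s and t themselves, so the only path through this cell
  -- is s, (1 , l), t.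
  tries (item (atom ξ s0 o+ ∷ atom ξ t0 o++ ∷ atom η s0 e+ ∷ atom η t0 e+ ∷ [])
    ((rect s0 s0 s0 s0 ∷ []) ∷ (rect t0 t0 t0 t0 ∷ []) ∷ (rect o+ o+ e0 e0 ∷ []) ∷ (rect o+ o+ o+ e- ∷ []) ∷
     (rect o+++ f0 e+ f0 ∷ rect o+ o++ e++ f0 ∷ []) ∷ [])
    ∘ zip ((2 ∷ 3 ∷ []) ∷ (3 ∷ 4 ∷ []) ∷ [])) (
    ((blk o+ t- e+ f0 (source ◲) ∷ blk s+ f0 s0 f0 (sink ◱) ∷ []) ∷
     (blk s0 s0 e0 s0 (source ◰) ∷ blk e+ t0 s0 s0 (sink ◳) ∷ []) ∷ []) ∷ []) (
  -- s and t fill a column of a band of two rows, so a path keeps to one side of it.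
  tries (item (atom η f0 e++ ∷ atom ξ s0 t0 ∷ atom ξ t0 s0 ∷ atom ξ o++ s0 ∷ atom ξ s+ f0 ∷ [])
    ((rect s0 s0 s0 s0 ∷ []) ∷ (rect t0 t0 t0 t0 ∷ []) ∷ (rect o+ o+ e0 e0 ∷ []) ∷ (rect o+ o+ o+ e- ∷ []) ∷
     (rect o+ s- e+ f0 ∷ []) ∷ (rect s+ f0 e+ f0 ∷ []) ∷ [])
    ∘ zip ((3 ∷ 5 ∷ []) ∷ (2 ∷ 3 ∷ 4 ∷ []) ∷ [])) (
    ((blk e+ s0 e+ s0 (source ◰) ∷ blk o+ e0 e0 s0 (sweep ◰ across) ∷ blk o+ s0 s+ f0 (sink ◱) ∷ []) ∷
     (blk t0 f0 s0 f0 (source ◱) ∷ []) ∷ []) ∷ []) (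
  tries (item (atom η f0 e++ ∷ atom ξ s0 o+ ∷ atom ξ t0 o++ ∷ atom ξ o++ t0 ∷ atom ξ o+++ f0 ∷ atom η s0 e+ ∷ atom η e++ t0 ∷ [])
    ((rect s0 s0 s0 s0 ∷ []) ∷ (rect t0 t0 t0 t0 ∷ []) ∷ (rect o+ o+ e0 e0 ∷ []) ∷ (rect o+ o+ o+ e- ∷ []) ∷
     (rect o++ o++ e+ e+ ∷ []) ∷ (rect o+ o+ f0 f0 ∷ []) ∷ (rect o+++ f0 e+ f0 ∷ []) ∷ [])
    ∘ zip ((2 ∷ 3 ∷ []) ∷ (3 ∷ 5 ∷ []) ∷ (3 ∷ 6 ∷ []) ∷ [])) (
    ((blk s0 o+ s0 f0 (source ◲) ∷ blk t0 f0 e+ t0 (sink ◰) ∷ []) ∷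
     (blk o+ s0 e0 s0 (source ◳) ∷ blk o++ f0 e+ f0 (sink ◰) ∷ []) ∷
     (blk o+ o+ e0 s0 (source ◳) ∷ blk o++ t0 e+ s0 (sweep ◰ across) ∷ blk s0 o++ f0 t0 (sink ◱) ∷ []) ∷ []) ∷ []) (
  tries (item (atom η f0 e++ ∷ atom ξ s0 o+ ∷ atom ξ t0 o++ ∷ atom ξ o++ t0 ∷ atom ξ o+++ f0 ∷ atom η e++ s0 ∷ atom η t0 e+ ∷ [])
    ((rect s0 s0 s0 s0 ∷ []) ∷ (rect t0 t0 t0 t0 ∷ []) ∷ (rect o+ o+ e0 e0 ∷ []) ∷ (rect o+ o+ o+ e- ∷ []) ∷
     (rect o+ o+ e+ e+ ∷ []) ∷ (rect o++ o++ f0 f0 ∷ []) ∷ (rect o+++ f0 e+ f0 ∷ []) ∷ [])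
    ∘ zip ((2 ∷ 3 ∷ []) ∷ (3 ∷ 6 ∷ []) ∷ [])) (
    ((blk s0 o+ t0 f0 (source ◰) ∷ blk o++ f0 e+ s0 (sink ◱) ∷ []) ∷
     (blk o+ o++ f0 f0 (source ◳) ∷ blk o+ t- e0 e+ (sweep ◱ across) ∷ blk s+ o++ e+ s- (sink ◰) ∷ []) ∷ []) ∷ []) (
  tries (item (atom ξ f0 o++ ∷ atom η s0 t0 ∷ atom η t0 s0 ∷ atom η e++ s0 ∷ atom η s+ f0 ∷ [])
    ((rect s0 s0 s0 s0 ∷ []) ∷ (rect t0 t0 t0 t0 ∷ []) ∷ (rect o+ o+ e0 e0 ∷ []) ∷ (rect o+ o+ o+ e- ∷ []) ∷
     (rect o+ f0 e+ s- ∷ []) ∷ (rect o+ f0 s+ f0 ∷ []) ∷ [])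
    ∘ zip ((3 ∷ 5 ∷ []) ∷ (2 ∷ 3 ∷ 4 ∷ []) ∷ [])) (
    ((blk o+ e0 e0 s0 (source ◳) ∷ blk e+ f0 e+ s0 (sink ◳) ∷ []) ∷
     (blk s0 t0 t0 f0 (source ◳) ∷ []) ∷ []) ∷ []) (
  tries (item []
    ((rect o+ o+ e0 e0 ∷ []) ∷ (rect o+ o+ o+ e- ∷ []) ∷ (rect o+ f0 e+ f0 ∷ []) ∷ [])
    ∘ zip ((1 ∷ []) ∷ [])) (
    ((blk e+ f0 e+ t- (source ◰) ∷ blk o+ e0 e0 t- (sweep ◰ across) ∷ blk o+ f0 t0 f0 (sink ◰) ∷ []) ∷ []) ∷
    ((blk o+ e0 e0 s0 (source ◳) ∷ blk e+ f0 e+ s0 (sweep ◰ across) ∷ blk o+ f0 s+ f0 (sink ◳) ∷ []) ∷ []) ∷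
    ((blk e+ s0 e+ s0 (source ◰) ∷ blk o+ e0 e0 s0 (sweep ◰ across) ∷ blk o+ s0 s+ f0 (sweep ◰ across) ∷
      blk s+ f0 e+ f0 (sink ◱) ∷ []) ∷ []) ∷
    ((blk o+ e0 s0 f0 (source ◱) ∷ blk e+ f0 s0 f0 (sweep ◱ along↕) ∷ blk o+ e0 e0 s- (sweep ◱ across) ∷
      blk e+ f0 e+ s- (sink ◰) ∷ []) ∷ []) ∷
    ((blk o+ e0 e0 f0 (source ◳) ∷ blk o++ f0 e+ f0 (sink ◰) ∷ []) ∷ []) ∷
    ((blk e+ f0 e+ s0 (source ◰) ∷ blk o+ e0 e0 s0 (sweep ◰ across) ∷ blk o+ f0 s+ f0 (sink ◰) ∷ []) ∷ []) ∷
    ((blk o+ s0 e0 s0 (source ◳) ∷ blk o++ t- e+ s0 (sweep ◰ across) ∷ blk o+ t- s+ f0 (sweep ◳ along↕) ∷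
      blk t0 f0 e+ f0 (sink ◱) ∷ []) ∷ []) ∷
    ((blk e+ s0 s0 f0 (source ◰) ∷ blk o+ e0 e0 f0 (sweep ◱ across) ∷ blk e+ s0 e+ s- (sweep ◰ across) ∷
      blk s+ f0 e+ f0 (sink ◱) ∷ []) ∷ []) ∷
    ((blk e+ s0 e+ s0 (source ◰) ∷ blk o+ e0 e0 f0 (sweep ◰ across) ∷ blk e+ t- t0 f0 (sweep ◱ across) ∷
      blk t0 s0 t+ f0 (sweep ◰ across) ∷ blk s+ f0 e+ f0 (sweep ◱ along↕) ∷ blk t0 s0 t0 t0 (sink ◳) ∷ []) ∷ []) ∷
    ((blk o++ s0 s0 s0 (source ◱) ∷ blk o+ t- t0 t0 (sweep ◳ across) ∷ blk o+ o+ e0 t- (sweep ◱ across) ∷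
      blk e+ f0 e+ s- (sweep ◰ across) ∷ blk s+ f0 s0 f0 (sweep ◳ across) ∷ blk s0 s0 t0 f0 (sink ◰) ∷ []) ∷ []) ∷
    ((blk o+ f0 t+ f0 (source ◰) ∷ blk o+ e0 e0 t0 (sweep ◱ across) ∷ blk e+ f0 e+ t0 (sink ◰) ∷ []) ∷ []) ∷
    ((blk s0 s0 s0 s0 (source ◰) ∷ blk o+ o+ e0 t0 (sweep ◰ across) ∷ blk o+ t0 t+ f0 (sweep ◰ across) ∷
      blk s+ f0 s0 f0 (sweep ◱ along↕) ∷ blk t0 s0 s+ t0 (sink ◰) ∷ []) ∷ []) ∷
    ((blk o+ f0 s0 f0 (source ◳) ∷ blk t+ f0 t0 s- (sweep ◲ across) ∷ blk o++ t0 t+ s- (sweep ◰ across) ∷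
      blk o+ o+ e0 s- (sweep ◱ across) ∷ blk t0 t0 t0 t0 (sink ◱) ∷ []) ∷ []) ∷
    ((blk o+ e0 e0 s0 (source ◳) ∷ blk e+ f0 e+ s- (sweep ◰ across) ∷ blk t+ f0 s0 f0 (sweep ◳ across) ∷
      blk o+ t0 s+ f0 (sweep ◲ across) ∷ blk e+ t0 s0 s0 (sink ◰) ∷ []) ∷ []) ∷
    ((blk o++ s0 s0 t0 (source ◱) ∷ blk o++ f0 s+ f0 (sweep ◰ along↕) ∷ blk o+ o+ e0 f0 (sweep ◱ across) ∷
      blk e+ f0 e+ s- (sweep ◰ across) ∷ blk s+ f0 t0 s0 (sink ◲) ∷ []) ∷ []) ∷
    ((blk e0 o+ s- s0 (source ◰) ∷ blk o++ e+ f- s0 (sweep ◰ across) ∷ blk o+ e+ f0 s+ (sweep ◰ across) ∷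
      blk o+++ f0 e+ f0 (sink ◰) ∷ []) ∷ []) ∷
    ((blk e+ s0 s0 f0 (source ◱) ∷ blk o+ e0 e0 f0 (sweep ◱ across) ∷ blk e+ f0 e+ s- (sweep ◰ across) ∷
      blk s+ f0 s0 f0 (sink ◳) ∷ []) ∷ []) ∷
    ((blk e+ t- s0 s0 (source ◰) ∷ blk o+ e0 e0 f0 (sweep ◰ across) ∷ blk o++ s0 s+ f0 (sweep ◱ across) ∷
      blk s+ f0 s0 f0 (sink ◰) ∷ []) ∷ []) ∷
    ((blk o+ e0 e0 t0 (source ◳) ∷ blk o++ f0 e+ t- (sweep ◰ across) ∷ blk s+ t- s0 s0 (sweep ◳ across) ∷
      blk o+ t- s+ f0 (sweep ◰ across) ∷ blk t0 t0 s0 f0 (sink ◲) ∷ []) ∷ []) ∷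
    ((blk o+ e0 t+ s0 (source ◰) ∷ blk o+ t0 s+ f0 (sweep ◰ across) ∷ blk t+ f0 e+ f0 (sweep ◱ along↕) ∷
      blk s+ t0 s0 s0 (sweep ◰ across) ∷ blk o+ s0 e0 s- (sweep ◱ across) ∷ blk t0 t0 e+ t0 (sink ◰) ∷ []) ∷ []) ∷
    ((blk t0 t0 s0 t- (source ◰) ∷ blk o++ t- s0 f0 (sweep ◳ across) ∷ blk o+ e0 e0 f0 (sweep ◱ across) ∷
      blk e+ t0 e+ s- (sweep ◰ along↔) ∷ blk t+ f0 e+ t0 (sweep ◰ along↕) ∷ blk s0 s0 s+ f0 (sink ◲) ∷ []) ∷ []) ∷
    ((blk o+ e0 e0 s0 (source ◰) ∷ blk e+ f0 e+ s0 (sweep ◰ across) ∷ blk o+ t- s+ f0 (sweep ◳ along↕) ∷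
      blk t0 f0 s+ f0 (sink ◱) ∷ []) ∷ []) ∷
    ((blk e+ t- e+ s0 (source ◱) ∷ blk o+ o+ e0 f0 (sweep ◰ across) ∷ blk o++ t0 t+ f0 (sweep ◱ along↕) ∷
      blk o++ t- t0 t0 (sweep ◰ across) ∷ blk s+ f0 e+ t0 (sink ◳) ∷ []) ∷ []) ∷
    ((blk o+ o+ e0 s0 (source ◳) ∷ blk s+ t- e+ s0 (sweep ◰ along↕) ∷ blk s0 f0 s+ f0 (sweep ◰ across) ∷
      blk t0 f0 t0 s0 (sink ◲) ∷ []) ∷ []) ∷
    ((blk s0 s0 s0 f0 (source ◱) ∷ blk o+ s- t0 f0 (sweep ◲ across) ∷ blk o+ e0 e0 t- (sweep ◱ across) ∷
      blk e+ f0 e+ t- (sweep ◰ across) ∷ blk s0 s0 t0 s- (sweep ◰ across) ∷ blk s+ f0 t0 f0 (sink ◲) ∷ []) ∷ []) ∷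
    ((blk e+ s0 e+ s0 (source ◰) ∷ blk o+ o+ e0 s0 (sweep ◰ across) ∷ blk o+ t- s+ f0 (sweep ◰ across) ∷
      blk t0 t0 s+ t- (sweep ◱ across) ∷ blk t+ f0 e+ t- (sweep ◰ across) ∷ blk s0 f0 t0 f0 (sink ◲) ∷ []) ∷ []) ∷
    ((blk s0 t- t0 s0 (source ◰) ∷ blk e+ f0 e+ t- (sweep ◳ across) ∷ blk o+ e0 e0 t- (sweep ◰ across) ∷
      blk o+ s- s0 f0 (sweep ◰ across) ∷ blk s0 t- s+ f0 (sweep ◰ across) ∷ blk t0 f0 s0 f0 (sink ◲) ∷ []) ∷ []) ∷
    ((blk o++ s0 t0 s0 (source ◱) ∷ blk e+ f0 e+ t- (sweep ◱ along↕) ∷ blk o+ e0 e0 f0 (sweep ◰ across) ∷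
      blk e+ s0 s+ f0 (sweep ◰ across) ∷ blk t0 f0 s0 f0 (sink ◱) ∷ []) ∷ []) ∷
    ((blk o++ t- e+ s0 (source ◱) ∷ blk o+ e0 e0 s0 (sweep ◰ across) ∷ blk o+ s- t0 f0 (sweep ◰ along↔) ∷
      blk s0 f0 t+ f0 (sweep ◰ across) ∷ blk s0 s0 t0 t0 (sweep ◰ across) ∷ blk s+ t0 e+ t0 (sink ◰) ∷ []) ∷ []) ∷
    ((blk o++ s0 e+ s0 (source ◱) ∷ blk o+ e0 e0 f0 (sweep ◰ across) ∷ blk o++ t0 t+ f0 (sweep ◱ across) ∷
      blk e+ s0 s+ t0 (sweep ◱ across) ∷ blk t0 t0 e+ t0 (sink ◰) ∷ []) ∷ []) ∷
    ((blk s0 e0 e0 s0 (source ◳) ∷ blk o++ f0 e+ s- (sweep ◰ across) ∷ blk t+ f0 s0 f0 (sweep ◳ across) ∷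
      blk o++ t0 s0 t- (sweep ◳ across) ∷ blk s0 t0 t0 f0 (sink ◱) ∷ []) ∷ []) ∷
    ((blk o+ o+ e0 t- (source ◳) ∷ blk s+ f0 e+ t- (sweep ◰ along↕) ∷ blk o+ f0 s+ t0 (sink ◰) ∷ []) ∷ []) ∷ []) stuck)))))

thick-TE : Tree
thick-TE =
  tries hamiltonian (
    ((blk o+ e0 o+ f0 (source ◲) ∷ blk e+ f0 e+ f0 (sink ◱) ∷ []) ∷ []) ∷
    ((blk o+ e0 o+ e0 (source ◱) ∷ blk o+ f0 e+ f0 (sink ◰) ∷ []) ∷ []) ∷
    ((blk o+ e0 o+ t- (source ◳) ∷ blk e+ f0 e+ t- (sweep ◰ across) ∷ blk o+ t- t0 f0 (sweep ◳ along↕) ∷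
      blk t0 f0 t0 f0 (sink ◲) ∷ []) ∷ []) ∷
    ((blk o+ e0 o+ f0 (source ◳) ∷ blk e+ f0 s+ f0 (sink ◰) ∷ []) ∷ []) ∷
    ((blk o+ s0 o+ s0 (source ◳) ∷ blk s+ e0 o+ e0 (sweep ◰ along↕) ∷ blk s0 f0 e+ f0 (sink ◰) ∷ []) ∷ []) ∷ []) stuck

thick-TK : Tree
thick-TK =
  tries hamiltonian (
    ((blk o+ e0 o+ e0 (source ◲) ∷ blk e+ f0 e+ f0 (sweep ◰ along↕) ∷ blk o+ e0 e+ f0 (sink ◲) ∷ []) ∷ []) ∷
    ((blk o+ e0 o+ e0 (source ◱) ∷ blk o+ f0 e+ f0 (sink ◰) ∷ []) ∷ []) ∷
    ((blk o+ e0 o+ s0 (source ◱) ∷ blk t+ f0 t0 f0 (sweep ◰ along↕) ∷ blk o+ t0 s+ f0 (sink ◱) ∷ []) ∷ []) ∷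
    ((blk s0 e0 o+ t- (source ◳) ∷ blk t+ f0 s+ t0 (sweep ◰ across) ∷ blk o+ f0 t+ f0 (sweep ◳ along↔) ∷
      blk o+ s- o+ t0 (sweep ◱ across) ∷ blk s0 t0 e+ t0 (sink ◱) ∷ []) ∷ []) ∷
    ((blk o+ e0 o+ t- (source ◳) ∷ blk e+ f0 e+ f0 (sweep ◰ along↕) ∷ blk o+ e0 t0 f0 (sink ◲) ∷ []) ∷ []) ∷
    ((blk o+ s0 o+ e0 (source ◳) ∷ blk s+ e0 o+ s0 (sweep ◰ along↕) ∷ blk o+ f0 s+ f0 (sink ◰) ∷ []) ∷ []) ∷
    ((blk s0 e0 o+ e0 (source ◲) ∷ blk e+ f0 e+ f0 (sweep ◰ along↕) ∷ blk s0 e0 e+ f0 (sweep ◲ across) ∷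
      blk o+ s- s0 f0 (sink ◳) ∷ []) ∷ []) ∷
    ((blk t+ e0 o+ s0 (source ◳) ∷ blk s+ f0 e+ t0 (sweep ◰ across) ∷ blk o+ f0 t+ f0 (sweep ◳ along↔) ∷
      blk t+ s0 t0 t0 (sweep ◰ across) ∷ blk o+ t0 s0 t0 (sink ◰) ∷ []) ∷ []) ∷
    ((blk s0 e0 o+ s0 (source ◲) ∷ blk t+ f0 e+ f0 (sweep ◳ across) ∷ blk t0 t0 e+ t- (sweep ◱ across) ∷
      blk o+ t- o+ f0 (sweep ◳ along↕) ∷ blk t0 t0 t0 t0 (sink ◰) ∷ []) ∷ []) ∷
    ((blk o+ t- o+ f0 (source ◲) ∷ blk t0 e0 o+ t- (sweep ◱ across) ∷ blk e+ f0 e+ f0 (sweep ◰ along↕) ∷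
      blk t0 e0 t0 f0 (sink ◲) ∷ []) ∷ []) ∷
    ((blk o+ t- s0 t0 (source ◱) ∷ blk o+ f0 t+ f0 (sweep ◰ along↔) ∷ blk e+ f0 e+ t0 (sweep ◳ across) ∷
      blk t0 e0 s0 t0 (sink ◳) ∷ []) ∷ []) ∷
    ((blk t0 s0 s0 e0 (source ◰) ∷ blk s0 s0 s+ t0 (sweep ◰ across) ∷ blk s+ e0 o+ t0 (sweep ◰ along↔) ∷
      blk e+ f0 e+ t0 (sweep ◰ across) ∷ blk s0 f0 t+ f0 (sweep ◳ across) ∷ blk t0 t0 e+ f0 (sink ◱) ∷ []) ∷ []) ∷
    ((blk t0 t0 s0 e0 (source ◰) ∷ blk o+ t- o+ t0 (sweep ◳ along↕) ∷ blk s0 s0 e+ t- (sweep ◱ across) ∷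
      blk s+ e0 o+ t- (sweep ◰ across) ∷ blk e+ f0 e+ t- (sweep ◱ along↔) ∷ blk t0 f0 t0 f0 (sink ◲) ∷ []) ∷ []) ∷
    ((blk o+ s0 o+ e0 (source ◰) ∷ blk o+ s- e+ f0 (sweep ◰ across) ∷ blk s0 e0 t+ f0 (sweep ◱ along↔) ∷
      blk e+ f0 e+ f0 (sweep ◱ along↕) ∷ blk s+ e0 o+ t0 (sweep ◳ along↔) ∷ blk s0 s0 e+ t0 (sink ◲) ∷ []) ∷ []) ∷ []) stuck

-- The first item is the only obstruction when both arms have width at least two: s and t side by
-- side in an arm of width two, below its end. A path then stays above or below them.
thick-TT : Tree
thick-TT =
  tries (item (atom ξ e0 o++ ∷ atom η s0 t0 ∷ atom η t0 s0 ∷ atom η o++ s0 ∷ [])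
    ((rect s0 s0 s0 s0 ∷ []) ∷ (rect t0 t0 t0 t0 ∷ []) ∷ (rect o+ e0 o+ s- ∷ []) ∷
     (rect o+ e0 s+ f0 ∷ rect e+ f0 e+ f0 ∷ []) ∷ [])
    ∘ zip ((2 ∷ []) ∷ (3 ∷ []) ∷ [])) (
    ((blk o+ s0 s0 f0 (source ◱) ∷ blk s+ f0 e+ f0 (sweep ◱ along↕) ∷ blk s+ e0 s0 e0 (sink ◲) ∷ []) ∷
     (blk o+ e0 o+ s0 (source ◲) ∷ []) ∷ []) ∷ []) (
  tries hamiltonian (
    ((blk o+ s0 o+ f0 (source ◲) ∷ blk s+ f0 e+ f0 (sweep ◱ along↕) ∷ blk s+ e0 o+ e0 (sink ◱) ∷ []) ∷ []) ∷
    ((blk o+ e0 o+ t- (source ◲) ∷ blk t+ e0 t0 e0 (sweep ◳ across) ∷ blk t+ f0 e+ f0 (sweep ◰ along↕) ∷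
      blk o+ t0 t0 f0 (sink ◲) ∷ []) ∷ []) ∷
    ((blk o+ s0 s0 f0 (source ◲) ∷ blk s+ f0 e+ f0 (sweep ◱ along↕) ∷ blk s+ e0 s0 e0 (sweep ◱ across) ∷
      blk o+ e0 o+ s- (sink ◱) ∷ []) ∷ []) ∷
    ((blk o+ e0 o+ s0 (source ◱) ∷ blk o+ s- s+ f0 (sweep ◰ across) ∷ blk s0 f0 e+ f0 (sweep ◱ along↕) ∷
      blk s0 e0 s+ e0 (sink ◱) ∷ []) ∷ []) ∷
    ((blk o+ t- o+ f0 (source ◲) ∷ blk t0 f0 e+ f0 (sweep ◱ along↕) ∷ blk t0 e0 o+ e0 (sink ◲) ∷ []) ∷ []) ∷
    ((blk o+ s0 s0 f0 (source ◲) ∷ blk s+ f0 e+ f0 (sweep ◱ along↕) ∷ blk s+ e0 s0 e0 (sweep ◱ across) ∷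
      blk o+ e0 o+ s- (sink ◲) ∷ []) ∷ []) ∷
    ((blk o+ s0 o+ s0 (source ◰) ∷ blk s+ e0 o+ s- (sweep ◰ across) ∷ blk t+ e0 s0 e0 (sweep ◳ across) ∷
      blk t+ f0 e+ f0 (sweep ◰ along↕) ∷ blk o+ t0 s+ f0 (sweep ◲ across) ∷ blk s+ t0 s0 s0 (sink ◰) ∷ []) ∷ []) ∷
    ((blk o+ t- o+ f0 (source ◲) ∷ blk t0 e0 e+ f0 (sweep ◱ along↔) ∷ blk e+ f0 e+ f0 (sweep ◱ along↕) ∷
      blk t0 e0 o+ e0 (sink ◲) ∷ []) ∷ []) ∷
    ((blk o+ e0 o+ t- (source ◲) ∷ blk o+ t- t0 f0 (sweep ◳ along↕) ∷ blk t0 f0 e+ f0 (sweep ◱ along↕) ∷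
      blk t0 e0 t0 e0 (sink ◲) ∷ []) ∷ []) ∷
    ((blk s0 s0 s0 s0 (source ◰) ∷ blk s0 f0 s+ f0 (sweep ◰ along↕) ∷ blk o+ s- o+ f0 (sweep ◲ along↕) ∷
      blk s0 e0 o+ t- (sweep ◰ across) ∷ blk s+ e0 s0 e0 (sink ◰) ∷ []) ∷ []) ∷
    ((blk s0 e0 s0 e0 (source ◲) ∷ blk s0 f0 e+ f0 (sweep ◰ along↕) ∷ blk o+ s- o+ f0 (sweep ◲ along↕) ∷
      blk s0 e0 o+ t0 (sink ◰) ∷ []) ∷ []) ∷
    ((blk o+ t0 s0 s0 (source ◰) ∷ blk o+ s- t0 t0 (sweep ◰ across) ∷ blk o+ t0 t+ f0 (sweep ◳ along↕) ∷
      blk s+ f0 e+ f0 (sweep ◱ along↕) ∷ blk t+ e0 o+ e0 (sweep ◱ along↕) ∷ blk s0 s0 t0 t0 (sink ◳) ∷ []) ∷ []) ∷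
    ((blk o+ s0 s0 s0 (source ◰) ∷ blk s0 t0 s+ f0 (sweep ◳ along↕) ∷ blk t+ f0 e+ f0 (sweep ◱ along↕) ∷
      blk t+ e0 o+ e0 (sweep ◱ along↕) ∷ blk t0 t0 t+ s0 (sweep ◰ across) ∷ blk o+ t0 t0 t0 (sink ◱) ∷ []) ∷ []) ∷
    ((blk o+ t- o+ t- (source ◰) ∷ blk o+ s- s+ f0 (sweep ◰ across) ∷ blk s0 f0 e+ f0 (sweep ◱ along↕) ∷
      blk s0 t0 t+ e0 (sweep ◲ across) ∷ blk s0 t- s+ t0 (sweep ◰ across) ∷ blk t0 e0 s0 t0 (sink ◰) ∷ []) ∷ []) ∷
    ((blk o+ s0 o+ s0 (source ◳) ∷ blk s+ e0 o+ t- (sweep ◰ across) ∷ blk s+ t- t0 s0 (sweep ◳ across) ∷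
      blk o+ t- s+ f0 (sweep ◰ across) ∷ blk t0 f0 e+ f0 (sweep ◱ along↕) ∷ blk t0 e0 t0 e0 (sink ◲) ∷ []) ∷ []) ∷
    ((blk s0 s0 s0 s0 (source ◰) ∷ blk s0 e0 s+ e0 (sweep ◰ across) ∷ blk s0 f0 e+ f0 (sweep ◰ along↕) ∷
      blk o+ s- o+ f0 (sweep ◲ along↕) ∷ blk s0 e0 o+ s- (sweep ◰ across) ∷ blk s+ e0 s0 s0 (sink ◰) ∷ []) ∷ []) ∷
    ((blk s0 e0 s0 s0 (source ◳) ∷ blk s0 s0 s+ e0 (sweep ◰ across) ∷ blk o+ s- o+ f0 (sweep ◳ along↕) ∷
      blk s0 f0 e+ f0 (sweep ◱ along↕) ∷ blk t0 e0 t0 t0 (sink ◳) ∷ []) ∷ []) ∷ []) stuck)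

thick-KK : Tree
thick-KK =
  tries hamiltonian (
    ((blk o+ t- o+ f0 (source ◳) ∷ blk t0 e0 o+ e0 (sweep ◰ across) ∷ blk t0 f0 e+ f0 (sink ◰) ∷ []) ∷ []) ∷
    ((blk o+ e0 o+ s0 (source ◲) ∷ blk e+ f0 e+ s0 (sweep ◰ across) ∷ blk o+ f0 s+ f0 (sink ◳) ∷ []) ∷ []) ∷
    ((blk o+ t- o+ f0 (source ◳) ∷ blk t0 e0 o+ e0 (sweep ◰ across) ∷ blk e+ f0 e+ f0 (sweep ◰ along↕) ∷
      blk t0 e0 e+ f0 (sink ◲) ∷ []) ∷ []) ∷
    ((blk o+ e0 e+ s0 (source ◰) ∷ blk o+ e0 o+ e0 (sweep ◱ along↔) ∷ blk e+ f0 e+ s0 (sweep ◰ across) ∷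
      blk o+ f0 s+ f0 (sink ◳) ∷ []) ∷ []) ∷
    ((blk s0 t- s0 s0 (source ◰) ∷ blk o+ e0 o+ s- (sweep ◱ along↔) ∷ blk e+ f0 e+ f0 (sweep ◰ along↕) ∷
      blk s+ t0 s0 s0 (sweep ◰ across) ∷ blk o+ e0 t0 f0 (sink ◰) ∷ []) ∷ []) ∷
    ((blk o+ e0 s0 f0 (source ◲) ∷ blk e+ f0 e+ f0 (sweep ◱ along↕) ∷ blk o+ e0 o+ e0 (sweep ◲ along↔) ∷
      blk o+ e0 e+ s- (sink ◰) ∷ []) ∷ []) ∷
    ((blk s0 t0 e+ s0 (source ◳) ∷ blk s+ e0 e+ f0 (sweep ◰ across) ∷ blk e+ f0 e+ t0 (sweep ◱ along↕) ∷
      blk o+ e0 o+ e0 (sweep ◲ along↔) ∷ blk o+ t- e+ f0 (sweep ◰ across) ∷ blk t0 s0 s+ t0 (sink ◰) ∷ []) ∷ []) ∷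
    ((blk t0 e0 s0 t- (source ◰) ∷ blk o+ t- o+ f0 (sweep ◲ along↕) ∷ blk s0 t0 o+ s- (sweep ◰ across) ∷
      blk e+ f0 e+ s0 (sweep ◱ along↔) ∷ blk t0 f0 t0 f0 (sink ◳) ∷ []) ∷ []) ∷
    ((blk o+ s0 o+ t0 (source ◳) ∷ blk s+ e0 o+ t- (sweep ◰ across) ∷ blk e+ f0 e+ s0 (sweep ◱ along↔) ∷
      blk s0 f0 s+ f0 (sweep ◳ along↔) ∷ blk t0 e0 t0 t0 (sink ◰) ∷ []) ∷ []) ∷
    ((blk o+ t- s0 s0 (source ◰) ∷ blk o+ f0 s+ f0 (sweep ◰ along↔) ∷ blk e+ f0 e+ t0 (sweep ◲ across) ∷
      blk o+ e0 o+ s- (sweep ◳ along↕) ∷ blk t0 e0 s0 t0 (sink ◲) ∷ []) ∷ []) ∷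
    ((blk o+ e0 t+ f0 (source ◲) ∷ blk e+ f0 e+ f0 (sweep ◱ along↕) ∷ blk s0 e0 o+ t0 (sink ◲) ∷ []) ∷ []) ∷
    ((blk o+ s0 o+ s0 (source ◰) ∷ blk s+ e0 o+ e0 (sweep ◰ across) ∷ blk e+ f0 e+ f0 (sweep ◰ along↕) ∷
      blk t+ e0 e+ f0 (sweep ◲ across) ∷ blk s+ t0 e+ s0 (sweep ◰ across) ∷ blk o+ t0 s+ f0 (sink ◱) ∷ []) ∷ []) ∷
    ((blk o+ s0 o+ s0 (source ◰) ∷ blk t0 e0 o+ e0 (sweep ◰ along↕) ∷ blk s+ t0 e+ s- (sweep ◰ across) ∷
      blk t+ f0 e+ t0 (sweep ◱ along↔) ∷ blk s0 f0 t+ f0 (sweep ◳ across) ∷ blk s+ t0 s0 s0 (sink ◲) ∷ []) ∷ []) ∷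
    ((blk o+ s0 o+ t- (source ◰) ∷ blk t0 e0 o+ e0 (sweep ◰ along↕) ∷ blk t0 f0 e+ s- (sweep ◰ across) ∷
      blk t+ f0 s0 f0 (sweep ◳ across) ∷ blk s+ t0 s0 s0 (sweep ◰ across) ∷ blk s0 t0 s+ f0 (sink ◱) ∷ []) ∷ []) ∷
    ((blk s0 e0 s0 s0 (source ◰) ∷ blk o+ s- o+ t0 (sweep ◱ across) ∷ blk t0 e0 o+ e0 (sweep ◰ across) ∷
      blk s0 f0 e+ s- (sweep ◳ across) ∷ blk e+ f0 s0 f0 (sweep ◰ across) ∷ blk t0 e0 t0 f0 (sink ◳) ∷ []) ∷ []) ∷
    ((blk s0 s0 e+ s0 (source ◰) ∷ blk o+ t- e+ f0 (sweep ◳ along↔) ∷ blk o+ e0 o+ e0 (sweep ◱ along↔) ∷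
      blk s+ f0 e+ t0 (sweep ◰ across) ∷ blk s0 e0 t0 f0 (sink ◲) ∷ []) ∷ []) ∷
    ((blk o+ s0 e+ s0 (source ◰) ∷ blk o+ e0 o+ e0 (sweep ◱ along↔) ∷ blk e+ f0 e+ f0 (sweep ◰ along↕) ∷
      blk o+ e0 t+ f0 (sweep ◲ along↕) ∷ blk s+ e0 e+ s0 (sink ◲) ∷ []) ∷ []) ∷
    ((blk o+ t- o+ t0 (source ◰) ∷ blk t0 e0 o+ s- (sweep ◰ across) ∷ blk e+ f0 t0 f0 (sweep ◰ along↕) ∷
      blk t+ e0 s0 f0 (sweep ◲ across) ∷ blk o+ t0 t+ f0 (sweep ◳ across) ∷ blk t0 t0 e+ t0 (sink ◱) ∷ []) ∷ []) ∷
    ((blk s0 s0 o+ s0 (source ◰) ∷ blk t0 t0 o+ e0 (sweep ◰ across) ∷ blk s+ f0 e+ t- (sweep ◰ across) ∷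
      blk e+ f0 s0 f0 (sweep ◰ across) ∷ blk o+ e0 t+ f0 (sweep ◲ across) ∷ blk s+ e0 t0 t0 (sink ◱) ∷ []) ∷ []) ∷ []) stuck

-- Symmetries of the decision trees

mapTree : (Atom 5 → Atom 5) → (Rect 5 → Rect 5) → (Plan 5 → Plan 5) → Tree → Tree
mapTree onAtom onRect onPlan (split a t u) = split (onAtom a) (mapTree onAtom onRect onPlan t) (mapTree onAtom onRect onPlan u)
mapTree onAtom onRect onPlan (try (item extra regions options) t) =
  try (item (map onAtom extra) (map (map onRect) regions) (map (map₂ onPlan) options)) (mapTree onAtom onRect onPlan t)
mapTree onAtom onRect onPlan stuck = stuck

-- Reading a path backwards exchanges s and t: the blocks come in reverse order, sources become
-- sinks, and each sweep starts at its former end. The result is checked like any other tree, so no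
-- invariance has to be proved.
swapTree : Tree → Tree
swapTree = mapTree (λ (atom ax t u) → atom ax (term t) (term u)) area′ (reverse ∘ map block′)
  where
  term : Term 5 → Term 5
  term (𝕤 ⊹ k) = 𝕥 ⊹ k
  term (𝕥 ⊹ k) = 𝕤 ⊹ k
  term t       = t
  area′ : Rect 5 → Rect 5
  area′ (rect x₁ x₂ y₁ y₂) = rect (term x₁) (term x₂) (term y₁) (term y₂)
  kind′ : Kind → Kind
  kind′ (sweep c mode) = sweep (opposite mode c) mode
  kind′ (source c)     = sink c
  kind′ (sink c)       = source c
  block′ : Block 5 → Block 5
  block′ (block R k) = block (area′ R) (kind′ k)

-- Reflecting the plane by (x , y) ↦ (n + 1 − y , m + 1 − x), which exchanges
-- the two arms.
flipTree : Tree → Tree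
flipTree = mapTree (λ (atom ax t u) → atom (other ax) (term u) (term t)) area′ (map block′)
  where
  other : Axis → Axis
  other ξ = η
  other η = ξ
  term : Term 5 → Term 5
  term (𝕠 ⊹ k) = 𝕗 ⊹ (1ℤ -ℤ k)
  term (𝕖 ⊹ k) = 𝕖 ⊹ (1ℤ -ℤ k)
  term (𝕗 ⊹ k) = 𝕠 ⊹ (1ℤ -ℤ k)
  term (𝕤 ⊹ k) = 𝕤 ⊹ (-ℤ k)
  term (𝕥 ⊹ k) = 𝕥 ⊹ (-ℤ k)
  area′ : Rect 5 → Rect 5
  area′ (rect x₁ x₂ y₁ y₂) = rect (term y₂) (term y₁) (term x₂) (term x₁)
  corner′ : Corner → Corner
  corner′ (r , b) = not b , not r
  kind′ : Kind → Kind
  kind′ (sweep c across)  = sweep (corner′ c) across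
  kind′ (sweep c along↔) = sweep (corner′ c) along↕
  kind′ (sweep c along↕) = sweep (corner′ c) along↔
  kind′ (source c)        = source (corner′ c)
  kind′ (sink c)          = sink (corner′ c)
  block′ : Block 5 → Block 5
  block′ (block R k) = block (area′ R) (kind′ k)

-- The complete case distinction

classify : Term 5 → (T K E : Tree) → Tree
classify v T K E = split (atom ξ v e0) (split (atom η v e0) T K) (split (atom η v e0) stuck E)

-- The tables are written for s before t; the other order is obtained by reversal.
ordered : Axis → Tree → Tree → Tree
ordered ax distinct same =
  split (atom ax s+ t0) distinct (split (atom ax t+ s0) (swapTree distinct) same)

lexicographic : Tree → Tree
lexicographic tree = ordered ξ tree (ordered η tree stuck)

-- m − k ≤ 1
thin : Tree
thin = classify s0
  (classify t0 (ordered η thin-TT stuck) (split single-row thin-TK thin-T-thick) (split single-row thin-TE thin-T-thick))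
  (classify t0 (swapTree (split single-row thin-TK thin-T-thick)) (split single-row stuck rest) (split single-row thin-KE rest))
  (classify t0 (swapTree (split single-row thin-TE thin-T-thick)) (split single-row (swapTree thin-KE) rest) (split single-row (ordered ξ thin-EE stuck) rest))
  where
  single-row = atom η f0 e+
  rest = lexicographic thin-rest

-- m − k ≥ 2 and n − l ≥ 2
thick : Tree
thick = classify s0
  (classify t0 (lexicographic thick-TT) thick-TK thick-TE)
  (classify t0 (swapTree thick-TK) (lexicographic thick-KK) (swapTree (flipTree thick-TK)))
  (classify t0 (swapTree thick-TE) (flipTree thick-TK) (flipTree (lexicographic thick-TT)))

-- If only the horizontal arm has width one, the reflection makes it the vertical one.
solution : Tree
solution = split (atom ξ e0 o+) thin (split (atom η f0 e+) (flipTree thin) thick)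

premises : List (Atom 5)
premises = sides ξ ++ sides η
  where
  sides : Axis → List (Atom 5)
  sides ax = atom ax o+ e0 ∷ atom ax e+ f0 ∷ atom ax o+ s0 ∷ atom ax s0 f0 ∷ atom ax o+ t0 ∷ atom ax t0 f0 ∷ []

-- Vertices and paths of L

-[i-j]≡j-i : ∀ i j → -ℤ (i -ℤ j) ≡ j -ℤ i
-[i-j]≡j-i i j = trans (ℤₚ.neg-distrib-+ i (-ℤ j)) (trans (cong (-ℤ i +ℤ_) (ℤₚ.neg-involutive j)) (ℤₚ.+-comm (-ℤ i) j))

∣i-j∣≤1⇒≈ : ∀ i j → ∣ i -ℤ j ∣ ≤ 1 → i ≈ᶻ j
∣i-j∣≤1⇒≈ i j p = below i j p , below j i (subst (_≤ 1) (trans (sym (ℤₚ.∣-i∣≡∣i∣ (i -ℤ j))) (cong ∣_∣ (-[i-j]≡j-i i j))) p)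
  where
  small : ∀ d → ∣ d ∣ ≤ 1 → d ≤ℤ 1ℤ
  small (pos n)  p = +≤+ p
  small -[1+ n ] p = -≤+
  below : ∀ i j → ∣ i -ℤ j ∣ ≤ 1 → i ≤ℤ sucℤ j
  below i j p = subst (_≤ℤ sucℤ j) (trans (ℤₚ.+-assoc i (-ℤ j) j) (trans (cong (i +ℤ_) (ℤₚ.+-inverseˡ j)) (ℤₚ.+-identityʳ i)))
    (ℤₚ.+-monoˡ-≤ j (small (i -ℤ j) p))

≈⇒∣i-j∣≤1 : ∀ i j → i ≈ᶻ j → ∣ i -ℤ j ∣ ≤ 1
≈⇒∣i-j∣≤1 i j (p , q) = small (i -ℤ j) (difference i j p) (subst (_≤ℤ 1ℤ) (sym (-[i-j]≡j-i i j)) (difference j i q))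
  where
  difference : ∀ i j → i ≤ℤ sucℤ j → i -ℤ j ≤ℤ 1ℤ
  difference i j p = subst (i -ℤ j ≤ℤ_) (trans (ℤₚ.+-assoc 1ℤ j (-ℤ j)) (cong (1ℤ +ℤ_) (ℤₚ.+-inverseʳ j))) (ℤₚ.+-monoˡ-≤ (-ℤ j) p)
  small : ∀ d → d ≤ℤ 1ℤ → -ℤ d ≤ℤ 1ℤ → ∣ d ∣ ≤ 1
  small (pos n)  (+≤+ p) _       = p
  small -[1+ n ] _       (+≤+ p) = p

grid : ℕ → ℕ → List Point
grid m n = cartesianProduct (map (pos ∘ suc) (upTo m)) (map (pos ∘ suc) (upTo n))

length-grid : ∀ m n → length (grid m n) ≡ m * n
length-grid m n = trans (length-product (map (pos ∘ suc) (upTo m)) _) (cong₂ _*_ (columns′ m) (columns′ n))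
  where
  columns′ : ∀ m → length (map (pos ∘ suc) (upTo m)) ≡ m
  columns′ m = trans (length-map (pos ∘ suc) (upTo m)) (length-upTo m)
  length-product : ∀ {A B : Set} (xs : List A) (ys : List B) → length (cartesianProduct xs ys) ≡ length xs * length ys
  length-product []       ys = refl
  length-product (x ∷ xs) ys = trans (length-++ (map (x ,_) ys)) (cong₂ _+_ (length-map (x ,_) ys) (length-product xs ys))

∈-grid : ∀ {m n z} → InBox 1ℤ (pos m) 1ℤ (pos n) z → z ∈ grid m n
∈-grid ((+≤+ {n = suc x} _ , +≤+ p) , (+≤+ {n = suc y} _ , +≤+ q)) =
  ∈-cartesianProduct⁺ (∈-map⁺ (pos ∘ suc) (∈-upTo⁺ p)) (∈-map⁺ (pos ∘ suc) (∈-upTo⁺ q))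

-- Uniqueness supplies the inequality of neighbours that `_~_` leaves out.
linked-adjacent : ∀ {P : Point → Set} {xs} → Linked _~_ xs → Unique xs → All P xs → Linked (Adj (induced supergrid P)) xs
linked-adjacent []  _ _ = []
linked-adjacent [-] _ _ = [-]
linked-adjacent (_∷_ {x = u} {v} (p , q) l) ((u≢v ∷ _) ∷ us) (a ∷ b ∷ as) =
  ((u≢v , ≈⇒∣i-j∣≤1 (proj₁ u) (proj₁ v) p , ≈⇒∣i-j∣≤1 (proj₂ u) (proj₂ v) q) , a , b) ∷ linked-adjacent l us (b ∷ as)

-- The program and its correctness

program : Tree → Program
program tree = 9 ≔ var 0 ⊖ var 2 ⨾ compile tree ⨾ 0 ≔ var cnt

Solves : Tree → Set
Solves tree = Under (assumeAll anything premises) (λ ρ → Legal ρ → Outcome ρ tree)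

module Instance (m n k l : ℕ) (s t : Point) (k≤m : k ≤ m) (1≤m-k : 1 ≤ m ∸ k) (1≤k : 1 ≤ k) (1≤l : 1 ≤ l) (l<n : l < n)
  (s∈ : Vertex (L m n k l) s) (t∈ : Vertex (L m n k l) t) (s≢t : s ≢ t) where

  initial : State
  initial = ⟪ reg (input m n k l s t) [ 9 ↦ m ∸ k ] , mem (input m n k l s t) ⟫

  ρ : Env 5
  ρ ax v = pos (reg initial (layoutᴸ ax v))

  magnitude : ∀ {i} → 1ℤ ≤ℤ i → pos ∣ i ∣ +ℤ 0ℤ ≡ i
  magnitude (+≤+ {n = j} _) = cong pos (+-identityʳ j)

  at-sᴾ : at ρ sᴾ ≡ s
  at-sᴾ = let ((x , _) , (y , _)) , _ = proj₂ s∈ in cong₂ _,_ (magnitude x) (magnitude y)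

  at-T : at ρ tᴾ ≡ t
  at-T = let ((x , _) , (y , _)) , _ = proj₂ t∈ in cong₂ _,_ (magnitude x) (magnitude y)

  plus-0 : ∀ {i j} → i ≤ℤ pos j → i ≤ℤ pos (j + 0)
  plus-0 {i} {j} = subst (i ≤ℤ_) (cong pos (sym (+-identityʳ j)))

  minus-0 : ∀ {i j} → i ≤ℤ pos (j + 0) → i ≤ℤ pos j
  minus-0 {i} {j} = subst (i ≤ℤ_) (cong pos (+-identityʳ j))

  next : ∀ {i j} → ¬ i ≤ℤ pos j → pos (j + 1) ≤ℤ i
  next {i} {j} p = subst (_≤ℤ i) (cong pos (+-comm 1 j)) (ℤₚ.i<j⇒suc[i]≤j (ℤₚ.≰⇒> p))

  not-next : ∀ {i j} → pos (j + 1) ≤ℤ i → ¬ i ≤ℤ pos j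
  not-next {i} {j} p q = <-irrefl refl (≤-trans (≤-reflexive (+-comm 1 j)) (ℤₚ.drop‿+≤+ (ℤₚ.≤-trans p q)))

  cut : (pos m -ℤ pos k) +ℤ 1ℤ ≡ pos (m ∸ k + 1)
  cut = cong (_+ℤ 1ℤ) (trans (ℤₚ.m-n≡m⊖n m k) (ℤₚ.⊖-≥ k≤m))

  vertex⇒shape : ∀ {z} → Vertex (L m n k l) z → InRegion ρ shape z
  vertex⇒shape {x , y} (_ , ((x₁ , x₂) , (y₁ , y₂)) , ¬hole) with x ℤₚ.≤? pos (m ∸ k)
  ... | yes p = here ((x₁ , plus-0 p) , (y₁ , plus-0 y₂))
  ... | no ¬p = there (here ((next ¬p , plus-0 x₂) , (next (λ q → ¬hole ((subst (_≤ℤ x) (sym cut) (next ¬p) , x₂) , (y₁ , q))) , plus-0 y₂)))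

  shape⇒vertex : ∀ {z} → InRegion ρ shape z → Vertex (L m n k l) z
  shape⇒vertex {x , y} (here ((x₁ , x₂) , (y₁ , y₂))) =
    tt , ((x₁ , ℤₚ.≤-trans (minus-0 x₂) (+≤+ (m∸n≤m m k))) , (y₁ , minus-0 y₂)) ,
    λ ((p , _) , _) → not-next (subst (_≤ℤ x) cut p) (minus-0 x₂)
  shape⇒vertex {x , y} (there (here ((x₁ , x₂) , (y₁ , y₂)))) =
    tt , ((ℤₚ.≤-trans (+≤+ (m≤n+m 1 (m ∸ k))) x₁ , minus-0 x₂) , (ℤₚ.≤-trans (+≤+ (m≤n+m 1 l)) y₁ , minus-0 y₂)) ,
    λ (_ , (_ , q)) → not-next y₁ q

  path⇒STPath : ∀ {q} → IsPath (L m n k l) s t q → STPath ρ q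
  path⇒STPath path = trans (IsPath.starts path) (cong just (sym at-sᴾ)) , suffix (All.map vertex⇒shape (IsPath.vertices path))
    (Linked.map (λ {u} {v} ((_ , p , q) , _) → ∣i-j∣≤1⇒≈ (proj₁ u) (proj₁ v) p , ∣i-j∣≤1⇒≈ (proj₂ u) (proj₂ v) q) (IsPath.linked path))
    (IsPath.simple path) (trans (IsPath.ends path) (cong just (sym at-T)))

  STPath⇒path : ∀ {q} → STPath ρ q → IsPath (L m n k l) s t q
  STPath⇒path (starts , suffix valid linked simple ends) = record
    { vertices = All.map shape⇒vertex valid
    ; linked   = linked-adjacent linked simple (All.map (proj₂ ∘ shape⇒vertex) valid)
    ; simple   = simple
    ; starts   = trans starts (cong just at-sᴾ)
    ; ends     = trans ends (cong just at-T) }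

  legal : Legal ρ
  legal = subst (InRegion ρ shape) (sym at-sᴾ) (vertex⇒shape s∈) , subst (InRegion ρ shape) (sym at-T) (vertex⇒shape t∈) ,
    λ eq → s≢t (trans (sym at-sᴾ) (trans eq at-T))

  few : ∀ xs → Unique xs → All (InRegion ρ shape) xs → length xs ≤ m * n
  few xs u inside = ≤-trans (unique-⊆⇒length≤ u (λ z∈ → ∈-grid (proj₁ (proj₂ (shape⇒vertex (All.lookup inside z∈)))))) (≤-reflexive (length-grid m n))

  premises-hold : Sat ρ (assumeAll anything premises)
  premises-hold = let ((sx , sy) , _) = proj₂ s∈; ((tx , ty) , _) = proj₂ t∈ in sat-assumeAll {ρ = ρ} anything premises (sat-anything ρ)
    (+≤+ (0+≤ 1≤m-k) ∷ +≤+ (1+≤ (∸-monoʳ-< 1≤k k≤m)) ∷ ≤S sx ∷ S≤ sx ∷ ≤S tx ∷ S≤ tx ∷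
     +≤+ (0+≤ 1≤l) ∷ +≤+ (1+≤ l<n) ∷ ≤S sy ∷ S≤ sy ∷ ≤S ty ∷ S≤ ty ∷ [])
    where
    0+≤ : ∀ {i j} → i ≤ j → i ≤ j + 0
    0+≤ {i} {j} = subst (i ≤_) (sym (+-identityʳ j))
    1+≤ : ∀ {i j} → suc i ≤ j → i + 1 ≤ j + 0
    1+≤ {i} p = 0+≤ (≤-trans (≤-reflexive (+-comm i 1)) p)
    ≤S : ∀ {i j} → 1ℤ ≤ℤ i × i ≤ℤ pos j → 1ℤ ≤ℤ pos ∣ i ∣ +ℤ 0ℤ
    ≤S {i} (p , _) = subst (1ℤ ≤ℤ_) (sym (magnitude p)) p
    S≤ : ∀ {i j} → 1ℤ ≤ℤ i × i ≤ℤ pos j → pos ∣ i ∣ +ℤ 0ℤ ≤ℤ pos (j + 0)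
    S≤ {i} (p , q) = plus-0 (subst (_≤ℤ _) (sym (magnitude p)) q)

  1≤mn : 1 ≤ m * n
  1≤mn = *-mono-≤ (≤-trans 1≤m-k (m∸n≤m m k)) (≤-trans (s≤s z≤n) l<n)

  computes : ∀ tree → Solves tree → Runs (program tree) (input m n k l s t) ((6 + rateTree tree) * (m * n)) (λ σ → IsLongestPath (L m n k l) s t (output σ))
  -- 6 = 4 + 2 pays for the assignments to registers 9 and 0.
  computes tree solves = runs-weaken (≤-trans (≤-reflexive (cong (4 +_) (+-comm (rateTree tree * (m * n)) 2))) (linear-step 6 {rateTree tree} 1≤mn)) id
    (runs-assign {9} ⟫= λ { refl → runs-tree 1≤mn few (λ _ _ → refl) tree (solves ρ premises-hold legal)
      -- Once the count has been copied to register 0, `output` of the final state is by computation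
      -- `out` of the state before.
      ⟫= λ {σ} (path , best) → runs-weaken ≤-refl (λ { refl → record { isPath = STPath⇒path path ; longest = λ q p → best q (path⇒STPath p) } }) (runs-assign {0}) })

-- Stated for an arbitrary tree: correctness and running time use the table only through `Solves`.
algorithm : ∀ tree → Solves tree → Σ[ P ∈ Program ] Σ[ C ∈ ℕ ]
    (∀ (m n k l : ℕ) → 1 < m → 1 < n → 1 ≤ k → 1 ≤ l → 1 ≤ m ∸ k → 1 ≤ n ∸ l →
    ∀ (s t : Point) → Vertex (L m n k l) s → Vertex (L m n k l) t → s ≢ t →
    Σ[ σ ∈ State ] Σ[ time ∈ ℕ ]
    (⟨ P , input m n k l s t ⟩⇓[ time ] σ) ×
    (time ≤ C * (m * n)) ×
    IsLongestPath (L m n k l) s t (output σ))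
algorithm tree solves = program tree , 6 + rateTree tree , λ m n k l _ _ 1≤k 1≤l 1≤m-k 1≤n-l s t s∈ t∈ s≢t →
  let runs e b post = Instance.computes m n k l s t (<⇒≤ (m∸n≢0⇒n<m (>⇒≢ 1≤m-k))) 1≤m-k 1≤k 1≤l (m∸n≢0⇒n<m (>⇒≢ 1≤n-l)) s∈ t∈ s≢t tree solves
  in _ , _ , e , b , post

-- All of the case analysis takes place in this evaluation: the plans are exhaustive under the
-- premises, each applicable item is optimal, and every stuck branch is illegal.
checked : is-just (solves? solution (assumeAll anything premises)) ≡ true
checked = refl

solves : Solves solution
solves = found (solves? solution (assumeAll anything premises)) checked

theorem4 : Σ[ P ∈ Program ] Σ[ C ∈ ℕ ]
    (∀ (m n k l : ℕ) → 1 < m → 1 < n → 1 ≤ k → 1 ≤ l → 1 ≤ m ∸ k → 1 ≤ n ∸ l →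
    ∀ (s t : Point) → Vertex (L m n k l) s → Vertex (L m n k l) t → s ≢ t →
    Σ[ σ ∈ State ] Σ[ time ∈ ℕ ]
    (⟨ P , input m n k l s t ⟩⇓[ time ] σ) ×
    (time ≤ C * (m * n)) ×
    IsLongestPath (L m n k l) s t (output σ))
theorem4 = algorithm solution solves
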